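{- Let $r(n)$ denote the probability that for two partitions $\lambda,\mu$ of $n$, chosen independently and uniformly at random among all partitions of $n$, we have $\lambda \preceq \mu$. Then there is a constant $C>0$ such that for all $n\geq 1$, $$r(n) \leq C n^{ -0.003297210314}.$$
   Context: For partitions $\alpha=(\alpha_1\geq\alpha_2\geq\cdots)$ and $\beta=(\beta_1\geq \beta_2\geq \cdots)$ of $n$ (padded with zeros), the dominance order is defined by $\alpha \preceq \beta$ if and only if $\sum_{j=1}^i \alpha_j \leq \sum_{j=1}^i \beta_j$ for all $i \geq 1$. -}

module Defs where

open import Data.Nat using (ℕ; zero; suc; _+_; _*_; _^_; _≤_; _≥_; _≤?_; _<_)
open import Data.Nat.Properties using (≤-refl; ≤-trans; m≤m+n; m≤n+m; ≰⇒>; <⇒≤; ≤-pred)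
open import Data.Nat.ListAction using (sum)
open import Data.List using (List; []; _∷_; take; length; concatMap; map; filter; upTo; cartesianProduct)
open import Data.List.Properties using (take-all)
open import Data.List.Relation.Unary.Linked using (Linked; linked?)
open import Data.List.Relation.Unary.All using (All)
open import Data.List.Relation.Unary.All.Properties using ()
import Data.List.Relation.Unary.All as All
open import Data.Fin using (Fin; toℕ; fromℕ<)
open import Data.Fin.Properties using (all?; toℕ-fromℕ<)
open import Data.Product using (_×_; _,_; proj₁; proj₂)
open import Relation.Nullary using (Dec; yes; no; ¬_)
open import Relation.Nullary.Decidable using (_×-dec_)
open import Relation.Binary.PropositionalEquality using (_≡_; subst₂; sym; trans; cong)
import Data.Nat as ℕ

-- Partitions of n are represented as weakly decreasing lists of positive
-- naturals summing to n (trailing zeros omitted; see Dominates below).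

listsOfLength : ℕ → ℕ → List (List ℕ)
listsOfLength m zero    = [] ∷ []
listsOfLength m (suc ℓ) =
  concatMap (λ x → map (x ∷_) (listsOfLength m ℓ)) (map suc (upTo m))

-- all lists of length ≤ n with entries in {1,…,n}; each appears exactly once
candidates : ℕ → List (List ℕ)
candidates n = concatMap (listsOfLength n) (upTo (suc n))

IsPartition : ℕ → List ℕ → Set
IsPartition n α = Linked _≥_ α × sum α ≡ n

isPartition? : (n : ℕ) (α : List ℕ) → Dec (IsPartition n α)
isPartition? n α = linked? (λ x y → y ≤? x) α ×-dec (sum α ℕ.≟ n)

partitions : ℕ → List (List ℕ)
partitions n = filter (isPartition? n) (candidates n)

p : ℕ → ℕ
p n = length (partitions n)

-- Dominance order: α ⪯ β iff  Σ_{j≤i} α_j ≤ Σ_{j≤i} β_j  for all i ≥ 1.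
-- `take i` of a list is its length-i prefix (the whole list if i exceeds its
-- length), which matches padding with zeros.
_⪯_ : List ℕ → List ℕ → Set
α ⪯ β = ∀ i → sum (take i α) ≤ sum (take i β)

-- decidability of dominance (checking i ≤ length α + length β suffices)
_⪯?_ : (α β : List ℕ) → Dec (α ⪯ β)
α ⪯? β with all? {n = suc L} (λ (i : Fin (suc L)) → sum (take (toℕ i) α) ≤? sum (take (toℕ i) β))
  where L = length α + length β
... | no ¬h = no (λ h → ¬h (λ i → h (toℕ i)))
... | yes h = yes go
  where
  L = length α + length β
  go : α ⪯ β
  go i with i ≤? L
  ... | yes i≤L = subst₂ (λ a b → sum (take a α) ≤ sum (take b β))
                    (toℕ-fromℕ< (ℕ.s≤s i≤L)) (toℕ-fromℕ< (ℕ.s≤s i≤L))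
                    (h (fromℕ< (ℕ.s≤s i≤L)))
  ... | no i≰L = subst₂ (λ a b → sum a ≤ sum b)
                   (trans (take-all L α (m≤m+n _ _)) (sym (take-all i α (≤-trans (m≤m+n _ _) L≤i))))
                   (trans (take-all L β (m≤n+m _ _)) (sym (take-all i β (≤-trans (m≤n+m _ _) L≤i))))
                   (subst₂ (λ a b → sum (take a α) ≤ sum (take b β))
                     (toℕ-fromℕ< (ℕ.s≤s (≤-refl {L}))) (toℕ-fromℕ< (ℕ.s≤s (≤-refl {L})))
                     (h (fromℕ< (ℕ.s≤s (≤-refl {L})))))
    where
    L≤i : L ≤ i
    L≤i = <⇒≤ (≰⇒> i≰L)

-- number of ordered pairs (λ, μ) of partitions of n with λ ⪯ μ.
-- Thus r(n) = dominatedPairs n / p(n)².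
dominatedPairs : ℕ → ℕ
dominatedPairs n =
  length (filter (λ (ab : List ℕ × List ℕ) → proj₁ ab ⪯? proj₂ ab)
                 (cartesianProduct (partitions n) (partitions n)))

-- Let λ, μ be independent uniform partitions of n. Only the large parts matter: λ ⪯ μ forces Σ (μ_j - t)⁺ ≥ Σ (λ_j - t)⁺ for all t.
--
-- The number f m of partitions of m into parts ≤ θ′ satisfies m f m ≈ ζ(2) f₂ m, where f₂ is the double partial sum of f. This is a
-- Riccati recursion for the ratio w = f₁ / f₂ of the single and double sums, and constant barriers for w show that f (n - s) is, up to
-- constant factors, proportional to r^s. Hence, up to a constant, the multiplicities of the parts v > θ′ have the law of independent
-- geometric variables with parameters r^v; repeated parts are rare and are discarded.
--
-- Reading v downwards, let W be the number of parts of μ minus that of λ and let X be the difference of the two sums above. The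
-- increments of W are independent, symmetric and at most 1, and X accumulates W. Cut the values v into blocks over each of which the
-- expected number of parts grows by the factor 2^12. On such a block X changes by an independent symmetric amount which dominates what
-- came before, so by a fourth moment bound it becomes negative with probability about 1/6. A quadratic Lyapunov function turns this into
-- a loss of the factor 8/9 per block, and 80 k blocks for n ≈ 2^(4000 k) give more than the exponent 0.0033.
module Submission where

-- The range of usable parts comes from an error budget. An error of size `x` in the barriers moves
-- the slope by about `b x`, and over a window of length `x n` this drifts by `b x² n`, which must
-- stay bounded. Since `b` is about n^(-1/2), `x` must be below n^(-1/4): with n ≈ 2^(4000 k) the
-- exponent of `x` has to exceed 1000, and 1020 leaves room for logarithms and constants. The large
-- parts followed by the walk must have total size well inside that window, which puts their lower
-- end at r^v ≈ 2^(-1030 k); there the expected number of repetitions is about 2^(2000 k - 2060 k),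
-- far below the probability to be proved. From 1030 k to 1990 k there are 960 k halvings, twelve
-- per block. As (9/8)^400 ≥ 2^66, the 80 k blocks give the exponent 66 / (5 · 4000) = 0.0033.
-- Everything stays rational: square roots and logarithms are replaced by the last integer
-- satisfying an inequality, exponentials by powers of `r` and Bernoulli's inequality, and laws are
-- compared only up to constant factors.

module Rationals where

  open import Level using (0ℓ)
  open import Data.Nat as ℕ using (ℕ; zero; suc)
  import Data.Nat.Properties as ℕ
  open import Data.Rational
  import Data.Integer as ℤ
  open import Data.Rational.Properties
  open import Data.Maybe using (Maybe; just; nothing)
  open import Data.Product using (_×_; _,_; ∃)
  open import Data.Sum using (inj₁; inj₂)
  open import Data.Empty using (⊥-elim)
  open import Relation.Nullary using (yes; no)
  open import Relation.Binary.PropositionalEquality using (_≡_; refl; sym; trans; cong; cong₂; subst; subst₂)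
  import Tactic.RingSolver.Core.AlmostCommutativeRing as ACR
  open import Tactic.RingSolver using (solve-∀)

  zero? : ∀ x → Maybe (0ℚ ≡ x)
  zero? x with 0ℚ ≟ x
  ... | yes e = just e
  ... | no _  = nothing

  ring : ACR.AlmostCommutativeRing 0ℓ 0ℓ
  ring = ACR.fromCommutativeRing +-*-commutativeRing zero?

  -- Defined by recursion rather than as the fraction n / 1, so that `κ (suc n)` is `1ℚ + κ n` by
  -- computation and ring identities can be stated with a successor in them.
  κ : ℕ → ℚ
  κ zero    = 0ℚ
  κ (suc n) = 1ℚ + κ n

  infix 9 _⁄_
  _⁄_ : (m n : ℕ) .{{_ : ℕ.NonZero n}} → ℚ
  m ⁄ n = ℤ.+ m / n

  infixr 8 _^_
  _^_ : ℚ → ℕ → ℚ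
  x ^ zero  = 1ℚ
  x ^ suc n = x * x ^ n

  Σ< : ℕ → (ℕ → ℚ) → ℚ
  Σ< zero    f = 0ℚ
  Σ< (suc n) f = Σ< n f + f n

  -- Inequalities are proved by certificates: b is exhibited as a plus an expression that is visibly nonnegative.
  by : ∀ {a b c} → 0ℚ ≤ c → b ≡ a + c → a ≤ b
  by {a} {b} {c} h e = subst (a ≤_) (sym e) (subst (_≤ a + c) (+-identityʳ a) (+-monoʳ-≤ a h))

  by< : ∀ {a b c} → 0ℚ < c → b ≡ a + c → a < b
  by< {a} {b} {c} h e = subst (a <_) (sym e) (subst (_< a + c) (+-identityʳ a) (+-monoʳ-< a h))

  infixl 6 _⊕_
  _⊕_ : ∀ {a b} → 0ℚ ≤ a → 0ℚ ≤ b → 0ℚ ≤ a + b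
  _⊕_ = +-mono-≤

  infixl 7 _⊗_
  _⊗_ : ∀ {a b} → 0ℚ ≤ a → 0ℚ ≤ b → 0ℚ ≤ a * b
  _⊗_ {a} {b} ha hb = subst (_≤ a * b) (*-zeroʳ a) (*-monoˡ-≤-nonNeg a {{nonNegative ha}} hb)

  infixl 7 _⊗⁺_
  _⊗⁺_ : ∀ {a b} → 0ℚ < a → 0ℚ < b → 0ℚ < a * b
  _⊗⁺_ {a} {b} ha hb = subst (_< a * b) (*-zeroʳ a) (*-monoʳ-<-pos a {{positive ha}} hb)

  gap : ∀ {a b} → a ≤ b → 0ℚ ≤ b - a
  gap {a} {b} h = subst (_≤ b - a) (+-inverseʳ a) (+-monoˡ-≤ (- a) h)

  ungap : ∀ {a b} → 0ℚ ≤ b - a → a ≤ b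
  ungap {a} {b} h = by h (e a b)
    where e : ∀ a b → b ≡ a + (b - a)
          e = solve-∀ ring

  gap< : ∀ {a b} → a < b → 0ℚ < b - a
  gap< {a} {b} h = subst (_< b - a) (+-inverseʳ a) (+-monoˡ-< (- a) h)

  κ≥0 : ∀ n → 0ℚ ≤ κ n
  κ≥0 zero    = ≤-refl
  κ≥0 (suc n) = nonNegative⁻¹ 1ℚ ⊕ κ≥0 n

  κ>0 : ∀ n → 0ℚ < κ (suc n)
  κ>0 n = <-≤-trans (positive⁻¹ 1ℚ) (by (κ≥0 n) refl)

  κ-+ : ∀ m n → κ (m ℕ.+ n) ≡ κ m + κ n
  κ-+ zero    n = sym (+-identityˡ _)
  κ-+ (suc m) n = trans (cong (1ℚ +_) (κ-+ m n)) (sym (+-assoc 1ℚ (κ m) (κ n)))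

  κ-* : ∀ m n → κ (m ℕ.* n) ≡ κ m * κ n
  κ-* zero    n = sym (*-zeroˡ (κ n))
  κ-* (suc m) n = trans (κ-+ n (m ℕ.* n)) (trans (cong (κ n +_) (κ-* m n)) (e (κ m) (κ n)))
    where e : ∀ a b → b + a * b ≡ (1ℚ + a) * b
          e = solve-∀ ring

  κ-^ : ∀ m n → κ (m ℕ.^ n) ≡ κ m ^ n
  κ-^ m zero    = refl
  κ-^ m (suc n) = trans (κ-* m (m ℕ.^ n)) (cong (κ m *_) (κ-^ m n))

  κ-mono : ∀ {m n} → m ℕ.≤ n → κ m ≤ κ n
  κ-mono (ℕ.z≤n {n}) = κ≥0 n
  κ-mono (ℕ.s≤s m≤n) = +-monoʳ-≤ 1ℚ (κ-mono m≤n)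

  κ-mono-< : ∀ {m n} → m ℕ.< n → κ m < κ n
  κ-mono-< {zero}  {suc n} _           = κ>0 n
  κ-mono-< {suc m} {suc n} (ℕ.s≤s m<n) = +-monoʳ-< 1ℚ (κ-mono-< m<n)

  κ-cancel-≤ : ∀ {m n} → κ m ≤ κ n → m ℕ.≤ n
  κ-cancel-≤ {m} {n} h with m ℕ.≤? n
  ... | yes m≤n = m≤n
  ... | no m≰n  = ⊥-elim (<-irrefl refl (<-≤-trans (κ-mono-< (ℕ.≰⇒> m≰n)) h))

  κ-∸ : ∀ {m n} → n ℕ.≤ m → κ (m ℕ.∸ n) ≡ κ m - κ n
  κ-∸ {m} {n} h = trans (e (κ (m ℕ.∸ n)) (κ n)) (cong (_- κ n) (trans (sym (κ-+ (m ℕ.∸ n) n)) (cong κ (ℕ.m∸n+n≡m h))))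
    where e : ∀ a b → a ≡ a + b - b
          e = solve-∀ ring

  *-monoʳ : ∀ {a b c} → 0ℚ ≤ c → a ≤ b → c * a ≤ c * b
  *-monoʳ {c = c} h = *-monoˡ-≤-nonNeg c {{nonNegative h}}

  *-monoˡ : ∀ {a b c} → 0ℚ ≤ c → a ≤ b → a * c ≤ b * c
  *-monoˡ {c = c} h = *-monoʳ-≤-nonNeg c {{nonNegative h}}

  *-mono : ∀ {a b c d} → 0ℚ ≤ a → 0ℚ ≤ d → a ≤ b → c ≤ d → a * c ≤ b * d
  *-mono ha hd ab cd = ≤-trans (*-monoʳ ha cd) (*-monoˡ hd ab)

  *-cancelˡ : ∀ {a b c} → 0ℚ < c → c * a ≤ c * b → a ≤ b
  *-cancelˡ {c = c} h = *-cancelˡ-≤-pos c {{positive h}}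

  inv : ∀ {x} → 0ℚ < x → ∃ λ y → 0ℚ < y × x * y ≡ 1ℚ
  inv {x} h = (1/ x) {{nz}} , positive⁻¹ _ {{1/pos⇒pos x {{positive h}}}} , *-inverseʳ x {{nz}}
    where nz = pos⇒nonZero x {{positive h}}

  sq≥0 : ∀ x → 0ℚ ≤ x * x
  sq≥0 x with ≤-total 0ℚ x
  ... | inj₁ h = h ⊗ h
  ... | inj₂ h = subst (0ℚ ≤_) (e x) (-x≥0 ⊗ -x≥0)
    where e : ∀ x → (- x) * (- x) ≡ x * x
          e = solve-∀ ring
          -x≥0 : 0ℚ ≤ - x
          -x≥0 = neg-antimono-≤ h

  -- Stands in for taking square roots: slopes of order n^(-1/2) are bounded by comparing squares.
  sq-cancel-≤ : ∀ {a b} → 0ℚ ≤ b → a * a ≤ b * b → a ≤ b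
  sq-cancel-≤ {a} {b} hb h with ≤-total a b
  ... | inj₁ ab = ab
  ... | inj₂ ba with b <? a
  ...   | no ¬ba = ≮⇒≥ ¬ba
  ...   | yes b<a = ⊥-elim (<-irrefl refl (<-≤-trans lt h))
    where
    e : ∀ a b → a * a ≡ b * b + ((a - b) * (a - b) + κ 2 * b * (a - b))
    e = solve-∀ ring
    lt : b * b < a * a
    lt = by< (<-≤-trans (gap< b<a ⊗⁺ gap< b<a) (by (κ≥0 2 ⊗ hb ⊗ gap ba) refl)) (e a b)

  ^≥0 : ∀ {x} n → 0ℚ ≤ x → 0ℚ ≤ x ^ n
  ^≥0 zero    h = nonNegative⁻¹ 1ℚ
  ^≥0 (suc n) h = h ⊗ ^≥0 n h

  ^>0 : ∀ {x} n → 0ℚ < x → 0ℚ < x ^ n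
  ^>0 zero    h = positive⁻¹ 1ℚ
  ^>0 (suc n) h = h ⊗⁺ ^>0 n h

  ^-+ : ∀ x m n → x ^ (m ℕ.+ n) ≡ x ^ m * x ^ n
  ^-+ x zero    n = sym (*-identityˡ _)
  ^-+ x (suc m) n = trans (cong (x *_) (^-+ x m n)) (sym (*-assoc x (x ^ m) (x ^ n)))

  1^ : ∀ n → 1ℚ ^ n ≡ 1ℚ
  1^ zero    = refl
  1^ (suc n) = trans (*-identityˡ _) (1^ n)

  *-^ : ∀ x y n → (x * y) ^ n ≡ x ^ n * y ^ n
  *-^ x y zero    = refl
  *-^ x y (suc n) = trans (cong (x * y *_) (*-^ x y n)) (e x y (x ^ n) (y ^ n))
    where e : ∀ x y a b → x * y * (a * b) ≡ x * a * (y * b)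
          e = solve-∀ ring

  ^-* : ∀ x m n → x ^ (m ℕ.* n) ≡ (x ^ n) ^ m
  ^-* x zero    n = refl
  ^-* x (suc m) n = trans (^-+ x n (m ℕ.* n)) (cong (x ^ n *_) (^-* x m n))

  ^-monoˡ : ∀ {x y} n → 0ℚ ≤ x → x ≤ y → x ^ n ≤ y ^ n
  ^-monoˡ zero    hx h = ≤-refl
  ^-monoˡ (suc n) hx h = *-mono hx (^≥0 n (≤-trans hx h)) h (^-monoˡ n hx h)

  ^≥1 : ∀ {x} n → 1ℚ ≤ x → 1ℚ ≤ x ^ n
  ^≥1 {x} n h = subst (_≤ x ^ n) (1^ n) (^-monoˡ n (nonNegative⁻¹ 1ℚ) h)

  ^≤1 : ∀ {x} n → 0ℚ ≤ x → x ≤ 1ℚ → x ^ n ≤ 1ℚ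
  ^≤1 {x} n h0 h = subst (x ^ n ≤_) (1^ n) (^-monoˡ n h0 h)

  ^-antimonoʳ : ∀ {x m n} → 0ℚ ≤ x → x ≤ 1ℚ → m ℕ.≤ n → x ^ n ≤ x ^ m
  ^-antimonoʳ {x} {m} {n} h0 h1 mn =
    subst (λ k → x ^ k ≤ x ^ m) (ℕ.m+[n∸m]≡n mn)
      (subst₂ _≤_ (sym (^-+ x m (n ℕ.∸ m))) (*-identityʳ (x ^ m)) (*-monoʳ (^≥0 m h0) (^≤1 (n ℕ.∸ m) h0 h1)))

  ^-monoʳ : ∀ {x m n} → 1ℚ ≤ x → m ℕ.≤ n → x ^ m ≤ x ^ n
  ^-monoʳ {x} {m} {n} h mn =
    subst (λ k → x ^ m ≤ x ^ k) (ℕ.m+[n∸m]≡n mn)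
      (subst₂ _≤_ (*-identityʳ (x ^ m)) (sym (^-+ x m (n ℕ.∸ m)))
        (*-monoʳ (^≥0 m (≤-trans (nonNegative⁻¹ 1ℚ) h)) (^≥1 (n ℕ.∸ m) h)))

  -- Together with `bernoulli⁻` this does the work of estimates for the exponential function; in
  -- particular the two bounds locate the half-life of `r` up to a constant factor.
  bernoulli : ∀ x n → 0ℚ ≤ x → 1ℚ + κ n * x ≤ (1ℚ + x) ^ n
  bernoulli x zero    h = ≤-reflexive (e x)
    where e : ∀ x → 1ℚ + 0ℚ * x ≡ 1ℚ
          e = solve-∀ ring
  bernoulli x (suc n) h = ≤-trans (by (κ≥0 n ⊗ (h ⊗ h)) (e x (κ n))) (*-monoʳ (nonNegative⁻¹ 1ℚ ⊕ h) (bernoulli x n h))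
    where e : ∀ x k → (1ℚ + x) * (1ℚ + k * x) ≡ 1ℚ + (1ℚ + k) * x + k * (x * x)
          e = solve-∀ ring

  bernoulli⁻ : ∀ x n → 0ℚ ≤ x → x ≤ 1ℚ → 1ℚ - κ n * x ≤ (1ℚ - x) ^ n
  bernoulli⁻ x zero    h h1 = ≤-reflexive (e x)
    where e : ∀ x → 1ℚ - 0ℚ * x ≡ 1ℚ
          e = solve-∀ ring
  bernoulli⁻ x (suc n) h h1 = ≤-trans (by (κ≥0 n ⊗ (h ⊗ h)) (e x (κ n))) (*-monoʳ (gap h1) (bernoulli⁻ x n h h1))
    where e : ∀ x k → (1ℚ - x) * (1ℚ - k * x) ≡ 1ℚ - (1ℚ + k) * x + k * (x * x)
          e = solve-∀ ring

  Σ<-cong : ∀ n {f g : ℕ → ℚ} → (∀ i → i ℕ.< n → f i ≡ g i) → Σ< n f ≡ Σ< n g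
  Σ<-cong zero    h = refl
  Σ<-cong (suc n) h = cong₂ _+_ (Σ<-cong n (λ i l → h i (ℕ.m≤n⇒m≤1+n l))) (h n ℕ.≤-refl)

  Σ<-mono : ∀ n {f g : ℕ → ℚ} → (∀ i → i ℕ.< n → f i ≤ g i) → Σ< n f ≤ Σ< n g
  Σ<-mono zero    h = ≤-refl
  Σ<-mono (suc n) h = +-mono-≤ (Σ<-mono n (λ i l → h i (ℕ.m≤n⇒m≤1+n l))) (h n ℕ.≤-refl)

  Σ<-* : ∀ n c (f : ℕ → ℚ) → Σ< n (λ i → c * f i) ≡ c * Σ< n f
  Σ<-* zero    c f = sym (*-zeroʳ c)
  Σ<-* (suc n) c f = trans (cong (_+ c * f n) (Σ<-* n c f)) (sym (*-distribˡ-+ c (Σ< n f) (f n)))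

  Σ<-+ : ∀ n (f g : ℕ → ℚ) → Σ< n (λ i → f i + g i) ≡ Σ< n f + Σ< n g
  Σ<-+ zero    f g = refl
  Σ<-+ (suc n) f g = trans (cong (_+ (f n + g n)) (Σ<-+ n f g)) (e (Σ< n f) (Σ< n g) (f n) (g n))
    where e : ∀ a b c d → a + b + (c + d) ≡ a + c + (b + d)
          e = solve-∀ ring

  Σ<≥0 : ∀ n {f : ℕ → ℚ} → (∀ i → i ℕ.< n → 0ℚ ≤ f i) → 0ℚ ≤ Σ< n f
  Σ<≥0 zero    h = ≤-refl
  Σ<≥0 (suc n) h = Σ<≥0 n (λ i l → h i (ℕ.m≤n⇒m≤1+n l)) ⊕ h n ℕ.≤-refl

-- Sums along arithmetic progressions and the cell count of partitions.

module CellSums where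

  open import Data.Nat as ℕ using (ℕ; zero; suc)
  import Data.Nat.Properties as ℕ
  open import Data.Rational
  open import Data.Rational.Properties
  open import Data.Product using (_,_; ∃; Σ; proj₁; proj₂)
  open import Data.Sum using (_⊎_; inj₁; inj₂)
  open import Relation.Nullary using (yes; no)
  open import Relation.Binary.PropositionalEquality using (_≡_; refl; sym; trans; cong; cong₂; subst; subst₂)
  open import Tactic.RingSolver using (solve-∀)
  open Rationals

  ℕ-split : ∀ m k → m ℕ.< k ⊎ ∃ λ m′ → m ≡ k ℕ.+ m′
  ℕ-split m k with m ℕ.<? k
  ... | yes l = inj₁ l
  ... | no m≮k = inj₂ (m ℕ.∸ k , sym (ℕ.m+[n∸m]≡n (ℕ.≮⇒≥ m≮k)))

  -- The value f (m - k) extended by zero; truncated subtraction would wrongly give f 0 for m < k.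
  sh : ℕ → (ℕ → ℚ) → ℕ → ℚ
  sh zero    f m       = f m
  sh (suc k) f zero    = 0ℚ
  sh (suc k) f (suc m) = sh k f m

  sh-+ : ∀ k j f m → sh (k ℕ.+ j) f (k ℕ.+ m) ≡ sh j f m
  sh-+ zero    j f m = refl
  sh-+ (suc k) j f m = sh-+ k j f m

  sh-hit : ∀ k f m → sh k f (k ℕ.+ m) ≡ f m
  sh-hit zero    f m = refl
  sh-hit (suc k) f m = sh-hit k f m

  sh-miss : ∀ k f m → m ℕ.< k → sh k f m ≡ 0ℚ
  sh-miss (suc k) f zero    _           = refl
  sh-miss (suc k) f (suc m) (ℕ.s≤s m<k) = sh-miss k f m m<k

  sh-sh : ∀ k j f m → sh k (sh j f) m ≡ sh (k ℕ.+ j) f m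
  sh-sh zero    j f m       = refl
  sh-sh (suc k) j f zero    = refl
  sh-sh (suc k) j f (suc m) = sh-sh k j f m

  sh-cong : ∀ k {f g} m → (∀ i → f i ≡ g i) → sh k f m ≡ sh k g m
  sh-cong zero    m       h = h m
  sh-cong (suc k) zero    h = refl
  sh-cong (suc k) (suc m) h = sh-cong k m h

  sh-linear : ∀ k f g m → sh k (λ i → f i + g i) m ≡ sh k f m + sh k g m
  sh-linear zero    f g m       = refl
  sh-linear (suc k) f g zero    = refl
  sh-linear (suc k) f g (suc m) = sh-linear k f g m

  sh-scale : ∀ k c f m → sh k (λ i → c * f i) m ≡ c * sh k f m
  sh-scale zero    c f m       = refl
  sh-scale (suc k) c f zero    = sym (*-zeroʳ c)
  sh-scale (suc k) c f (suc m) = sh-scale k c f m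

  sh≥0 : ∀ k {f} m → (∀ i → 0ℚ ≤ f i) → 0ℚ ≤ sh k f m
  sh≥0 zero    m       h = h m
  sh≥0 (suc k) zero    h = ≤-refl
  sh≥0 (suc k) (suc m) h = sh≥0 k m h

  sh-mono : ∀ k {f g} m → (∀ i → f i ≤ g i) → sh k f m ≤ sh k g m
  sh-mono zero    m       h = h m
  sh-mono (suc k) zero    h = ≤-refl
  sh-mono (suc k) (suc m) h = sh-mono k m h

  sh-Σ : ∀ k n (f : ℕ → ℕ → ℚ) m → sh k (λ j → Σ< n (λ i → f i j)) m ≡ Σ< n (λ i → sh k (f i) m)
  sh-Σ zero    n f m       = refl
  sh-Σ (suc k) n f zero    = sym (zeros n)
    where zeros : ∀ n → Σ< n (λ _ → 0ℚ) ≡ 0ℚ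
          zeros zero    = refl
          zeros (suc n) = trans (+-identityʳ _) (zeros n)
  sh-Σ (suc k) n f (suc m) = sh-Σ k n f m

  Σ<-front : ∀ n (f : ℕ → ℚ) → Σ< (suc n) f ≡ f 0 + Σ< n (λ i → f (suc i))
  Σ<-front zero    f = +-comm 0ℚ (f 0)
  Σ<-front (suc n) f = trans (cong (_+ f (suc n)) (Σ<-front n f)) (+-assoc (f 0) (Σ< n (λ i → f (suc i))) (f (suc n)))

  Σ<-split : ∀ m n (f : ℕ → ℚ) → Σ< (m ℕ.+ n) f ≡ Σ< m f + Σ< n (λ i → f (m ℕ.+ i))
  Σ<-split m zero    f = trans (cong (λ k → Σ< k f) (ℕ.+-identityʳ m)) (sym (+-identityʳ _))
  Σ<-split m (suc n) f = trans (cong (λ k → Σ< k f) (ℕ.+-suc m n))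
    (trans (cong (_+ f (m ℕ.+ n)) (Σ<-split m n f)) (+-assoc (Σ< m f) (Σ< n (λ i → f (m ℕ.+ i))) (f (m ℕ.+ n))))

  Σ<-swap : ∀ m n (f : ℕ → ℕ → ℚ) → Σ< m (λ i → Σ< n (f i)) ≡ Σ< n (λ j → Σ< m (λ i → f i j))
  Σ<-swap zero    n f = sym (zeros n)
    where zeros : ∀ n → Σ< n (λ _ → 0ℚ) ≡ 0ℚ
          zeros zero    = refl
          zeros (suc n) = trans (+-identityʳ _) (zeros n)
  Σ<-swap (suc m) n f = trans (cong (_+ Σ< n (f m)) (Σ<-swap m n f)) (sym (Σ<-+ n (λ j → Σ< m (λ i → f i j)) (f m)))

  Σ<-zero : ∀ n {f : ℕ → ℚ} → (∀ i → i ℕ.< n → f i ≡ 0ℚ) → Σ< n f ≡ 0ℚ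
  Σ<-zero zero    h = refl
  Σ<-zero (suc n) h = trans (cong₂ _+_ (Σ<-zero n (λ i l → h i (ℕ.m≤n⇒m≤1+n l))) (h n ℕ.≤-refl)) (+-identityʳ 0ℚ)

  -- D L d f m = Σ_{1 ≤ i ≤ L} f (m - i d) and C L d f m = Σ_{1 ≤ i ≤ L} i f (m - i d), with f = 0 on negative arguments.
  D : ℕ → ℕ → (ℕ → ℚ) → ℕ → ℚ
  D L d f m = Σ< L (λ i → sh (suc i ℕ.* d) f m)

  C : ℕ → ℕ → (ℕ → ℚ) → ℕ → ℚ
  C L d f m = Σ< L (λ i → κ (suc i) * sh (suc i ℕ.* d) f m)

  D-miss : ∀ L d f m → m ℕ.< d → D L d f m ≡ 0ℚ
  D-miss L d f m l = Σ<-zero L (λ i _ → sh-miss (suc i ℕ.* d) f m (ℕ.<-≤-trans l (ℕ.m≤m+n d (i ℕ.* d))))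

  D-hit : ∀ L d f m → D (suc L) d f (d ℕ.+ m) ≡ f m + D L d f m
  D-hit L d f m = trans (Σ<-cong (suc L) (λ i _ → sh-+ d (i ℕ.* d) f m)) (Σ<-front L (λ i → sh (i ℕ.* d) f m))

  C-miss : ∀ L d f m → m ℕ.< d → C L d f m ≡ 0ℚ
  C-miss L d f m l = Σ<-zero L λ i _ →
    trans (cong (κ (suc i) *_) (sh-miss (suc i ℕ.* d) f m (ℕ.<-≤-trans l (ℕ.m≤m+n d (i ℕ.* d))))) (*-zeroʳ (κ (suc i)))

  -- Shifting the progression by d raises the weight of every old term by one, hence the extra copy
  -- of `D`: discrete integration by parts.
  C-hit : ∀ L d f m → C (suc L) d f (d ℕ.+ m) ≡ f m + D L d f m + C L d f m
  C-hit L d f m = trans (Σ<-cong (suc L) (λ i _ → cong (κ (suc i) *_) (sh-+ d (i ℕ.* d) f m)))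
    (trans (Σ<-front L (λ i → κ (suc i) * sh (i ℕ.* d) f m))
      (trans (cong₂ _+_ (e₀ (f m)) (trans (Σ<-cong L (λ i _ → e₁ (κ (suc i)) (sh (suc i ℕ.* d) f m)))
         (Σ<-+ L (λ i → sh (suc i ℕ.* d) f m) (λ i → κ (suc i) * sh (suc i ℕ.* d) f m))))
        (sym (+-assoc (f m) (D L d f m) (C L d f m)))))
    where e₀ : ∀ a → (1ℚ + 0ℚ) * a ≡ a
          e₀ = solve-∀ ring
          e₁ : ∀ k a → (1ℚ + k) * a ≡ a + k * a
          e₁ = solve-∀ ring

  module Sums (f : ℕ → ℚ) (f≥0 : ∀ m → 0ℚ ≤ f m) (f-mono : ∀ m → f m ≤ f (suc m)) where

    -- Both sums omit their endpoint, so f₁ grows by f and f₂ by f₁ at the same index; this makes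
    -- the ratio f₁ / f₂ obey a Riccati recursion.
    f₁ f₂ : ℕ → ℚ
    f₁ m = Σ< m f
    f₂ m = Σ< m f₁

    f₁≥0 : ∀ m → 0ℚ ≤ f₁ m
    f₁≥0 m = Σ<≥0 m (λ i _ → f≥0 i)

    f₂≥0 : ∀ m → 0ℚ ≤ f₂ m
    f₂≥0 m = Σ<≥0 m (λ i _ → f₁≥0 i)

    f₁-mono : ∀ m → f₁ m ≤ f₁ (suc m)
    f₁-mono m = by (f≥0 m) refl

    f₂-mono : ∀ m → f₂ m ≤ f₂ (suc m)
    f₂-mono m = by (f₁≥0 m) refl

    window-≥ : ∀ (g : ℕ → ℚ) → (∀ m → g m ≤ g (suc m)) → ∀ d m → Σ< m g + κ d * g m ≤ Σ< (d ℕ.+ m) g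
    window-≥ g mono zero    m = ≤-reflexive (e (Σ< m g) (g m))
      where e : ∀ a b → a + 0ℚ * b ≡ a
            e = solve-∀ ring
    window-≥ g mono (suc d) m = ≤-trans (by (gap (grow d)) (e (Σ< m g) (κ d) (g m) (g (d ℕ.+ m)))) (+-monoˡ-≤ (g (d ℕ.+ m)) (window-≥ g mono d m))
      where e : ∀ s d g a → s + d * g + a ≡ s + (1ℚ + d) * g + (a - g)
            e = solve-∀ ring
            grow : ∀ d → g m ≤ g (d ℕ.+ m)
            grow zero    = ≤-refl
            grow (suc d) = ≤-trans (grow d) (mono (d ℕ.+ m))

    window-≤ : ∀ (g : ℕ → ℚ) → (∀ m → g m ≤ g (suc m)) → ∀ d m → Σ< (d ℕ.+ m) g ≤ Σ< m g + κ d * g (d ℕ.+ m)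
    window-≤ g mono zero    m = ≤-reflexive (e (Σ< m g) (g m))
      where e : ∀ a b → a ≡ a + 0ℚ * b
            e = solve-∀ ring
    window-≤ g mono (suc d) m = ≤-trans (+-monoˡ-≤ (g (d ℕ.+ m)) (window-≤ g mono d m))
        (by ((κ≥0 d ⊕ nonNegative⁻¹ 1ℚ) ⊗ gap (mono (d ℕ.+ m))) (e (Σ< m g) (κ d) (g (d ℕ.+ m)) (g (suc d ℕ.+ m))))
      where e : ∀ s d a b → s + (1ℚ + d) * b ≡ s + d * a + a + (d + 1ℚ) * (b - a)
            e = solve-∀ ring

    -- A lower Riemann sum: d f (m - i d) is at most the sum of f over the d indices from m - i d
    -- on, and these windows are disjoint and stay below m.
    D-upper : ∀ L d m → κ d * D L d f m ≤ f₁ m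
    D-upper zero    d m = subst (_≤ f₁ m) (sym (*-zeroʳ (κ d))) (f₁≥0 m)
    D-upper (suc L) d m with ℕ-split m d
    ... | inj₁ m<d = subst (_≤ f₁ m) (sym (trans (cong (κ d *_) (D-miss (suc L) d f m m<d)) (*-zeroʳ (κ d)))) (f₁≥0 m)
    ... | inj₂ (m′ , refl) = subst (λ x → κ d * x ≤ f₁ m) (sym (D-hit L d f m′))
          (≤-trans (by (gap (D-upper L d m′)) (e (κ d) (f m′) (D L d f m′) (f₁ m′))) (window-≥ f f-mono d m′))
      where e : ∀ k a x s → s + k * a ≡ k * (a + x) + (s - k * x)
            e = solve-∀ ring

    -- The same comparison integrated once more. The term with f₁ is the discretisation error; after
    -- division by d² it becomes f₁ / d, and summing over d produces the harmonic number.
    C-upper : ∀ L d m → κ d * κ d * C L d f m ≤ f₂ m + κ d * f₁ m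
    C-upper zero    d m = subst (_≤ f₂ m + κ d * f₁ m) (sym (*-zeroʳ (κ d * κ d))) (f₂≥0 m ⊕ κ≥0 d ⊗ f₁≥0 m)
    C-upper (suc L) d m with ℕ-split m d
    ... | inj₁ m<d = subst (_≤ f₂ m + κ d * f₁ m) (sym (trans (cong (κ d * κ d *_) (C-miss (suc L) d f m m<d)) (*-zeroʳ (κ d * κ d))))
                       (f₂≥0 m ⊕ κ≥0 d ⊗ f₁≥0 m)
    ... | inj₂ (m′ , refl) = subst (λ x → κ d * κ d * x ≤ f₂ m + κ d * f₁ m) (sym (C-hit L d f m′))
          (≤-trans (by (gap (C-upper L d m′) ⊕ κ≥0 d ⊗ gap (D-upper L d m′))
                       (e (κ d) (f m′) (D L d f m′) (C L d f m′) (f₁ m′) (f₂ m′)))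
                   (+-mono-≤ (window-≥ f₁ f₁-mono d m′) (*-monoʳ (κ≥0 d) (window-≥ f f-mono d m′))))
      where e : ∀ k a x c s t → t + k * s + k * (s + k * a) ≡ k * k * (a + x + c) + ((t + k * s - k * k * c) + k * (s - k * x))
            e = solve-∀ ring

    -- An upper Riemann sum, where f m pays for the window that ends at m. Since the step is at
    -- least one, m ≤ L ensures that the truncated progression already runs below zero.
    D-lower : ∀ L d m → m ℕ.≤ L → f₁ m ≤ κ (suc d) * (f m + D L (suc d) f m)
    D-lower L d m l with ℕ-split m (suc d)
    ... | inj₁ m<d = ≤-trans (subst (λ k → f₁ k ≤ f₁ 0 + κ m * f k) (ℕ.+-identityʳ m) (window-≤ f f-mono m 0))
          (≤-trans (by (gap (κ-mono (ℕ.<⇒≤ m<d)) ⊗ f≥0 m) (e (κ (suc d)) (κ m) (f m)))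
                   (≤-reflexive (cong (λ x → κ (suc d) * (f m + x)) (sym (D-miss L (suc d) f m m<d)))))
      where e : ∀ k j a → k * (a + 0ℚ) ≡ 0ℚ + j * a + (k - j) * a
            e = solve-∀ ring
    D-lower (suc L) d m (ℕ.s≤s l) | inj₂ (m′ , refl) = ≤-trans (window-≤ f f-mono (suc d) m′)
          (≤-trans (by (gap (D-lower L d m′ (ℕ.≤-trans (ℕ.m≤n+m m′ d) l)))
                       (e (κ (suc d)) (f m) (f m′) (D L (suc d) f m′) (f₁ m′)))
             (≤-reflexive (cong (λ x → κ (suc d) * (f m + x)) (sym (D-hit L (suc d) f m′)))))
      where e : ∀ k b a x s → k * (b + (a + x)) ≡ s + k * b + (k * (a + x) - s)
            e = solve-∀ ring

    C-lower : ∀ L d m → m ℕ.≤ L → f₂ m ≤ κ (suc d) * κ (suc d) * C L (suc d) f m + κ (suc d) * f₁ m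
    C-lower L d m l with ℕ-split m (suc d)
    ... | inj₁ m<d = ≤-trans (subst (λ k → f₂ k ≤ f₂ 0 + κ m * f₁ k) (ℕ.+-identityʳ m) (window-≤ f₁ f₁-mono m 0))
          (≤-trans (by (gap (κ-mono (ℕ.<⇒≤ m<d)) ⊗ f₁≥0 m) (e (κ (suc d)) (κ m) (f₁ m)))
                   (≤-reflexive (cong (λ x → κ (suc d) * κ (suc d) * x + κ (suc d) * f₁ m) (sym (C-miss L (suc d) f m m<d)))))
      where e : ∀ k j a → k * k * 0ℚ + k * a ≡ 0ℚ + j * a + (k - j) * a
            e = solve-∀ ring
    C-lower (suc L) d m (ℕ.s≤s l) | inj₂ (m′ , refl) = ≤-trans (window-≤ f₁ f₁-mono (suc d) m′)
          (≤-trans (by (gap (C-lower L d m′ l′) ⊕ κ≥0 (suc d) ⊗ gap (D-lower L d m′ l′))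
                       (e (κ (suc d)) (f₁ m) (f m′) (D L (suc d) f m′) (C L (suc d) f m′) (f₁ m′) (f₂ m′)))
             (≤-reflexive (cong (λ x → κ (suc d) * κ (suc d) * x + κ (suc d) * f₁ m) (sym (C-hit L (suc d) f m′)))))
      where e : ∀ k b a x c s t → k * k * (a + x + c) + k * b ≡ t + k * b + ((k * k * c + k * s - t) + k * (k * (a + x) - s))
            e = solve-∀ ring
            l′ : m′ ℕ.≤ L
            l′ = ℕ.≤-trans (ℕ.m≤n+m m′ d) l

    sh-antimono : ∀ {g : ℕ → ℚ} → (∀ m → 0ℚ ≤ g m) → (∀ m → g m ≤ g (suc m)) → ∀ {a b} m → a ℕ.≤ b → sh b g m ≤ sh a g m
    sh-antimono {g} g≥0 mono {a} {b} m ab with ℕ-split m b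
    ... | inj₁ m<b = subst (_≤ sh a g m) (sym (sh-miss b g m m<b)) (sh≥0 a m g≥0)
    ... | inj₂ (m′ , refl) = subst₂ _≤_ (sym (sh-hit b g m′)) (sym eq) (grow (b ℕ.∸ a))
      where
      grow : ∀ k → g m′ ≤ g (k ℕ.+ m′)
      grow zero    = ≤-refl
      grow (suc k) = ≤-trans (grow k) (mono (k ℕ.+ m′))
      eq : sh a g (b ℕ.+ m′) ≡ g (b ℕ.∸ a ℕ.+ m′)
      eq = trans (cong (sh a g) (trans (cong (ℕ._+ m′) (sym (ℕ.m+[n∸m]≡n ab))) (ℕ.+-assoc a (b ℕ.∸ a) m′))) (sh-hit a g (b ℕ.∸ a ℕ.+ m′))

  ι : ℕ → ℚ
  ι i = proj₁ (inv (κ>0 i))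

  ι≥0 : ∀ i → 0ℚ ≤ ι i
  ι≥0 i = <⇒≤ (proj₁ (proj₂ (inv (κ>0 i))))

  κι : ∀ i → κ (suc i) * ι i ≡ 1ℚ
  κι i = proj₂ (proj₂ (inv (κ>0 i)))

  -- Because `ι i` is 1 / (i + 1), these are the partial sums of ζ(2) and of the harmonic series.
  ζ H : ℕ → ℚ
  ζ n = Σ< n (λ i → ι i * ι i)
  H n = Σ< n ι

  -- Partition counts enter only through their recursion on the largest part. Monotonicity is stated
  -- from the bound 1 on: with no parts at all only 0 has a partition.
  module Weights
    (f : ℕ → ℕ → ℚ)
    (f≥0 : ∀ N m → 0ℚ ≤ f N m)
    (f-mono : ∀ N m → f (suc N) m ≤ f (suc N) (suc m))
    (f-base : ∀ m → f 0 (suc m) ≡ 0ℚ)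
    (f-step : ∀ N m → f (suc N) m ≡ f N m + sh (suc N) (f (suc N)) m)
    where

    J : ℕ → ℕ → ℕ → (ℕ → ℚ) → ℚ
    J L N m g = Σ< N (λ d → κ (suc d) * D L (suc d) g m)

    -- Partitions containing the part N + 1 are sorted by its number of copies; removing all of them
    -- leaves a partition into parts ≤ N, removing one leaves the right side.
    D-part : ∀ L N m → m ℕ.≤ L → D L (suc N) (f N) m ≡ sh (suc N) (f (suc N)) m
    D-part L N m l with ℕ-split m (suc N)
    ... | inj₁ m<d = trans (D-miss L (suc N) (f N) m m<d) (sym (sh-miss (suc N) (f (suc N)) m m<d))
    D-part (suc L) N m (ℕ.s≤s l) | inj₂ (m′ , refl) = trans (D-hit L (suc N) (f N) m′)
      (trans (cong (f N m′ +_) (D-part L N m′ (ℕ.≤-trans (ℕ.m≤n+m m′ N) l)))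
        (trans (sym (f-step N m′)) (sym (sh-hit (suc N) (f (suc N)) m′))))

    D-sh : ∀ L d k g m → D L d (sh k g) m ≡ sh k (D L d g) m
    D-sh L d k g m = trans (Σ<-cong L (λ i _ → trans (sh-sh (suc i ℕ.* d) k g m) (trans (cong (λ x → sh x g m) (ℕ.+-comm (suc i ℕ.* d) k)) (sym (sh-sh k (suc i ℕ.* d) g m)))))
      (sym (sh-Σ k L (λ i → sh (suc i ℕ.* d) g) m))

    D-linear : ∀ L d g h k m → (∀ m → g m ≡ h m + k m) → D L d g m ≡ D L d h m + D L d k m
    D-linear L d g h k m e = trans (Σ<-cong L (λ i _ → trans (sh-cong (suc i ℕ.* d) m e) (sh-linear (suc i ℕ.* d) h k m)))
      (Σ<-+ L (λ i → sh (suc i ℕ.* d) h m) (λ i → sh (suc i ℕ.* d) k m))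

    J-step : ∀ L N m → m ℕ.≤ L →
      J L (suc N) m (f (suc N)) ≡ J L N m (f N) + κ (suc N) * sh (suc N) (f (suc N)) m + sh (suc N) (λ m → J L (suc N) m (f (suc N))) m
    J-step L N m l =
      trans (Σ<-cong (suc N) (λ d _ → trans (cong (κ (suc d) *_) (D-linear L (suc d) (f (suc N)) (f N) (sh (suc N) (f (suc N))) m (f-step N)))
                                            (*-distribˡ-+ (κ (suc d)) _ _)))
      (trans (Σ<-+ (suc N) (λ d → κ (suc d) * D L (suc d) (f N) m) (λ d → κ (suc d) * D L (suc d) (sh (suc N) (f (suc N))) m))
      (cong₂ _+_ (cong (λ x → J L N m (f N) + κ (suc N) * x) (D-part L N m l))
                 (trans (Σ<-cong (suc N) (λ d _ → trans (cong (κ (suc d) *_) (D-sh L (suc d) (suc N) (f (suc N)) m))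
                                                      (sym (sh-scale (suc N) (κ (suc d)) (D L (suc d) (f (suc N))) m))))
                        (sym (sh-Σ (suc N) (suc N) (λ d m → κ (suc d) * D L (suc d) (f (suc N)) m) m)))))

    -- Counting the cells of all partitions of m according to the part d they lie in and the copy i of that part.
    cells : ∀ N L m → m ℕ.≤ L → κ m * f N m ≡ J L N m (f N)
    cells zero L zero    l = *-zeroˡ (f 0 0)
    cells zero L (suc m) l = trans (cong (κ (suc m) *_) (f-base m)) (*-zeroʳ (κ (suc m)))
    cells (suc N) L m l = go m m ℕ.≤-refl l
      where
      go : ∀ b m → m ℕ.≤ b → m ℕ.≤ L → κ m * f (suc N) m ≡ J L (suc N) m (f (suc N))
      go b m mb l with ℕ-split m (suc N)
      ... | inj₁ m<N = trans (cong (κ m *_) (trans (f-step N m) (trans (cong (f N m +_) (sh-miss (suc N) (f (suc N)) m m<N)) (+-identityʳ (f N m)))))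
            (trans (cells N L m l) (sym (trans (J-step L N m l)
              (trans (cong₂ _+_ (cong (λ x → J L N m (f N) + κ (suc N) * x) (sh-miss (suc N) (f (suc N)) m m<N))
                                (sh-miss (suc N) (λ m → J L (suc N) m (f (suc N))) m m<N))
                     (e (J L N m (f N)) (κ (suc N)))))))
        where e : ∀ a k → a + k * 0ℚ + 0ℚ ≡ a
              e = solve-∀ ring
      go (suc b) m (ℕ.s≤s mb) l | inj₂ (m′ , refl) =
        trans (cong (κ m *_) (trans (f-step N m) (cong (f N m +_) (sh-hit (suc N) (f (suc N)) m′))))
        (trans (cong₂ (λ x y → x * (f N m + f (suc N) m′)) (κ-+ (suc N) m′) (refl {x = m}))
        (trans (e (κ (suc N)) (κ m′) (f N m) (f (suc N) m′))
        (trans (cong₂ (λ x y → x + κ (suc N) * f (suc N) m′ + y)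
                  (trans (cong (_* f N m) (sym (κ-+ (suc N) m′))) (cells N L m l))
                  (go b m′ (ℕ.≤-trans (ℕ.m≤n+m m′ N) mb) (ℕ.≤-trans (ℕ.m≤n+m m′ (suc N)) l)))
        (sym (trans (J-step L N m l)
          (cong₂ _+_ (cong (λ x → J L N m (f N) + κ (suc N) * x) (sh-hit (suc N) (f (suc N)) m′))
                     (sh-hit (suc N) (λ m → J L (suc N) m (f (suc N))) m′)))))))
        where e : ∀ k j a b → (k + j) * (a + b) ≡ (k + j) * a + k * b + j * b
              e = solve-∀ ring

    -- After the swap the roles change: for a fixed copy number i + 1 the part size runs along a
    -- progression of step i + 1. This is `C N (suc i) g m`, so the second-order Riemann bounds
    -- apply with i in place of the part.
    C′ : ℕ → ℕ → ℕ → (ℕ → ℚ) → ℚ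
    C′ N i m g = Σ< N (λ d → κ (suc d) * sh (suc d ℕ.* suc i) g m)

    J-swap : ∀ L N m g → J L N m g ≡ Σ< L (λ i → C′ N i m g)
    J-swap L N m g = trans (Σ<-cong N (λ d _ → trans (sym (Σ<-* L (κ (suc d)) (λ i → sh (suc i ℕ.* suc d) g m)))
                                      (Σ<-cong L (λ i _ → cong (λ x → κ (suc d) * sh x g m) (ℕ.*-comm (suc i) (suc d))))))
                     (Σ<-swap N L (λ d i → κ (suc d) * sh (suc d ℕ.* suc i) g m))

    module Level (N′ : ℕ) where
      N : ℕ
      N = suc N′
      open Sums (f N) (f≥0 N) (f-mono N′) public

      term≥0 : ∀ i m d → 0ℚ ≤ κ (suc d) * sh (suc d ℕ.* suc i) (f N) m
      term≥0 i m d = κ≥0 (suc d) ⊗ sh≥0 (suc d ℕ.* suc i) m (f≥0 N)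

      C-ι-upper : ∀ L i m → C L (suc i) (f N) m ≤ ι i * ι i * f₂ m + ι i * f₁ m
      C-ι-upper L i m = ≤-trans (≤-reflexive (trans (e₁ c) (trans (cong (λ x → x * x * c) (sym (κι i))) (e₂ (κ (suc i)) (ι i) c))))
        (≤-trans (*-monoʳ (ι≥0 i ⊗ ι≥0 i) (C-upper L (suc i) m))
          (≤-reflexive (trans (e₃ (κ (suc i)) (ι i) (f₂ m) (f₁ m)) (trans (cong (λ x → ι i * ι i * f₂ m + x * (ι i * f₁ m)) (κι i)) (cong (ι i * ι i * f₂ m +_) (*-identityˡ _))))))
        where c = C L (suc i) (f N) m
              e₁ : ∀ c → c ≡ 1ℚ * 1ℚ * c
              e₁ = solve-∀ ring
              e₂ : ∀ k x c → k * x * (k * x) * c ≡ x * x * (k * k * c)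
              e₂ = solve-∀ ring
              e₃ : ∀ k x a b → x * x * (a + k * b) ≡ x * x * a + (k * x) * (x * b)
              e₃ = solve-∀ ring

      C-ι-lower : ∀ L i m → m ℕ.≤ L → ι i * ι i * f₂ m - ι i * f₁ m ≤ C L (suc i) (f N) m
      C-ι-lower L i m l = ungap (subst (0ℚ ≤_) (trans (e (κ (suc i)) (ι i) (f₂ m) (f₁ m) c) (trans (cong₂ (λ x y → x * x * c + y * (ι i * f₁ m) - ι i * ι i * f₂ m) (κι i) (κι i)) (e′ (ι i) (f₂ m) (f₁ m) c)))
                            (ι≥0 i ⊗ ι≥0 i ⊗ gap (C-lower L i m l)))
        where c = C L (suc i) (f N) m
              e : ∀ k x a b c → x * x * (k * k * c + k * b - a) ≡ k * x * (k * x) * c + k * x * (x * b) - x * x * a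
              e = solve-∀ ring
              e′ : ∀ x a b c → 1ℚ * 1ℚ * c + 1ℚ * (x * b) - x * x * a ≡ c - (x * x * a - x * b)
              e′ = solve-∀ ring

      -- Letting the part size run on to L only adds nonnegative terms; then `C-upper` is summed
      -- over the copy number.
      cells-upper : ∀ L m → m ℕ.≤ L → N ℕ.≤ L → κ m * f N m ≤ ζ L * f₂ m + H L * f₁ m
      cells-upper L m l NL = subst (_≤ ζ L * f₂ m + H L * f₁ m) (sym (trans (cells N L m l) (J-swap L N m (f N))))
        (≤-trans (Σ<-mono L {g = λ i → f₂ m * (ι i * ι i) + f₁ m * ι i} (λ i _ → ≤-trans (shorter i) (≤-trans (C-ι-upper L i m) (≤-reflexive (e (ι i) (f₂ m) (f₁ m))))))
          (≤-reflexive (trans (Σ<-+ L (λ i → f₂ m * (ι i * ι i)) (λ i → f₁ m * ι i))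
            (cong₂ _+_ (trans (Σ<-* L (f₂ m) (λ i → ι i * ι i)) (*-comm (f₂ m) (ζ L))) (trans (Σ<-* L (f₁ m) ι) (*-comm (f₁ m) (H L)))))))
        where e : ∀ x a b → x * x * a + x * b ≡ a * (x * x) + b * x
              e = solve-∀ ring
              shorter : ∀ i → C′ N i m (f N) ≤ C L (suc i) (f N) m
              shorter i = subst (λ k → C′ N i m (f N) ≤ C k (suc i) (f N) m) (ℕ.m+[n∸m]≡n NL)
                (by (Σ<≥0 (L ℕ.∸ N) (λ d _ → term≥0 i m (N ℕ.+ d))) (Σ<-split N (L ℕ.∸ N) (λ d → κ (suc d) * sh (suc d ℕ.* suc i) (f N) m)))

      -- Part sizes beyond N do not occur, yet `C` counts them. Taking N (i + 1) off m leaves a `D`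
      -- sum and a `C` sum at the smaller index, and monotonicity replaces that index by m - N for
      -- all i at once.
      excess : ∀ L i m → Σ< L (λ d → κ (suc (N ℕ.+ d)) * sh (suc (N ℕ.+ d) ℕ.* suc i) (f N) m)
                         ≤ ι i * (κ (suc N) * sh N f₁ m) + ι i * ι i * sh N f₂ m
      excess L i m with ℕ-split m (N ℕ.* suc i)
      ... | inj₁ m<Ni = subst (_≤ ι i * (κ (suc N) * sh N f₁ m) + ι i * ι i * sh N f₂ m)
              (sym (Σ<-zero L (λ d _ → trans (cong (κ (suc (N ℕ.+ d)) *_) (sh-miss (suc (N ℕ.+ d) ℕ.* suc i) (f N) m (ℕ.<-≤-trans m<Ni (ℕ.*-monoˡ-≤ (suc i) (ℕ.≤-trans (ℕ.m≤m+n N d) (ℕ.n≤1+n _)))))) (*-zeroʳ (κ (suc (N ℕ.+ d)))))))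
              (ι≥0 i ⊗ (κ≥0 (suc N) ⊗ sh≥0 N m f₁≥0) ⊕ ι≥0 i ⊗ ι≥0 i ⊗ sh≥0 N m f₂≥0)
      ... | inj₂ (m′ , eq) = ≤-trans (≤-reflexive (trans (Σ<-cong L (λ d _ → step d)) (trans (Σ<-+ L (λ d → κ N * sh (suc d ℕ.* suc i) (f N) m′) (λ d → κ (suc d) * sh (suc d ℕ.* suc i) (f N) m′)) (cong (_+ C L (suc i) (f N) m′) (Σ<-* L (κ N) (λ d → sh (suc d ℕ.* suc i) (f N) m′))))))
          (≤-trans (by (κ≥0 N ⊗ gap D-ι ⊕ gap (C-ι-upper L i m′)) (e (κ N) (ι i) (D L (suc i) (f N) m′) (C L (suc i) (f N) m′) (f₁ m′) (f₂ m′)))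
            (+-mono-≤ (*-monoʳ (ι≥0 i) (*-monoʳ (κ≥0 (suc N)) (below f₁≥0 f₁-mono))) (*-monoʳ (ι≥0 i ⊗ ι≥0 i) (below f₂≥0 f₂-mono))))
        where
        below : ∀ {g : ℕ → ℚ} → (∀ m → 0ℚ ≤ g m) → (∀ m → g m ≤ g (suc m)) → g m′ ≤ sh N g m
        below {g} g≥0 mono = subst (_≤ sh N g m) (trans (cong (sh (N ℕ.* suc i) g) eq) (sh-hit (N ℕ.* suc i) g m′))
                               (sh-antimono g≥0 mono m (ℕ.m≤m*n N (suc i)))
        step : ∀ d → κ (suc (N ℕ.+ d)) * sh (suc (N ℕ.+ d) ℕ.* suc i) (f N) m ≡ κ N * sh (suc d ℕ.* suc i) (f N) m′ + κ (suc d) * sh (suc d ℕ.* suc i) (f N) m′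
        step d = trans (cong₂ _*_ (trans (cong κ (sym (ℕ.+-suc N d))) (κ-+ N (suc d)))
                    (trans (cong₂ (λ x y → sh x (f N) y) (trans (cong (ℕ._* suc i) (sym (ℕ.+-suc N d))) (ℕ.*-distribʳ-+ (suc i) N (suc d))) eq)
                           (sh-+ (N ℕ.* suc i) (suc d ℕ.* suc i) (f N) m′)))
                    (*-distribʳ-+ (sh (suc d ℕ.* suc i) (f N) m′) (κ N) (κ (suc d)))
        D-ι : D L (suc i) (f N) m′ ≤ ι i * f₁ m′
        D-ι = subst (_≤ ι i * f₁ m′) (trans (e′ (κ (suc i)) (ι i) (D L (suc i) (f N) m′)) (trans (cong (_* D L (suc i) (f N) m′) (κι i)) (*-identityˡ _))) (*-monoʳ (ι≥0 i) (D-upper L (suc i) m′))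
          where e′ : ∀ k x a → x * (k * a) ≡ k * x * a
                e′ = solve-∀ ring
        e : ∀ k x d c a b → x * ((1ℚ + k) * a) + x * x * b ≡ k * d + c + (k * (x * a - d) + (x * x * b + x * a - c))
        e = solve-∀ ring

      -- The last bracket is the total contribution of the sizes beyond N. It lives at m - N and is
      -- therefore negligible once f₂ is known to grow geometrically.
      cells-lower : ∀ L m → m ℕ.≤ L → N ℕ.≤ L →
        ζ L * f₂ m ≤ κ m * f N m + H L * f₁ m + (H L * (κ (suc N) * sh N f₁ m) + ζ L * sh N f₂ m)
      cells-lower L m l NL = subst (λ x → ζ L * f₂ m ≤ x + H L * f₁ m + (H L * (κ (suc N) * sh N f₁ m) + ζ L * sh N f₂ m)) (sym (trans (cells N L m l) (J-swap L N m (f N))))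
        (≤-trans (≤-reflexive (sum (ζ L) (H L) (f₂ m) (f₁ m)))
        (≤-trans (+-monoˡ-≤ (H L * f₁ m) (≤-trans (≤-reflexive lhs) (≤-trans (Σ<-mono L pointwise) (≤-reflexive rhs))))
          (≤-reflexive (sum′ (Σ< L (λ i → C′ N i m (f N))) (H L) (ζ L) (κ (suc N) * sh N f₁ m) (sh N f₂ m) (H L * f₁ m)))))
        where
        sum : ∀ z h a b → z * a ≡ (a * z - b * h) + h * b
        sum = solve-∀ ring
        sum′ : ∀ s h z a b c → (s + (a * h + b * z)) + c ≡ s + c + (h * a + z * b)
        sum′ = solve-∀ ring
        A = κ (suc N) * sh N f₁ m
        lhs : f₂ m * ζ L - f₁ m * H L ≡ Σ< L (λ i → f₂ m * (ι i * ι i) + (- f₁ m) * ι i)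
        lhs = trans (cong₂ _+_ (sym (Σ<-* L (f₂ m) (λ i → ι i * ι i))) (trans (neg-distribˡ-* (f₁ m) (H L)) (sym (Σ<-* L (- f₁ m) ι)))) (sym (Σ<-+ L _ _))
        rhs : Σ< L (λ i → C′ N i m (f N) + (A * ι i + sh N f₂ m * (ι i * ι i))) ≡ Σ< L (λ i → C′ N i m (f N)) + (A * H L + sh N f₂ m * ζ L)
        rhs = trans (Σ<-+ L _ _) (cong (Σ< L (λ i → C′ N i m (f N)) +_) (trans (Σ<-+ L _ _) (cong₂ _+_ (Σ<-* L A ι) (Σ<-* L (sh N f₂ m) (λ i → ι i * ι i)))))
        pointwise : ∀ i → i ℕ.< L → f₂ m * (ι i * ι i) + (- f₁ m) * ι i ≤ C′ N i m (f N) + (A * ι i + sh N f₂ m * (ι i * ι i))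
        pointwise i _ = ≤-trans (≤-reflexive (e (ι i) (f₂ m) (f₁ m))) (≤-trans (C-ι-lower L i m l)
          (subst (λ k → C k (suc i) (f N) m ≤ C′ N i m (f N) + (A * ι i + sh N f₂ m * (ι i * ι i))) (ℕ.m+[n∸m]≡n NL)
            (≤-trans (≤-reflexive (Σ<-split N (L ℕ.∸ N) (λ d → κ (suc d) * sh (suc d ℕ.* suc i) (f N) m)))
              (+-monoʳ-≤ (C′ N i m (f N)) (≤-trans (excess (L ℕ.∸ N) i m) (≤-reflexive (e′ (ι i) A (sh N f₂ m))))))))
          where e : ∀ x a b → a * (x * x) + (- b) * x ≡ x * x * a - x * b
                e = solve-∀ ring
                e′ : ∀ x a b → x * a + x * x * b ≡ a * x + b * (x * x)
                e′ = solve-∀ ring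

-- Barriers for the Riccati recursion and geometric behaviour of f near n.

module Riccati where

  open import Data.Nat as ℕ using (ℕ; zero; suc)
  import Data.Nat.Properties as ℕ
  open import Data.Rational
  open import Data.Rational.Properties
  open import Data.Product using (_×_; _,_; ∃)
  open import Data.Sum using (inj₁; inj₂)
  open import Data.Empty using (⊥-elim)
  open import Relation.Nullary using (yes; no)
  open import Relation.Binary.PropositionalEquality using (_≡_; refl; sym; trans; cong; subst)
  open import Tactic.RingSolver using (solve-∀)
  open Rationals
  open CellSums

  ½≥0 : 0ℚ ≤ ½
  ½≥0 = nonNegative⁻¹ ½

  1≥0 : 0ℚ ≤ 1ℚ
  1≥0 = nonNegative⁻¹ 1ℚ

  -- One step of the upper barrier, where x, y, a stand for f₁, f₂, f at an index m = M + m₁.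
  -- In terms of w = x / y the step of the Riccati map is w ↦ (w + a / y) / (1 + w), and the barrier is M w² ≤ Z′.
  barrier-step : ∀ (M m₁ Z ε H x y a : ℚ) →
    0ℚ ≤ M → 1ℚ ≤ m₁ → 1ℚ ≤ Z → 0ℚ < ε → 0ℚ ≤ H → 0ℚ ≤ x → 0ℚ < y → 0ℚ ≤ a → x ≤ y → a ≤ y →
    (H + ½) * (H + ½) * (Z + ε) ≤ κ 4 * (ε * (½ * m₁ - Z - H)) →
    (M + m₁) * a ≤ Z * y + H * x →
    M * (x * x) ≤ (Z + ε) * (y * y) →
    (M + 1ℚ) * ((x + a) * (x + a)) ≤ (Z + ε) * ((y + x) * (y + x))
  barrier-step M m₁ Z ε H x y a M≥0 m₁≥1 Z≥1 ε>0 H≥0 x≥0 y>0 a≥0 xy ay hm k1 k2 =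
    ≤-trans (by (rest ⊕ (κ≥0 2 ⊗ x≥0 ⊗ K ⊕ ½≥0 ⊗ a≥0 ⊗ x≥0 ⊕ a≥0 ⊗ K)) (eD M (Z + ε) x y a)) ≤-refl
    where
    Z′ = Z + ε
    y≥0 = <⇒≤ y>0
    ε≥0 = <⇒≤ ε>0
    m₁≥0 = ≤-trans 1≥0 m₁≥1
    Z≥0 = ≤-trans 1≥0 Z≥1
    Z′≥0 = Z≥0 ⊕ ε≥0
    -- `M + m₁` times the lower bound for the quantity in `K` when `a` is as large as `k1` allows.
    -- Completing the square in x, with `k2` for the remaining x² term, shows that it is
    -- nonnegative.
    T = M * (ε * y - (H + ½) * x) + m₁ * ((Z + ε) * y - ½ * x) - Z * y - H * x
    eT : ∀ M m₁ Z ε H x y → κ 4 * ε * y * (M * (ε * y - (H + ½) * x) + m₁ * ((Z + ε) * y - ½ * x) - Z * y - H * x) ≡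
       κ 4 * ε * y * 0ℚ + (κ 4 * M * ((ε * y - ½ * (H + ½) * x) * (ε * y - ½ * (H + ½) * x)) + (H + ½) * (H + ½) * ((Z + ε) * (y * y) - M * (x * x))
        + (κ 4 * (ε * (½ * m₁ - Z - H)) - (H + ½) * (H + ½) * (Z + ε)) * (y * y)
        + κ 4 * ε * (m₁ * ((Z - 1ℚ) + ε) * y * y + m₁ * ½ * (y - x) * y + H * (y - x) * y))
    eT = solve-∀ ring
    T≥0 : 0ℚ ≤ T
    T≥0 = *-cancelˡ (positive⁻¹ (κ 4) ⊗⁺ ε>0 ⊗⁺ y>0)
       (by (κ≥0 4 ⊗ M≥0 ⊗ sq≥0 (ε * y - ½ * (H + ½) * x) ⊕ sq≥0 (H + ½) ⊗ gap k2 ⊕ gap hm ⊗ (y≥0 ⊗ y≥0)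
             ⊕ κ≥0 4 ⊗ ε≥0 ⊗ (m₁≥0 ⊗ (gap Z≥1 ⊕ ε≥0) ⊗ y≥0 ⊗ y≥0 ⊕ m₁≥0 ⊗ ½≥0 ⊗ gap xy ⊗ y≥0 ⊕ H≥0 ⊗ gap xy ⊗ y≥0))
           (eT M m₁ Z ε H x y))
    eK : ∀ M m₁ Z ε H x y a → (M + m₁) * ((Z + ε) * y - ½ * x - (M + 1ℚ) * a) ≡
         (M + m₁) * 0ℚ + ((M * (ε * y - (H + ½) * x) + m₁ * ((Z + ε) * y - ½ * x) - Z * y - H * x) + (M + 1ℚ) * (Z * y + H * x - (M + m₁) * a))
    eK = solve-∀ ring
    K : 0ℚ ≤ Z′ * y - ½ * x - (M + 1ℚ) * a
    K = *-cancelˡ (+-mono-≤-< M≥0 (<-≤-trans (positive⁻¹ 1ℚ) m₁≥1)) (by (T≥0 ⊕ (M≥0 ⊕ 1≥0) ⊗ gap k1) (eK M m₁ Z ε H x y a))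
    rest : 0ℚ ≤ Z′ * (y * y) + Z′ * (x * x) - M * (x * x) - Z′ * (a * y)
    rest with ≤-total M Z′
    ... | inj₁ M≤Z′ = ≤-trans (Z′≥0 ⊗ y≥0 ⊗ gap ay ⊕ gap M≤Z′ ⊗ (x≥0 ⊗ x≥0)) (≤-reflexive (e M Z′ x y a))
      where e : ∀ M z x y a → z * y * (y - a) + (z - M) * (x * x) ≡ z * (y * y) + z * (x * x) - M * (x * x) - z * (a * y)
            e = solve-∀ ring
    ... | inj₂ Z′≤M = *-cancelˡ (<-≤-trans (+-mono-≤-< Z≥0 ε>0) Z′≤M)
        (by (gap Z′≤M ⊗ gap k2 ⊕ Z′≥0 ⊗ y≥0 ⊗ (K ⊕ ½≥0 ⊗ x≥0 ⊕ a≥0)) (e M Z′ x y a))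
      where e : ∀ M z x y a → M * (z * (y * y) + z * (x * x) - M * (x * x) - z * (a * y)) ≡
                 M * 0ℚ + ((M - z) * (z * (y * y) - M * (x * x)) + z * y * ((z * y - ½ * x - (M + 1ℚ) * a) + ½ * x + a))
            e = solve-∀ ring
    eD : ∀ M z x y a → z * ((y + x) * (y + x)) ≡ (M + 1ℚ) * ((x + a) * (x + a)) +
          ((z * (y * y) + z * (x * x) - M * (x * x) - z * (a * y)) +
           (κ 2 * x * (z * y - ½ * x - (M + 1ℚ) * a) + ½ * a * x + a * (z * y - ½ * x - (M + 1ℚ) * a)))
    eD = solve-∀ ring

  module Barriers
    (f : ℕ → ℚ) (f≥0 : ∀ m → 0ℚ ≤ f m) (f-mono : ∀ m → f m ≤ f (suc m)) (f0>0 : 0ℚ < f 0)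
    (n : ℕ) (Z H : ℚ) (Z≥1 : 1ℚ ≤ Z) (Z≤2 : Z ≤ κ 2) (H≥0 : 0ℚ ≤ H)
    (upper : ∀ m → m ℕ.≤ n → κ m * f m ≤ Z * Σ< m (λ j → Σ< j f) + H * Σ< m f)
    where

    open Sums f f≥0 f-mono public

    f₂>0 : ∀ m → 0ℚ < f₂ (suc (suc m))
    f₂>0 zero    = <-≤-trans f0>0 (by {c = 0ℚ} ≤-refl (e (f 0)))
      where e : ∀ a → 0ℚ + 0ℚ + (0ℚ + a) ≡ a + 0ℚ
            e = solve-∀ ring
    f₂>0 (suc m) = <-≤-trans (f₂>0 m) (f₂-mono (suc (suc m)))

    small-first : ∀ m → m ℕ.≤ n → κ 2 + H ≤ κ m → f₁ m ≤ f₂ m → f m ≤ f₂ m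
    small-first m l hm le = *-cancelˡ (<-≤-trans (+-mono-<-≤ (positive⁻¹ (κ 2)) H≥0) hm)
      (≤-trans (upper m l) (by (gap Z≤2 ⊗ f₂≥0 m ⊕ H≥0 ⊗ gap le ⊕ gap hm ⊗ f₂≥0 m) (e (κ m) Z H (f₁ m) (f₂ m))))
      where e : ∀ k z h x y → k * y ≡ z * y + h * x + ((κ 2 - z) * y + h * (y - x) + (k - (κ 2 + h)) * y)
            e = solve-∀ ring

    -- The Riccati map forgets its starting value: whatever the ratio is at m, one step brings it
    -- below 2 and a second one below 1. This is what starts the barrier.
    f₁≤f₂ : ∀ m → suc m ℕ.≤ n → κ 2 + κ 2 * H ≤ κ m → f₁ (suc (suc m)) ≤ f₂ (suc (suc m))
    f₁≤f₂ m l hm = by (gap fm1) (e (f₁ (suc m)) (f₂ (suc m)) (f (suc m)))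
      where
      κm>0 : 0ℚ < κ m
      κm>0 = <-≤-trans (+-mono-<-≤ (positive⁻¹ (κ 2)) (κ≥0 2 ⊗ H≥0)) hm
      fm : f m ≤ f₁ m + f₂ m
      fm = *-cancelˡ κm>0 (≤-trans (upper m (ℕ.≤-trans (ℕ.n≤1+n m) l))
             (by (gap Z≤2 ⊗ f₂≥0 m ⊕ H≥0 ⊗ (f₁≥0 m ⊕ κ≥0 2 ⊗ f₂≥0 m) ⊕ κ≥0 2 ⊗ f₁≥0 m ⊕ gap hm ⊗ (f₁≥0 m ⊕ f₂≥0 m)) (e₁ (κ m) Z H (f₁ m) (f₂ m))))
        where e₁ : ∀ k z h x y → k * (x + y) ≡ z * y + h * x + ((κ 2 - z) * y + h * (x + κ 2 * y) + κ 2 * x + (k - (κ 2 + κ 2 * h)) * (x + y))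
              e₁ = solve-∀ ring
      w≤2 : f₁ (suc m) ≤ κ 2 * f₂ (suc m)
      w≤2 = by (gap fm ⊕ f₂≥0 m) (e₂ (f₁ m) (f₂ m) (f m))
        where e₂ : ∀ x y a → κ 2 * (y + x) ≡ x + a + (x + y - a + y)
              e₂ = solve-∀ ring
      fm1 : f (suc m) ≤ f₂ (suc m)
      fm1 = *-cancelˡ (κ>0 m) (≤-trans (upper (suc m) l)
             (by (gap Z≤2 ⊗ f₂≥0 (suc m) ⊕ H≥0 ⊗ gap w≤2 ⊕ gap (≤-trans hm (κ-mono (ℕ.n≤1+n m))) ⊗ f₂≥0 (suc m)) (e₃ (κ (suc m)) Z H (f₁ (suc m)) (f₂ (suc m)))))
        where e₃ : ∀ k z h x y → k * y ≡ z * y + h * x + ((κ 2 - z) * y + h * (κ 2 * y - x) + (k - (κ 2 + κ 2 * h)) * y)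
              e₃ = solve-∀ ring
      e : ∀ x y a → y + x ≡ x + a + (y - a)
      e = solve-∀ ring

    module Upper (m₁ ε : ℚ) (ε>0 : 0ℚ < ε) (m₁-large : κ 5 + κ 2 * H ≤ m₁)
      (hm : (H + ½) * (H + ½) * (Z + ε) ≤ κ 4 * (ε * (½ * m₁ - Z - H))) where

      private
        Z≥0 = ≤-trans 1≥0 Z≥1
        Z′≥0 = Z≥0 ⊕ <⇒≤ ε>0

      f₁≤f₂′ : ∀ m → m ℕ.≤ n → m₁ ≤ κ m + 1ℚ → f₁ m ≤ f₂ m × f m ≤ f₂ m × ∃ λ m′ → m ≡ suc (suc m′)
      f₁≤f₂′ zero l h = ⊥-elim (<-irrefl refl (<-≤-trans (positive⁻¹ (κ 4)) (by (κ≥0 2 ⊗ H≥0 ⊕ gap m₁-large ⊕ gap h) (e H m₁))))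
        where e : ∀ h m → 0ℚ ≡ κ 4 + (κ 2 * h + (m - (κ 5 + κ 2 * h)) + (0ℚ + 1ℚ - m))
              e = solve-∀ ring
      f₁≤f₂′ (suc zero) l h = ⊥-elim (<-irrefl refl (<-≤-trans (positive⁻¹ (κ 3)) (by (κ≥0 2 ⊗ H≥0 ⊕ gap m₁-large ⊕ gap h) (e H m₁))))
        where e : ∀ h m → 0ℚ ≡ κ 3 + (κ 2 * h + (m - (κ 5 + κ 2 * h)) + (1ℚ + 0ℚ + 1ℚ - m))
              e = solve-∀ ring
      f₁≤f₂′ (suc (suc m)) l h = a , small-first (suc (suc m)) l (by (κ≥0 2 ⊕ H≥0 ⊕ gap m₁-large ⊕ gap h) (e H m₁ (κ m))) a , (m , refl)
        where
        e : ∀ h m k → 1ℚ + (1ℚ + k) ≡ κ 2 + h + (κ 2 + h + (m - (κ 5 + κ 2 * h)) + (1ℚ + (1ℚ + k) + 1ℚ - m))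
        e = solve-∀ ring
        e′ : ∀ h m k → k ≡ κ 2 + κ 2 * h + ((m - (κ 5 + κ 2 * h)) + (1ℚ + (1ℚ + k) + 1ℚ - m))
        e′ = solve-∀ ring
        a = f₁≤f₂ m (ℕ.≤-trans (ℕ.n≤1+n (suc m)) l) (by (gap m₁-large ⊕ gap h) (e′ H m₁ (κ m)))

      -- The curve w² = (Z + ε) / (m - m₁) with denominators cleared. It is vacuous up to the
      -- burn-in time m₁, and `barrier-step` takes over afterwards.
      barrier : ∀ m → m ℕ.≤ n → (κ m - m₁) * (f₁ m * f₁ m) ≤ (Z + ε) * (f₂ m * f₂ m)
      barrier zero    l = ≤-reflexive (e m₁ (Z + ε))
        where e : ∀ m z → (0ℚ - m) * (0ℚ * 0ℚ) ≡ z * (0ℚ * 0ℚ)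
              e = solve-∀ ring
      barrier (suc m) l with ≤-total (κ (suc m)) m₁
      ... | inj₁ neg = ≤-trans (by (gap neg ⊗ sq≥0 (f₁ (suc m))) (e (κ (suc m)) m₁ (f₁ (suc m) * f₁ (suc m)))) (Z′≥0 ⊗ sq≥0 (f₂ (suc m)))
        where e : ∀ k m x → 0ℚ ≡ (k - m) * x + (m - k) * x
              e = solve-∀ ring
      ... | inj₂ pos with ≤-total (κ m) m₁ | f₁≤f₂′ m (ℕ.≤-trans (ℕ.n≤1+n m) l) (≤-trans pos (≤-reflexive (+-comm 1ℚ (κ m))))
      -- The step that crosses m₁: the coefficient on the left is at most 1, so f ≤ f₂ is already
      -- enough.
      ...   | inj₁ small | xy , ay , _ = by (gap small ⊗ sq≥0 (f₁ m + f m)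
                ⊕ (gap Z≥1 ⊕ <⇒≤ ε>0) ⊗ sq≥0 (f₂ m + f₁ m) ⊕ gap ay ⊗ (f₂≥0 m ⊕ κ≥0 2 ⊗ f₁≥0 m ⊕ f≥0 m)) (e (κ m) m₁ Z ε (f₁ m) (f₂ m) (f m))
        where e : ∀ k m z ε x y a → (z + ε) * ((y + x) * (y + x)) ≡ (1ℚ + k - m) * ((x + a) * (x + a)) +
                   ((m - k) * ((x + a) * (x + a)) + (z - 1ℚ + ε) * ((y + x) * (y + x)) + (y - a) * (y + κ 2 * x + a))
              e = solve-∀ ring
      ...   | inj₂ large | xy , ay , (m′ , refl) = ≤-trans (≤-reflexive (e (κ m) m₁ (f₁ m) (f m)))
               (barrier-step (κ m - m₁) m₁ Z ε H (f₁ m) (f₂ m) (f m) (gap large) (≤-trans (by (κ≥0 4 ⊕ κ≥0 2 ⊗ H≥0) (e₁ H)) m₁-large) Z≥1 ε>0 H≥0 (f₁≥0 m) (f₂>0 m′) (f≥0 m) xy ay hm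
                  (≤-trans (≤-reflexive (e₂ (κ m) m₁ (f m))) (upper m (ℕ.≤-trans (ℕ.n≤1+n m) l))) (barrier m (ℕ.≤-trans (ℕ.n≤1+n m) l)))
        where e : ∀ k m x a → (1ℚ + k - m) * ((x + a) * (x + a)) ≡ (k - m + 1ℚ) * ((x + a) * (x + a))
              e = solve-∀ ring
              e₁ : ∀ h → κ 5 + κ 2 * h ≡ 1ℚ + (κ 4 + κ 2 * h)
              e₁ = solve-∀ ring
              e₂ : ∀ k m a → (k - m + m) * a ≡ k * a
              e₂ = solve-∀ ring

      -- On a short window below n the decreasing barrier is dominated by its value at the left end,
      -- which gives a constant slope.
      slope-upper : ∀ (B S₀ : ℚ) → 0ℚ ≤ B → 0ℚ < κ n - S₀ - m₁ → Z + ε ≤ B * B * (κ n - S₀ - m₁) →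
        ∀ m → m ℕ.≤ n → κ n - S₀ ≤ κ m → f₁ m ≤ B * f₂ m
      slope-upper B S₀ B≥0 gap>0 hB m l near = sq-cancel-≤ (B≥0 ⊗ f₂≥0 m) (*-cancelˡ gap>0
        (by (gap (barrier m l) ⊕ gap near ⊗ sq≥0 (f₁ m) ⊕ gap hB ⊗ sq≥0 (f₂ m)) (e (κ n) S₀ m₁ (κ m) (Z + ε) B (f₁ m) (f₂ m))))
        where e : ∀ n s m k z b x y → (n - s - m) * (b * y * (b * y)) ≡ (n - s - m) * (x * x) +
                    (z * (y * y) - (k - m) * (x * x) + (k - (n - s)) * (x * x) + (b * b * (n - s - m) - z) * (y * y))
              e = solve-∀ ring

    module Lower (b r t : ℚ) (b>0 : 0ℚ < b) (t≥0 : 0ℚ ≤ t) (r≥0 : 0ℚ ≤ r) (r-inv : (1ℚ + b) * r ≡ 1ℚ)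
      (n>0 : 0ℚ < κ n) (slack : κ n * b + H ≤ κ n) (balance : κ n * b * b + H * b + t ≤ Z)
      (tail : ℕ → ℚ)
      (lower : ∀ m → m ℕ.≤ n → Z * f₂ m ≤ κ m * f m + H * f₁ m + tail m)
      (tail-small : ∀ m → m ℕ.≤ n → (∀ k j → j ℕ.+ k ℕ.≤ m → f₂ j ≤ r ^ k * f₂ (j ℕ.+ k)) → tail m ≤ t * f₂ m)
      where

      r-step : ∀ {x y} → b * y ≤ x → y ≤ r * (y + x)
      r-step {x} {y} h = ≤-trans (≤-reflexive (trans (sym (*-identityˡ y)) (trans (cong (_* y) (sym r-inv)) (e b r y)))) (*-monoʳ r≥0 (+-monoʳ-≤ y h))
        where e : ∀ b r y → (1ℚ + b) * r * y ≡ r * (y + b * y)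
              e = solve-∀ ring

      decay-from : ∀ m → (∀ j → j ℕ.< m → b * f₂ j ≤ f₁ j) → ∀ k j → j ℕ.+ k ℕ.≤ m → f₂ j ≤ r ^ k * f₂ (j ℕ.+ k)
      decay-from m h zero    j l = ≤-reflexive (trans (sym (*-identityˡ (f₂ j))) (cong (λ i → 1ℚ * f₂ i) (sym (ℕ.+-identityʳ j))))
      decay-from m h (suc k) j l = ≤-trans (r-step (h j (ℕ.≤-trans (ℕ.≤-reflexive (ℕ.+-comm 1 j)) (ℕ.≤-trans (ℕ.+-monoʳ-≤ j (ℕ.s≤s ℕ.z≤n)) l))))
        (≤-trans (*-monoʳ r≥0 (decay-from m h k (suc j) (subst (ℕ._≤ m) (ℕ.+-suc j k) l)))
          (≤-reflexive (trans (sym (*-assoc r (r ^ k) (f₂ (suc j ℕ.+ k)))) (cong (λ i → r * r ^ k * f₂ i) (sym (ℕ.+-suc j k))))))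

      -- As m ≤ n, n f m may replace m f m, so a constant can serve as barrier: at slope exactly b
      -- the next step needs f ≥ b² f₂, which is `balance`, and `slack` makes larger slopes
      -- harmless. The bound on the tail presupposes decay at smaller indices, so all j ≤ m are
      -- carried along.
      slope-below : ∀ m → m ℕ.≤ n → ∀ j → j ℕ.≤ m → b * f₂ j ≤ f₁ j
      slope-below m l zero _ = ≤-reflexive (*-zeroʳ b)
      slope-below (suc m) l (suc j) (ℕ.s≤s jm) = *-cancelˡ n>0
          (by (gap (κ-mono (ℕ.≤-trans jm l′)) ⊗ f≥0 j ⊕ gap (lower j (ℕ.≤-trans jm l′)) ⊕ gap (tail-small j (ℕ.≤-trans jm l′) (decay-from j (λ i i<j → slope-below m l′ i (ℕ.≤-trans (ℕ.<⇒≤ i<j) jm))))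
               ⊕ gap slack ⊗ gap (slope-below m l′ j jm) ⊕ gap balance ⊗ f₂≥0 j) (e (κ n) (κ j) b H Z t (tail j) (f j) (f₁ j) (f₂ j)))
        where
        l′ = ℕ.≤-trans (ℕ.n≤1+n m) l
        e : ∀ n k b h z t τ a x y → n * (x + a) ≡ n * (b * (y + x)) +
             ((n - k) * a + (k * a + h * x + τ - z * y) + (t * y - τ) + (n - (n * b + h)) * (x - b * y) + (z - (n * b * b + h * b + t)) * y)
        e = solve-∀ ring

      slope-lower : ∀ m → m ℕ.≤ n → b * f₂ m ≤ f₁ m
      slope-lower m l = slope-below m l m ℕ.≤-refl

      decay : ∀ k j → j ℕ.+ k ℕ.≤ n → f₂ j ≤ r ^ k * f₂ (j ℕ.+ k)
      decay = decay-from n (λ j l → slope-lower j (ℕ.<⇒≤ l))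

      second-upper : ∀ B → H * B + t ≤ ½ → ∀ m → m ℕ.≤ n → f₁ m ≤ B * f₂ m → f₂ m ≤ κ 2 * (κ m * f m)
      second-upper B hB m l w = by (κ≥0 2 ⊗ (gap (lower m l) ⊕ gap (tail-small m l (λ k j p → decay k j (ℕ.≤-trans p l))) ⊕ H≥0 ⊗ gap w ⊕ gap hB ⊗ f₂≥0 m ⊕ gap Z≥1 ⊗ f₂≥0 m))
          (e (κ m) H Z t B (tail m) (f m) (f₁ m) (f₂ m))
        where e : ∀ k h z t B τ a x y → κ 2 * (k * a) ≡ y + κ 2 * ((k * a + h * x + τ - z * y) + (t * y - τ) + h * (B * y - x) + (½ - (h * B + t)) * y + (z - 1ℚ) * y)
              e = solve-∀ ring

      f-grow : ∀ k m → f m ≤ f (m ℕ.+ k)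
      f-grow zero    m = ≤-reflexive (cong f (sym (ℕ.+-identityʳ m)))
      f-grow (suc k) m = ≤-trans (f-grow k m) (≤-trans (f-mono (m ℕ.+ k)) (≤-reflexive (cong f (sym (ℕ.+-suc m k)))))

      module Window (h₀ : ℕ) (c : ℚ) (c≥1 : 1ℚ ≤ c) (r≤1 : r ≤ 1ℚ) (h₀>0 : 0ℚ < κ h₀)
        (half : 1ℚ ≤ κ 4 * r ^ h₀) (n≤ch₀² : κ n ≤ c * (κ h₀ * κ h₀)) (f₂n : f₂ n ≤ κ 2 * (κ n * f n)) where

        private
          c≥0 = ≤-trans 1≥0 c≥1
          half² : 1ℚ ≤ κ 16 * r ^ (h₀ ℕ.+ h₀)
          half² = ≤-trans (*-mono 1≥0 (κ≥0 4 ⊗ ^≥0 h₀ r≥0) half half) (≤-reflexive (trans (e (r ^ h₀)) (cong (κ 16 *_) (sym (^-+ r h₀ h₀)))))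
            where e : ∀ x → κ 4 * x * (κ 4 * x) ≡ κ 16 * (x * x)
                  e = solve-∀ ring

          twice : ∀ m → κ h₀ * κ h₀ * f m ≤ f₂ (m ℕ.+ (h₀ ℕ.+ h₀))
          twice m = ≤-trans (≤-trans (≤-reflexive (*-assoc (κ h₀) (κ h₀) (f m))) (*-monoʳ (κ≥0 h₀) (≤-trans (by (f₁≥0 m) (+-comm (f₁ m) _)) (window-≥ f f-mono h₀ m))))
            (≤-trans (by (f₂≥0 (h₀ ℕ.+ m)) (+-comm (f₂ (h₀ ℕ.+ m)) _)) (≤-trans (window-≥ f₁ f₁-mono h₀ (h₀ ℕ.+ m)) (≤-reflexive (cong f₂ (trans (sym (ℕ.+-assoc h₀ h₀ m)) (ℕ.+-comm (h₀ ℕ.+ h₀) m))))))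

        -- Decay is exact for f₂ only. Two half-lives h₀ convert: h₀² f m ≤ f₂ (m + 2 h₀), while f₂
        -- n ≤ 2 n f n and n ≤ c h₀². The 16 lost over the two half-lives times this 2 is 32.
        f-decay : ∀ m s → m ℕ.+ s ≡ n → f m ≤ κ 32 * c * f n * r ^ s
        f-decay m s ms with s ℕ.≤? h₀ ℕ.+ h₀
        ... | yes s≤ = ≤-trans (≤-trans (f-grow s m) (≤-reflexive (cong f ms)))
                (by (gap (≤-trans half² (*-monoʳ (κ≥0 16) (^-antimonoʳ r≥0 r≤1 s≤))) ⊗ f≥0 n ⊕ κ≥0 16 ⊗ (gap c≥1 ⊕ c≥0) ⊗ f≥0 n ⊗ ^≥0 s r≥0) (e c (f n) (r ^ s)))
          where e : ∀ c a x → κ 32 * c * a * x ≡ a + ((κ 16 * x - 1ℚ) * a + κ 16 * (c - 1ℚ + c) * a * x)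
                e = solve-∀ ring
        ... | no s≰ with ℕ-split s (h₀ ℕ.+ h₀)
        ...   | inj₁ s< = ⊥-elim (s≰ (ℕ.<⇒≤ s<))
        ...   | inj₂ (s′ , refl) = *-cancelˡ (h₀>0 ⊗⁺ h₀>0)
               (≤-trans (twice m) (≤-trans (decay s′ (m ℕ.+ (h₀ ℕ.+ h₀)) (ℕ.≤-reflexive ms′))
                 (≤-trans (≤-reflexive (cong (λ i → r ^ s′ * f₂ i) ms′))
                   (≤-trans (*-mono (^≥0 s′ r≥0) (κ≥0 2 ⊗ (κ≥0 n ⊗ f≥0 n)) (≤-trans (≤-reflexive (sym (*-identityˡ (r ^ s′)))) (*-monoˡ (^≥0 s′ r≥0) half²)) f₂n)
                     (by (κ≥0 32 ⊗ (^≥0 (h₀ ℕ.+ h₀) r≥0 ⊗ ^≥0 s′ r≥0) ⊗ f≥0 n ⊗ gap n≤ch₀²)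
                       (trans (cong (λ x → κ h₀ * κ h₀ * (κ 32 * c * f n * x)) (^-+ r (h₀ ℕ.+ h₀) s′)) (e (κ h₀ * κ h₀) c (f n) (κ n) (r ^ (h₀ ℕ.+ h₀)) (r ^ s′))))))))
          where
          ms′ : m ℕ.+ (h₀ ℕ.+ h₀) ℕ.+ s′ ≡ n
          ms′ = trans (ℕ.+-assoc m (h₀ ℕ.+ h₀) s′) ms
          e : ∀ h c a n x y → h * (κ 32 * c * a * (x * y)) ≡ κ 16 * x * y * (κ 2 * (n * a)) + κ 32 * (x * y) * a * (c * h - n)
          e = solve-∀ ring

      module Flat (B δ S₀ : ℚ) (δ≥0 : 0ℚ ≤ δ) (δ≤1 : δ ≤ 1ℚ) (B≤ : B ≤ b + δ) (S₀>0 : 0ℚ < S₀) (S₀δ : S₀ * δ ≤ ½) (hB : H * B + t ≤ ½)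
        (w-upper : ∀ m → m ℕ.≤ n → κ n - S₀ ≤ κ m → f₁ m ≤ B * f₂ m) where

        private
          growth : ∀ s m → m ℕ.+ s ≡ n → κ s ≤ S₀ → f₂ n ≤ ((1ℚ + b) * (1ℚ + δ)) ^ s * f₂ m
          growth zero    m ms l = ≤-reflexive (trans (cong f₂ (trans (sym ms) (ℕ.+-identityʳ m))) (sym (*-identityˡ (f₂ m))))
          growth (suc s) m ms l = ≤-trans (growth s (suc m) (trans (sym (ℕ.+-suc m s)) ms) (≤-trans (κ-mono (ℕ.n≤1+n s)) l))
              (≤-trans (*-monoʳ (^≥0 s (b⁺ ⊗ (1≥0 ⊕ δ≥0)))
                (by (gap (w-upper m (subst (m ℕ.≤_) ms (ℕ.m≤m+n m (suc s))) (by (gap l) (trans (e₂ (κ m) (κ (suc s)) S₀) (cong (λ x → x - S₀ + (S₀ - κ (suc s))) (trans (sym (κ-+ m (suc s))) (cong κ ms))))))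
                       ⊕ gap B≤ ⊗ f₂≥0 m ⊕ <⇒≤ b>0 ⊗ δ≥0 ⊗ f₂≥0 m) (e b δ B (f₁ m) (f₂ m))))
                (≤-reflexive (e₃ ((1ℚ + b) * (1ℚ + δ)) (((1ℚ + b) * (1ℚ + δ)) ^ s) (f₂ m))))
            where b⁺ = 1≥0 ⊕ <⇒≤ b>0
                  e : ∀ b d B x y → (1ℚ + b) * (1ℚ + d) * y ≡ y + x + ((B * y - x) + (b + d - B) * y + b * d * y)
                  e = solve-∀ ring
                  e₂ : ∀ k s S → k ≡ (k + s) - S + (S - s)
                  e₂ = solve-∀ ring
                  e₃ : ∀ x p y → p * (x * y) ≡ x * p * y
                  e₃ = solve-∀ ring

          -- Bounded from above through the reciprocal: (1 + δ)^s (1 - δ)^s ≤ 1, and the second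
          -- factor is at least 1 - s δ ≥ 1/2.
          two : ∀ s → κ s ≤ S₀ → (1ℚ + δ) ^ s ≤ κ 2
          two s l = by (κ≥0 2 ⊗ (^≥0 s (1≥0 ⊕ δ≥0) ⊗ gap (bernoulli⁻ δ s δ≥0 δ≤1) ⊕ ^≥0 s (1≥0 ⊕ δ≥0) ⊗ gap (≤-trans (*-monoˡ δ≥0 l) S₀δ) ⊕ gap prod)) (e ((1ℚ + δ) ^ s) ((1ℚ - δ) ^ s) (κ s * δ))
            where e : ∀ p q k → κ 2 ≡ p + κ 2 * (p * (q - (1ℚ - k)) + p * (½ - k) + (1ℚ - p * q))
                  e = solve-∀ ring
                  prod : (1ℚ + δ) ^ s * (1ℚ - δ) ^ s ≤ 1ℚ
                  prod = subst (_≤ 1ℚ) (*-^ (1ℚ + δ) (1ℚ - δ) s) (^≤1 s ((1≥0 ⊕ δ≥0) ⊗ gap δ≤1) (by (sq≥0 δ) (e′ δ)))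
                    where e′ : ∀ d → 1ℚ ≡ (1ℚ + d) * (1ℚ - d) + d * d
                          e′ = solve-∀ ring

        -- Inside the window the slope exceeds b by at most δ, so f₂ grows by at most 2 r^(-s). The
        -- constant is 3 · 2 · 2, from f to f₂ at n, across the window, and back to f at m. The
        -- linear cutoff makes the bound trivial outside the window and fits Markov's inequality
        -- later.
        f-flat : ∀ m s → m ℕ.+ s ≡ n → f n * r ^ s * (S₀ - κ s) ≤ κ 12 * (S₀ * f m)
        f-flat m s ms with ≤-total S₀ (κ s)
        ... | inj₁ far = ≤-trans (by (f≥0 n ⊗ ^≥0 s r≥0 ⊗ gap far) (e (f n * r ^ s) S₀ (κ s))) (κ≥0 12 ⊗ (<⇒≤ S₀>0 ⊗ f≥0 m))
          where e : ∀ a s k → 0ℚ ≡ a * (s - k) + a * (k - s)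
                e = solve-∀ ring
        ... | inj₂ near = ≤-trans (by (f≥0 n ⊗ ^≥0 s r≥0 ⊗ κ≥0 s) (e₁ (f n * r ^ s) S₀ (κ s)))
              (≤-trans (*-monoˡ (<⇒≤ S₀>0) core) (≤-reflexive (e₂ (f m) S₀)))
          where
          m≤n : m ℕ.≤ n
          m≤n = subst (m ℕ.≤_) ms (ℕ.m≤m+n m s)
          e₁ : ∀ a s k → a * s ≡ a * (s - k) + a * k
          e₁ = solve-∀ ring
          e₂ : ∀ a s → κ 12 * a * s ≡ κ 12 * (s * a)
          e₂ = solve-∀ ring
          near′ : κ n - S₀ ≤ κ m
          near′ = by (gap near) (trans (e₃ (κ m) (κ s) S₀) (cong (λ x → x - S₀ + (S₀ - κ s)) (trans (sym (κ-+ m s)) (cong κ ms))))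
            where e₃ : ∀ k s S → k ≡ (k + s) - S + (S - s)
                  e₃ = solve-∀ ring
          w-n = w-upper n ℕ.≤-refl (by (<⇒≤ S₀>0) (e₃ (κ n) S₀))
            where e₃ : ∀ n s → n ≡ n - s + s
                  e₃ = solve-∀ ring
          HB = H * B
          n-upper : κ n * f n ≤ κ 3 * f₂ n
          n-upper = ≤-trans (upper n ℕ.≤-refl)
            (by (gap Z≤2 ⊗ f₂≥0 n ⊕ H≥0 ⊗ gap w-n ⊕ (gap hB ⊕ ½≥0 ⊕ t≥0) ⊗ f₂≥0 n) (e₄ Z H B t (f₁ n) (f₂ n)))
            where
            e₄ : ∀ z h B t x y → κ 3 * y ≡ z * y + h * x + ((κ 2 - z) * y + h * (B * y - x) + (½ - (h * B + t) + ½ + t) * y)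
            e₄ = solve-∀ ring
          shrink : r ^ s * f₂ n ≤ κ 2 * f₂ m
          shrink = ≤-trans (*-monoʳ (^≥0 s r≥0) (growth s m ms near))
            (≤-trans (≤-reflexive (trans (cong (λ x → r ^ s * (x * f₂ m)) (*-^ (1ℚ + b) (1ℚ + δ) s)) (trans (e₅ (r ^ s) ((1ℚ + b) ^ s) ((1ℚ + δ) ^ s) (f₂ m))
               (trans (cong (λ x → x * ((1ℚ + δ) ^ s * f₂ m)) (trans (sym (*-^ (1ℚ + b) r s)) (trans (cong (_^ s) r-inv) (1^ s)))) (*-identityˡ _)))))
              (*-monoˡ (f₂≥0 m) (two s near)))
            where e₅ : ∀ r p q y → r * (p * q * y) ≡ p * r * (q * y)
                  e₅ = solve-∀ ring
          core : f n * r ^ s ≤ κ 12 * f m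
          core = *-cancelˡ n>0 (by (gap n-upper ⊗ ^≥0 s r≥0 ⊕ κ≥0 3 ⊗ gap shrink ⊕ κ≥0 6 ⊗ gap (second-upper B hB m m≤n (w-upper m m≤n near′)) ⊕ κ≥0 12 ⊗ gap (κ-mono m≤n) ⊗ f≥0 m)
                    (e₆ (κ n) (κ m) (f n) (f m) (r ^ s) (f₂ n) (f₂ m)))
            where e₆ : ∀ n k a b r y z → n * (κ 12 * b) ≡ n * (a * r) + ((κ 3 * y - n * a) * r + κ 3 * (κ 2 * z - r * y) + κ 6 * (κ 2 * (k * b) - z) + κ 12 * (n - k) * b)
                  e₆ = solve-∀ ring

-- Enumeration of partitions and dominance in terms of excesses.

module PartitionLists where

  open import Defs using (listsOfLength; candidates; isPartition?; partitions; _⪯_)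
  open import Data.Bool using (Bool; true; false; if_then_else_)
  open import Data.Nat using (ℕ; zero; suc; _+_; _*_; _∸_; _≤_; _≥_; z≤n; s≤s; _≤?_)
  open import Data.Nat.Properties
  open import Data.Nat.ListAction using (sum)
  open import Data.List using (List; []; _∷_; _++_; map; take; length; concatMap; upTo)
  open import Data.List.Properties using (∷-injectiveˡ; ∷-injectiveʳ; ++-identityʳ)
  open import Data.List.Membership.Propositional using (_∈_)
  open import Data.List.Membership.Propositional.Properties using (∈-map⁺; ∈-map⁻; ∈-++⁺ˡ; ∈-++⁺ʳ; ∈-++⁻; ∈-upTo⁺; ∈-upTo⁻; ∈-filter⁺; ∈-filter⁻; ∈-concatMap⁺; ∈-concatMap⁻)
  open import Data.List.Relation.Unary.All as All using (All; []; _∷_)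
  open import Data.List.Relation.Unary.Any as Any using (Any; here; there)
  open import Data.List.Relation.Unary.AllPairs using ([]; _∷_)
  open import Data.List.Relation.Unary.Linked using (Linked; []; [-]; _∷_)
  import Data.List.Relation.Unary.Linked as Linked
  open import Data.List.Relation.Unary.Linked.Properties using (Linked⇒AllPairs)
  open import Data.List.Relation.Unary.Unique.Propositional using (Unique)
  import Data.List.Relation.Unary.Unique.Propositional.Properties as Unique
  open import Data.Product using (_×_; _,_; ∃; proj₁; proj₂)
  open import Data.Sum using (inj₁; inj₂)
  open import Data.Empty using (⊥; ⊥-elim)
  open import Relation.Nullary using (yes; no; ¬_)
  open import Relation.Binary.PropositionalEquality using (_≡_; refl; sym; trans; cong; cong₂; subst)

  Unique-concatMap : ∀ {A B : Set} (f : A → List B) {xs} → Unique xs → (∀ x → Unique (f x)) →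
    (∀ {x y v} → v ∈ f x → v ∈ f y → x ≡ y) → Unique (concatMap f xs)
  Unique-concatMap f []       u s = []
  Unique-concatMap f {x ∷ xs} (x∉ ∷ uxs) u s = Unique.++⁺ (u x) (Unique-concatMap f uxs u s) λ (v∈x , v∈xs) → clash x∉ (∈-concatMap⁻ f v∈xs) v∈x
    where
    clash : ∀ {v ys} → All (λ y → ¬ x ≡ y) ys → Any (λ y → v ∈ f y) ys → v ∈ f x → ⊥
    clash (n ∷ _) (here v∈y)  v∈x = n (s v∈x v∈y)
    clash (_ ∷ a) (there any) v∈x = clash a any v∈x

  Bounded : ℕ → List ℕ → Set
  Bounded N = All (λ x → 1 ≤ x × x ≤ N)

  listsOfLength-unique : ∀ m ℓ → Unique (listsOfLength m ℓ)
  listsOfLength-unique m zero    = [] ∷ []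
  listsOfLength-unique m (suc ℓ) = Unique-concatMap (λ x → map (x ∷_) (listsOfLength m ℓ))
    (Unique.map⁺ suc-injective (Unique.upTo⁺ m))
    (λ x → Unique.map⁺ ∷-injectiveʳ (listsOfLength-unique m ℓ))
    (λ p q → ∷-injectiveˡ (trans (sym (proj₂ (proj₂ (∈-map⁻ _ p)))) (proj₂ (proj₂ (∈-map⁻ _ q)))))

  ∈-listsOfLength⁻ : ∀ m ℓ {α} → α ∈ listsOfLength m ℓ → length α ≡ ℓ × Bounded m α
  ∈-listsOfLength⁻ m zero    (here refl) = refl , []
  ∈-listsOfLength⁻ m (suc ℓ) α∈ = go (map suc (upTo m)) (λ x∈ → x∈) (∈-concatMap⁻ (λ x → map (x ∷_) (listsOfLength m ℓ)) α∈)
    where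
    go : ∀ {α} ys → (∀ {y} → y ∈ ys → y ∈ map suc (upTo m)) → Any (λ x → α ∈ map (x ∷_) (listsOfLength m ℓ)) ys → length α ≡ suc ℓ × Bounded m α
    go (y ∷ ys) inc (there any) = go ys (λ p → inc (there p)) any
    go (y ∷ ys) inc (here p) with ∈-map⁻ _ p | ∈-map⁻ suc (inc (here refl))
    ... | β , β∈ , refl | i , i∈ , refl with ∈-listsOfLength⁻ m ℓ β∈
    ...   | len , bd = cong suc len , (s≤s z≤n , ∈-upTo⁻ i∈) ∷ bd

  ∈-listsOfLength⁺ : ∀ m {α} → Bounded m α → α ∈ listsOfLength m (length α)
  ∈-listsOfLength⁺ m []                      = here refl
  ∈-listsOfLength⁺ m {suc x ∷ α} ((_ , x≤) ∷ bd) = ∈-concatMap⁺ (λ y → map (y ∷_) (listsOfLength m (length α)))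
    (Any.map (λ {y} e → subst (λ z → _ ∈ map (z ∷_) (listsOfLength m (length α))) e (∈-map⁺ (suc x ∷_) (∈-listsOfLength⁺ m bd))) (∈-map⁺ suc (∈-upTo⁺ x≤)))

  partitions-unique : ∀ n → Unique (partitions n)
  partitions-unique n = Unique.filter⁺ (isPartition? n) (Unique-concatMap (listsOfLength n) (Unique.upTo⁺ (suc n)) (listsOfLength-unique n)
    (λ p q → trans (sym (proj₁ (∈-listsOfLength⁻ n _ p))) (proj₁ (∈-listsOfLength⁻ n _ q))))

  ∈-partitions⁻ : ∀ n {α} → α ∈ partitions n → Linked _≥_ α × sum α ≡ n × Bounded n α
  ∈-partitions⁻ n α∈ with ∈-filter⁻ (isPartition? n) {xs = candidates n} α∈
  ... | c , (l , s) = l , s , go (upTo (suc n)) (∈-concatMap⁻ (listsOfLength n) c)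
    where
    go : ∀ {α} ys → Any (λ ℓ → α ∈ listsOfLength n ℓ) ys → Bounded n α
    go (y ∷ ys) (here p)  = proj₂ (∈-listsOfLength⁻ n y p)
    go (y ∷ ys) (there p) = go ys p

  length≤sum : ∀ {N α} → Bounded N α → length α ≤ sum α
  length≤sum []             = z≤n
  length≤sum ((1≤ , _) ∷ b) = +-mono-≤ 1≤ (length≤sum b)

  ∈-partitions⁺ : ∀ n {α} → Linked _≥_ α → sum α ≡ n → Bounded n α → α ∈ partitions n
  ∈-partitions⁺ n {α} l s b = ∈-filter⁺ (isPartition? n)
    (∈-concatMap⁺ (listsOfLength n) (Any.map (λ {ℓ} e → subst (λ z → α ∈ listsOfLength n z) e (∈-listsOfLength⁺ n b)) (∈-upTo⁺ (s≤s (subst (length α ≤_) s (length≤sum b))))))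
    (l , s)

  shift : ∀ {A : Set} → ℕ → (ℕ → List A) → ℕ → List A
  shift zero    g m       = g m
  shift (suc k) g zero    = []
  shift (suc k) g (suc m) = shift k g m

  shift-cong : ∀ {A : Set} k {g h : ℕ → List A} m → (∀ i → i ≤ m → g i ≡ h i) → shift k g m ≡ shift k h m
  shift-cong zero    m       e = e m ≤-refl
  shift-cong (suc k) zero    e = refl
  shift-cong (suc k) (suc m) e = shift-cong k m (λ i l → e i (m≤n⇒m≤1+n l))

  ∈-shift⁻ : ∀ {A : Set} k (g : ℕ → List A) m {x} → x ∈ shift k g m → ∃ λ i → m ≡ k + i × x ∈ g i
  ∈-shift⁻ zero    g m       p = m , refl , p
  ∈-shift⁻ (suc k) g (suc m) p with ∈-shift⁻ k g m p
  ... | i , e , q = i , cong suc e , q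

  ∈-shift⁺ : ∀ {A : Set} k (g : ℕ → List A) i {x} → x ∈ g i → x ∈ shift k g (k + i)
  ∈-shift⁺ zero    g i p = p
  ∈-shift⁺ (suc k) g i p = ∈-shift⁺ k g i p

  shift-unique : ∀ {A : Set} k (g : ℕ → List A) m → (∀ i → Unique (g i)) → Unique (shift k g m)
  shift-unique zero    g m       u = u m
  shift-unique (suc k) g zero    u = []
  shift-unique (suc k) g (suc m) u = shift-unique k g m u

  -- Partitions of m into parts ≤ N in which only the parts v with rep v = true may be repeated; the first argument is fuel.
  parts : (ℕ → Bool) → ℕ → ℕ → ℕ → List (List ℕ)
  parts rep f       zero    zero    = [] ∷ []
  parts rep f       zero    (suc m) = []
  parts rep zero    (suc N) m       = parts rep zero N m
  parts rep (suc f) (suc N) m       = parts rep (suc f) N m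
    ++ map (suc N ∷_) (shift (suc N) (parts rep f (if rep (suc N) then suc N else N)) m)

  next≤ : ∀ (b : Bool) N → (if b then suc N else N) ≤ suc N
  next≤ true  N = ≤-refl
  next≤ false N = n≤1+n N

  -- Each part taken costs one unit of fuel and at least one unit of m, so any fuel ≥ m gives the
  -- same list.
  parts-fuel : ∀ rep f f′ N m → m ≤ f → m ≤ f′ → parts rep f N m ≡ parts rep f′ N m
  parts-fuel rep f       f′       zero    zero    l l′ = refl
  parts-fuel rep f       f′       zero    (suc m) l l′ = refl
  parts-fuel rep zero    zero     (suc N) m       l l′ = refl
  parts-fuel rep zero    (suc f′) (suc N) zero    l l′ =
    trans (parts-fuel rep zero (suc f′) N zero l l′) (sym (++-identityʳ _))
  parts-fuel rep (suc f) zero     (suc N) zero    l l′ =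
    trans (++-identityʳ _) (parts-fuel rep (suc f) zero N zero l l′)
  parts-fuel rep (suc f) (suc f′) (suc N) zero    l l′ = cong (_++ []) (parts-fuel rep (suc f) (suc f′) N zero l l′)
  parts-fuel rep (suc f) (suc f′) (suc N) (suc m) l@(s≤s mf) l′@(s≤s mf′) =
    cong₂ (λ x y → x ++ map (suc N ∷_) y) (parts-fuel rep (suc f) (suc f′) N (suc m) l l′)
      (shift-cong N m (λ i i≤m → parts-fuel rep f f′ (if rep (suc N) then suc N else N) i (≤-trans i≤m mf) (≤-trans i≤m mf′)))

  Bounded-mono : ∀ {M N α} → M ≤ N → Bounded M α → Bounded N α
  Bounded-mono l = All.map (λ (a , b) → a , ≤-trans b l)

  Linked-cons : ∀ {N α} → Bounded N α → Linked _≥_ α → Linked _≥_ (N ∷ α)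
  Linked-cons []             l = [-]
  Linked-cons ((_ , x≤) ∷ _) l = x≤ ∷ l

  ∈-parts⁻ : ∀ rep f N m {α} → α ∈ parts rep f N m → Linked _≥_ α × sum α ≡ m × Bounded N α
  ∈-parts⁻ rep f       zero    zero (here refl) = [] , refl , []
  ∈-parts⁻ rep zero    (suc N) m    p with ∈-parts⁻ rep zero N m p
  ... | l , s , b = l , s , Bounded-mono (n≤1+n N) b
  ∈-parts⁻ rep (suc f) (suc N) m    p with ∈-++⁻ (parts rep (suc f) N m) p
  ... | inj₁ q with ∈-parts⁻ rep (suc f) N m q
  ...   | l , s , b = l , s , Bounded-mono (n≤1+n N) b
  ∈-parts⁻ rep (suc f) (suc N) m    p | inj₂ q with ∈-map⁻ (suc N ∷_) q
  ... | β , β∈ , refl with ∈-shift⁻ (suc N) (parts rep f (if rep (suc N) then suc N else N)) m β∈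
  ...   | i , refl , r with ∈-parts⁻ rep f _ i r
  ...     | l , refl , b = Linked-cons b′ l , refl , (s≤s z≤n , ≤-refl) ∷ b′
    where b′ = Bounded-mono (next≤ (rep (suc N)) N) b

  parts-unique : ∀ rep f N m → Unique (parts rep f N m)
  parts-unique rep f       zero    zero    = [] ∷ []
  parts-unique rep f       zero    (suc m) = []
  parts-unique rep zero    (suc N) m       = parts-unique rep zero N m
  parts-unique rep (suc f) (suc N) m       = Unique.++⁺ (parts-unique rep (suc f) N m)
    (Unique.map⁺ ∷-injectiveʳ (shift-unique (suc N) _ m (parts-unique rep f (if rep (suc N) then suc N else N)))) disj
    where
    disj : ∀ {v} → v ∈ parts rep (suc f) N m × v ∈ map (suc N ∷_) (shift (suc N) (parts rep f (if rep (suc N) then suc N else N)) m) → ⊥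
    disj (p , q) with ∈-map⁻ (suc N ∷_) q
    ... | β , _ , refl with ∈-parts⁻ rep (suc f) N m p
    ...   | _ , _ , ((_ , N<N) ∷ _) = <-irrefl refl N<N

  anyPart : ℕ → Bool
  anyPart _ = true

  head-bounds : ∀ {a N α} → Linked _≥_ (a ∷ α) → Bounded N (a ∷ α) → Bounded a (a ∷ α)
  head-bounds l b with Linked⇒AllPairs (λ p q → ≤-trans q p) l
  head-bounds l ((1≤ , _) ∷ b) | a≥ ∷ _ = (1≤ , ≤-refl) ∷ All.zipWith (λ ((p , _) , q) → p , q) (b , a≥)

  ∈-parts⁺ : ∀ f N m {α} → m ≤ f → Linked _≥_ α → sum α ≡ m → Bounded N α → α ∈ parts anyPart f N m
  ∈-parts⁺ f       zero    _ l lk refl []                = here refl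
  ∈-parts⁺ f       zero    _ l lk s    ((1≤ , ≤0) ∷ _)   = ⊥-elim (<-irrefl refl (≤-trans 1≤ ≤0))
  ∈-parts⁺ zero    (suc N) m l lk s    []                = ∈-parts⁺ zero N m l lk s []
  ∈-parts⁺ zero    (suc N) m l lk refl ((1≤ , _) ∷ b)    = ⊥-elim (<-irrefl refl (≤-trans 1≤ (≤-trans (m≤m+n _ _) l)))
  ∈-parts⁺ (suc f) (suc N) m l lk s    []                = ∈-++⁺ˡ (∈-parts⁺ (suc f) N m l lk s [])
  ∈-parts⁺ (suc f) (suc N) m {a ∷ α} l lk s b@((1≤ , a≤) ∷ b′) with m≤n⇒m<n∨m≡n a≤
  ... | inj₁ (s≤s a≤N) = ∈-++⁺ˡ (∈-parts⁺ (suc f) N m l lk s (Bounded-mono a≤N (head-bounds lk b)))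
  ... | inj₂ refl with s
  ...   | refl = ∈-++⁺ʳ (parts anyPart (suc f) N m) (∈-map⁺ (suc N ∷_) (∈-shift⁺ (suc N) (parts anyPart f (suc N)) (sum α)
           (∈-parts⁺ f (suc N) (sum α) (≤-trans (m≤n+m (sum α) N) (≤-pred l)) (Linked.tail lk) refl b′)))

  -- Truncated subtraction is the positive part: this counts the cells of the Young diagram to the
  -- right of column t.
  excess : ℕ → List ℕ → ℕ
  excess t []      = 0
  excess t (a ∷ α) = (a ∸ t) + excess t α

  excess-zero : ∀ {N} t {α} → N ≤ t → Bounded N α → excess t α ≡ 0
  excess-zero t l []             = refl
  excess-zero t l ((_ , a≤) ∷ b) = cong₂ _+_ (m≤n⇒m∸n≡0 (≤-trans a≤ l)) (excess-zero t l b)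

  -- The witness is the number of parts ≥ t; these form a prefix because the parts decrease.
  excess-attained : ∀ {N} t {α} → Linked _≥_ α → Bounded N α → ∃ λ i → excess t α + i * t ≡ sum (take i α)
  excess-attained t {[]}    lk b = 0 , refl
  excess-attained t {a ∷ α} lk b@(_ ∷ b′) with t ≤? a
  ... | no t≰a = 0 , trans (+-identityʳ _) (excess-zero t (<⇒≤ (≰⇒> t≰a)) (head-bounds lk b))
  ... | yes t≤a with excess-attained t (Linked.tail lk) b′
  ...   | i , e = suc i , trans (shuffle (a ∸ t) (excess t α) t (i * t)) (cong₂ _+_ (m∸n+n≡m t≤a) e)
    where shuffle : ∀ x y z w → (x + y) + (z + w) ≡ (x + z) + (y + w)
          shuffle x y z w = trans (+-assoc x y (z + w)) (trans (cong (x +_) (trans (sym (+-assoc y z w)) (trans (cong (_+ w) (+-comm y z)) (+-assoc z y w)))) (sym (+-assoc x z (y + w))))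

  sum-take≤excess : ∀ t i β → sum (take i β) ≤ excess t β + i * t
  sum-take≤excess t zero    β       = z≤n
  sum-take≤excess t (suc i) []      = z≤n
  sum-take≤excess t (suc i) (b ∷ β) = ≤-trans (+-mono-≤ (≤-trans (m≤n+m∸n b t) (≤-reflexive (+-comm t (b ∸ t)))) (sum-take≤excess t i β))
     (≤-reflexive (shuffle (b ∸ t) t (excess t β) (i * t)))
    where shuffle : ∀ x z y w → (x + z) + (y + w) ≡ (x + y) + (z + w)
          shuffle x y z w = trans (+-assoc x y (z + w)) (trans (cong (x +_) (trans (sym (+-assoc y z w)) (trans (cong (_+ w) (+-comm y z)) (+-assoc z y w)))) (sym (+-assoc x z (y + w))))

  -- The excess at t is the maximum over i of the i-th prefix sum minus i t, a Legendre transform,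
  -- and hence monotone in the prefix sums.
  ⪯⇒excess : ∀ {N α β} → Linked _≥_ α → Bounded N α → α ⪯ β → ∀ t → excess t α ≤ excess t β
  ⪯⇒excess {α = α} {β} lk b dom t with excess-attained t lk b
  ... | i , e = +-cancelʳ-≤ (i * t) (excess t α) (excess t β) (≤-trans (≤-reflexive e) (≤-trans (dom i) (sum-take≤excess t i β)))

-- Counting by sums over lists, and the loss from repeated large parts.

module Counting where

  open import Defs using (partitions; p; dominatedPairs; _⪯?_)
  open import Data.Bool using (Bool; true; false; if_then_else_)
  open import Data.Nat as ℕ using (ℕ; zero; suc)
  import Data.Nat.Properties as ℕ
  open import Data.Rational
  open import Data.Rational.Properties
  open import Data.List using (List; []; _∷_; _++_; map; length; filter; cartesianProduct)
  open import Data.List.Properties using (++-identityʳ)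
  open import Data.List.Membership.Propositional using (_∈_)
  open import Data.List.Membership.Propositional.Properties using (∈-++⁺ˡ; ∈-++⁺ʳ; ∈-++⁻; ∈-∃++)
  open import Data.List.Relation.Unary.All as All using (All; []; _∷_)
  open import Data.List.Relation.Unary.Any using (here; there)
  open import Data.List.Relation.Unary.AllPairs using ([]; _∷_)
  open import Data.List.Relation.Unary.Unique.Propositional using (Unique)
  open import Data.Product using (_×_; _,_; proj₁; proj₂)
  open import Data.Sum using (inj₁; inj₂)
  open import Data.Empty using (⊥-elim)
  open import Relation.Nullary using (Dec; does)
  open import Relation.Nullary.Decidable using (dec-true; dec-false)
  open import Relation.Binary.PropositionalEquality using (_≡_; refl; sym; trans; cong; cong₂; subst; subst₂)
  open import Tactic.RingSolver using (solve-∀)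
  open Rationals
  open CellSums
  open PartitionLists

  Σl : {A : Set} → (A → ℚ) → List A → ℚ
  Σl F []       = 0ℚ
  Σl F (x ∷ xs) = F x + Σl F xs

  Σl-++ : ∀ {A : Set} (F : A → ℚ) xs ys → Σl F (xs ++ ys) ≡ Σl F xs + Σl F ys
  Σl-++ F []       ys = sym (+-identityˡ (Σl F ys))
  Σl-++ F (x ∷ xs) ys = trans (cong (F x +_) (Σl-++ F xs ys)) (sym (+-assoc (F x) (Σl F xs) (Σl F ys)))

  Σl-map : ∀ {A B : Set} (F : B → ℚ) (g : A → B) xs → Σl F (map g xs) ≡ Σl (λ x → F (g x)) xs
  Σl-map F g []       = refl
  Σl-map F g (x ∷ xs) = cong (F (g x) +_) (Σl-map F g xs)

  Σl-mono : ∀ {A : Set} {F G : A → ℚ} xs → (∀ {x} → x ∈ xs → F x ≤ G x) → Σl F xs ≤ Σl G xs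
  Σl-mono []       h = ≤-refl
  Σl-mono (x ∷ xs) h = +-mono-≤ (h (here refl)) (Σl-mono xs (λ q → h (there q)))

  Σl≥0 : ∀ {A : Set} {F : A → ℚ} xs → (∀ x → 0ℚ ≤ F x) → 0ℚ ≤ Σl F xs
  Σl≥0 []       h = ≤-refl
  Σl≥0 (x ∷ xs) h = h x ⊕ Σl≥0 xs h

  Σl-const : ∀ {A : Set} c (xs : List A) → Σl (λ _ → c) xs ≡ κ (length xs) * c
  Σl-const c []       = sym (*-zeroˡ c)
  Σl-const c (x ∷ xs) = trans (cong (c +_) (Σl-const c xs)) (e c (κ (length xs)))
    where e : ∀ c k → c + k * c ≡ (1ℚ + k) * c
          e = solve-∀ ring

  Σl-length : ∀ {A : Set} (xs : List A) → Σl (λ _ → 1ℚ) xs ≡ κ (length xs)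
  Σl-length xs = trans (Σl-const 1ℚ xs) (*-identityʳ _)

  Σl-+ : ∀ {A : Set} (F G : A → ℚ) xs → Σl (λ x → F x + G x) xs ≡ Σl F xs + Σl G xs
  Σl-+ F G []       = refl
  Σl-+ F G (x ∷ xs) = trans (cong (F x + G x +_) (Σl-+ F G xs)) (e (F x) (G x) (Σl F xs) (Σl G xs))
    where e : ∀ a b c d → a + b + (c + d) ≡ a + c + (b + d)
          e = solve-∀ ring

  Σl-⊆ : ∀ {A : Set} (F : A → ℚ) {xs ys} → (∀ x → 0ℚ ≤ F x) → Unique xs → (∀ {x} → x ∈ xs → x ∈ ys) → Σl F xs ≤ Σl F ys
  Σl-⊆ F {[]}     {ys} F≥0 u inc = Σl≥0 ys F≥0
  Σl-⊆ F {x ∷ xs} {ys} F≥0 (x∉ ∷ u) inc with ∈-∃++ (inc (here refl))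
  ... | as , bs , refl = ≤-trans (+-monoʳ-≤ (F x) (Σl-⊆ F F≥0 u inc′)) (≤-reflexive (trans (cong (F x +_) (Σl-++ F as bs))
          (trans (e (F x) (Σl F as) (Σl F bs)) (sym (Σl-++ F as (x ∷ bs))))))
    where
    e : ∀ a b c → a + (b + c) ≡ b + (a + c)
    e = solve-∀ ring
    inc′ : ∀ {y} → y ∈ xs → y ∈ as ++ bs
    inc′ {y} y∈ with ∈-++⁻ as (inc (there y∈))
    ... | inj₁ q         = ∈-++⁺ˡ q
    ... | inj₂ (here e)  = ⊥-elim (All.lookup x∉ y∈ (sym e))
    ... | inj₂ (there q) = ∈-++⁺ʳ as q

  -- This is `Σl-⊆` for the function 1 - F: each discarded element costs at most one.
  Σl-⊆-defect : ∀ {A : Set} (F : A → ℚ) {xs ys} → (∀ x → F x ≤ 1ℚ) → Unique xs → (∀ {x} → x ∈ xs → x ∈ ys) →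
    Σl F ys ≤ Σl F xs + (κ (length ys) - κ (length xs))
  Σl-⊆-defect F {xs} {ys} F≤1 u inc = by (gap (subst₂ _≤_ (co xs) (co ys) (Σl-⊆ G (λ x → gap (F≤1 x)) u inc)))
      (e (Σl F xs) (Σl F ys) (κ (length xs)) (κ (length ys)))
    where
    G = λ x → 1ℚ - F x
    e : ∀ a b m n → a + (n - m) ≡ b + (n - b - (m - a))
    e = solve-∀ ring
    co : ∀ zs → Σl G zs ≡ κ (length zs) - Σl F zs
    co []       = refl
    co (z ∷ zs) = trans (cong (1ℚ - F z +_) (co zs)) (e′ (F z) (κ (length zs)) (Σl F zs))
      where e′ : ∀ a k s → 1ℚ - a + (k - s) ≡ 1ℚ + k - (a + s)
            e′ = solve-∀ ring

  length-filter : ∀ {A : Set} {P : A → Set} (P? : ∀ x → Dec (P x)) xs → κ (length (filter P? xs)) ≡ Σl (λ x → if does (P? x) then 1ℚ else 0ℚ) xs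
  length-filter P? [] = refl
  length-filter P? (x ∷ xs) with does (P? x)
  ... | true  = cong (1ℚ +_) (length-filter P? xs)
  ... | false = trans (length-filter P? xs) (sym (+-identityˡ _))

  Σl-product : ∀ {A B : Set} (F : A × B → ℚ) xs ys → Σl F (cartesianProduct xs ys) ≡ Σl (λ x → Σl (λ y → F (x , y)) ys) xs
  Σl-product F []       ys = refl
  Σl-product F (x ∷ xs) ys = trans (Σl-++ F (map (x ,_) ys) (cartesianProduct xs ys)) (cong₂ _+_ (Σl-map F (x ,_) ys) (Σl-product F xs ys))

  length-shift : ∀ {A : Set} k (g : ℕ → List A) m → κ (length (shift k g m)) ≡ sh k (λ i → κ (length (g i))) m
  length-shift zero    g m       = refl
  length-shift (suc k) g zero    = refl
  length-shift (suc k) g (suc m) = length-shift k g m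

  length-cons : ∀ {A : Set} (v : A) (as : List (List A)) bs → κ (length (as ++ map (v ∷_) bs)) ≡ κ (length as) + κ (length bs)
  length-cons v as bs = trans (cong κ (length-++ as)) (trans (κ-+ (length as) (length (map (v ∷_) bs))) (cong (λ x → κ (length as) + κ x) (length-map (v ∷_) bs)))
    where open import Data.List.Properties using (length-++; length-map)

  P : (ℕ → Bool) → ℕ → ℕ → List (List ℕ)
  P rep N m = parts rep m N m

  P-step : ∀ rep N m → P rep (suc N) m ≡ P rep N m ++ map (suc N ∷_) (shift (suc N) (P rep (if rep (suc N) then suc N else N)) m)
  P-step rep N zero    = sym (++-identityʳ _)
  P-step rep N (suc m) = cong (λ x → parts rep (suc m) N (suc m) ++ map (suc N ∷_) x)
    (shift-cong N m (λ i i≤m → parts-fuel rep m i (if rep (suc N) then suc N else N) i i≤m ℕ.≤-refl))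

  f : ℕ → ℕ → ℚ
  f N m = κ (length (P anyPart N m))

  f≥0 : ∀ N m → 0ℚ ≤ f N m
  f≥0 N m = κ≥0 (length (P anyPart N m))

  f-step : ∀ N m → f (suc N) m ≡ f N m + sh (suc N) (f (suc N)) m
  f-step N m = trans (cong (λ x → κ (length x)) (P-step anyPart N m))
    (trans (length-cons (suc N) (P anyPart N m) (shift (suc N) (P anyPart (suc N)) m)) (cong (f N m +_) (length-shift (suc N) (P anyPart (suc N)) m)))

  f-base : ∀ m → f 0 (suc m) ≡ 0ℚ
  f-base m = refl

  f-zero : ∀ N → f N 0 ≡ 1ℚ
  f-zero zero    = refl
  f-zero (suc N) = f-zero N

  f-mono : ∀ N m → f (suc N) m ≤ f (suc N) (suc m)
  f-mono zero    m = ≤-reflexive (sym (trans (f-step 0 (suc m)) (+-identityˡ _)))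
  f-mono (suc N) m = go m m ℕ.≤-refl
    where
    v = suc (suc N)
    go : ∀ b m → m ℕ.≤ b → f v m ≤ f v (suc m)
    go b m l = subst₂ _≤_ (sym (f-step (suc N) m)) (sym (f-step (suc N) (suc m))) (+-mono-≤ (f-mono N m) (tl b l))
      where
      tl : ∀ b → m ℕ.≤ b → sh v (f v) m ≤ sh v (f v) (suc m)
      tl b l with ℕ-split m v
      ... | inj₁ m<v = subst (_≤ sh v (f v) (suc m)) (sym (sh-miss v (f v) m m<v)) (sh≥0 v (suc m) (f≥0 v))
      tl (suc b) (ℕ.s≤s l) | inj₂ (m′ , refl) = subst₂ _≤_ (sym (sh-hit v (f v) m′)) (sym (trans (cong (sh v (f v)) (sym (ℕ.+-suc v m′))) (sh-hit v (f v) (suc m′))))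
         (go b m′ (ℕ.≤-trans (ℕ.m≤n+m m′ (suc N)) l))

  distinct : ℕ → ℕ → Bool
  distinct θ′ v = does (v ℕ.≤? θ′)

  below : ∀ θ′ f N m → N ℕ.≤ θ′ → parts (distinct θ′) f N m ≡ parts anyPart f N m
  below θ′ f       zero    zero    l = refl
  below θ′ f       zero    (suc m) l = refl
  below θ′ zero    (suc N) m       l = below θ′ zero N m (ℕ.<⇒≤ l)
  below θ′ (suc f) (suc N) m       l rewrite dec-true (suc N ℕ.≤? θ′) l =
    cong₂ (λ x y → x ++ map (suc N ∷_) y) (below θ′ (suc f) N m (ℕ.<⇒≤ l)) (shift-cong (suc N) m (λ i _ → below θ′ f (suc N) i l))

  module Distinct (θ′ : ℕ) where

    Q : ℕ → ℕ → List (List ℕ)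
    Q k m = P (distinct θ′) (k ℕ.+ θ′) m

    g : ℕ → ℕ → ℚ
    g k m = κ (length (Q k m))

    -- The index fits the walk: the step from level k + 1 to level k decides on `part k`, which is
    -- also the threshold t whose excess is tested at level k.
    part : ℕ → ℕ
    part k = suc (k ℕ.+ θ′)

    Q-zero : ∀ m → Q 0 m ≡ P anyPart θ′ m
    Q-zero m = below θ′ m θ′ m ℕ.≤-refl

    Q-step : ∀ k m → Q (suc k) m ≡ Q k m ++ map (part k ∷_) (shift (part k) (Q k) m)
    Q-step k m = trans (P-step (distinct θ′) (k ℕ.+ θ′) m)
      (cong (λ b → Q k m ++ map (part k ∷_) (shift (part k) (P (distinct θ′) (if b then part k else k ℕ.+ θ′)) m))
        (dec-false (part k ℕ.≤? θ′) (λ l → ℕ.<-irrefl refl (ℕ.<-≤-trans (ℕ.s≤s (ℕ.m≤n+m θ′ k)) l))))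

    g-step : ∀ k m → g (suc k) m ≡ g k m + sh (part k) (g k) m
    g-step k m = trans (cong (λ x → κ (length x)) (Q-step k m)) (trans (length-cons (part k) (Q k m) _) (cong (g k m +_) (length-shift (part k) (Q k) m)))

    -- A partition with a repeated part w > θ′ gives a partition of m - 2w, two copies of w being removed.
    repeated : ∀ k m → f (k ℕ.+ θ′) m ≤ g k m + Σ< k (λ i → sh (part i ℕ.+ part i) (f (k ℕ.+ θ′)) m)
    repeated zero    m = ≤-reflexive (sym (trans (+-identityʳ (g 0 m)) (cong (λ x → κ (length x)) (Q-zero m))))
    repeated (suc k) m = ≤-trans (≤-reflexive unfold) (≤-trans (+-monoˡ-≤ (sh (part k ℕ.+ part k) (f (part k)) m)
        (+-mono-≤ (repeated k m) (≤-trans (sh-mono (part k) m (repeated k)) (≤-reflexive (sh-linear (part k) (g k) (λ m → Σ< k (λ i → sh (part i ℕ.+ part i) (f (k ℕ.+ θ′)) m)) m)))))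
        (≤-trans (≤-reflexive (e (g k m) (Σ< k (λ i → sh (part i ℕ.+ part i) (f (k ℕ.+ θ′)) m)) (sh (part k) (g k) m) (sh (part k) (λ m → Σ< k (λ i → sh (part i ℕ.+ part i) (f (k ℕ.+ θ′)) m)) m) (sh (part k ℕ.+ part k) (f (part k)) m)))
          (+-mono-≤ (≤-reflexive (sym (g-step k m))) (+-monoˡ-≤ (sh (part k ℕ.+ part k) (f (part k)) m) collect))))
      where
      e : ∀ a s b t c → a + s + (b + t) + c ≡ (a + b) + ((s + t) + c)
      e = solve-∀ ring
      unfold : f (part k) m ≡ f (k ℕ.+ θ′) m + sh (part k) (f (k ℕ.+ θ′)) m + sh (part k ℕ.+ part k) (f (part k)) m
      unfold = trans (f-step (k ℕ.+ θ′) m) (trans (cong (f (k ℕ.+ θ′) m +_)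
        (trans (sh-cong (part k) m (f-step (k ℕ.+ θ′))) (trans (sh-linear (part k) (f (k ℕ.+ θ′)) (sh (part k) (f (part k))) m)
           (cong (sh (part k) (f (k ℕ.+ θ′)) m +_) (sh-sh (part k) (part k) (f (part k)) m)))))
        (sym (+-assoc (f (k ℕ.+ θ′) m) _ _)))
      two : ∀ m → f (k ℕ.+ θ′) m + sh (part k) (f (k ℕ.+ θ′)) m ≤ f (part k) m
      two m = ≤-trans (+-monoʳ-≤ (f (k ℕ.+ θ′) m) (sh-mono (part k) m (λ i → by (sh≥0 (part k) i (f≥0 (part k))) (f-step (k ℕ.+ θ′) i)))) (≤-reflexive (sym (f-step (k ℕ.+ θ′) m)))
      collect : Σ< k (λ i → sh (part i ℕ.+ part i) (f (k ℕ.+ θ′)) m) + sh (part k) (λ m → Σ< k (λ i → sh (part i ℕ.+ part i) (f (k ℕ.+ θ′)) m)) m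
                  ≤ Σ< k (λ i → sh (part i ℕ.+ part i) (f (part k)) m)
      collect = ≤-trans (≤-reflexive (trans (cong (Σ< k (λ i → sh (part i ℕ.+ part i) (f (k ℕ.+ θ′)) m) +_) (sh-Σ (part k) k (λ i → sh (part i ℕ.+ part i) (f (k ℕ.+ θ′))) m))
                   (sym (Σ<-+ k _ _))))
         (Σ<-mono k (λ i _ → ≤-trans (≤-reflexive (trans (cong (sh (part i ℕ.+ part i) (f (k ℕ.+ θ′)) m +_)
              (trans (sh-sh (part k) (part i ℕ.+ part i) (f (k ℕ.+ θ′)) m) (trans (cong (λ x → sh x (f (k ℕ.+ θ′)) m) (ℕ.+-comm (part k) (part i ℕ.+ part i))) (sym (sh-sh (part i ℕ.+ part i) (part k) (f (k ℕ.+ θ′)) m)))))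
              (sym (sh-linear (part i ℕ.+ part i) (f (k ℕ.+ θ′)) (sh (part k) (f (k ℕ.+ θ′))) m))))
            (sh-mono (part i ℕ.+ part i) m two)))

  ind : List ℕ → List ℕ → ℚ
  ind α β = if does (α ⪯? β) then 1ℚ else 0ℚ

  ind≥0 : ∀ α β → 0ℚ ≤ ind α β
  ind≥0 α β with does (α ⪯? β)
  ... | true  = nonNegative⁻¹ 1ℚ
  ... | false = ≤-refl

  ind≤1 : ∀ α β → ind α β ≤ 1ℚ
  ind≤1 α β with does (α ⪯? β)
  ... | true  = ≤-refl
  ... | false = nonNegative⁻¹ 1ℚ

  module Pairs (n : ℕ) where

    private
      L = P anyPart n n
      to : ∀ {α} → α ∈ partitions n → α ∈ L
      to α∈ with ∈-partitions⁻ n α∈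
      ... | l , s , b = ∈-parts⁺ n n n ℕ.≤-refl l s b
      from : ∀ {α} → α ∈ L → α ∈ partitions n
      from α∈ with ∈-parts⁻ anyPart n n n α∈
      ... | l , s , b = ∈-partitions⁺ n l s b

    p≡f : κ (p n) ≡ f n n
    p≡f = ≤-antisym
      (subst₂ _≤_ (Σl-length (partitions n)) (Σl-length L) (Σl-⊆ (λ _ → 1ℚ) (λ _ → nonNegative⁻¹ 1ℚ) (partitions-unique n) to))
      (subst₂ _≤_ (Σl-length L) (Σl-length (partitions n)) (Σl-⊆ (λ _ → 1ℚ) (λ _ → nonNegative⁻¹ 1ℚ) (parts-unique anyPart n n n) from))

    module _ (θ′ k : ℕ) (n≡ : n ≡ k ℕ.+ θ′) where
      open Distinct θ′

      private
        T = Q k n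
        inc : ∀ {α} → α ∈ T → α ∈ L
        inc α∈ with ∈-parts⁻ (distinct θ′) n (k ℕ.+ θ′) n α∈
        ... | l , s , b = ∈-parts⁺ n n n ℕ.≤-refl l s (subst (λ N → Bounded N _) (sym n≡) b)
        uT : Unique T
        uT = parts-unique (distinct θ′) n (k ℕ.+ θ′) n

      distinct≤p : g k n ≤ κ (p n)
      distinct≤p = subst₂ _≤_ (Σl-length T) (trans (Σl-length L) (sym p≡f)) (Σl-⊆ (λ _ → 1ℚ) (λ _ → nonNegative⁻¹ 1ℚ) uT inc)

      -- The defect bound is applied first to the second coordinate and, after exchanging the sums,
      -- to the first. Each application loses at most p (p - g).
      dominated-split : κ (dominatedPairs n) ≤ Σl (λ α → Σl (ind α) T) T + κ 2 * κ (p n) * (κ (p n) - g k n)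
      dominated-split = ≤-trans (≤-reflexive (trans (length-filter (λ ab → proj₁ ab ⪯? proj₂ ab) (cartesianProduct (partitions n) (partitions n)))
           (Σl-product (λ ab → ind (proj₁ ab) (proj₂ ab)) (partitions n) (partitions n))))
        (≤-trans (Σl-⊆ _ (λ α → Σl≥0 (partitions n) (ind≥0 α)) (partitions-unique n) to)
        (≤-trans (Σl-mono L (λ {α} _ → ≤-trans (Σl-⊆ (ind α) (ind≥0 α) (partitions-unique n) to) (Σl-⊆-defect (ind α) (ind≤1 α) uT inc)))
        (≤-trans (≤-reflexive (trans (Σl-+ (λ α → Σl (ind α) T) (λ _ → κ (length L) - κ (length T)) L) (cong₂ _+_ (Σl-swap L T) (Σl-const _ L))))
        (≤-trans (+-monoˡ-≤ _ (≤-trans (Σl-mono T (λ {β} _ → Σl-⊆-defect (λ α → ind α β) (λ α → ind≤1 α β) uT inc)) (≤-reflexive (trans (Σl-+ _ _ T) (cong₂ _+_ (sym (Σl-swap T T)) (Σl-const _ T))))))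
          (by (gap t≤l ⊗ gap t≤l) (trans (cong (λ x → Σl (λ α → Σl (ind α) T) T + κ 2 * x * (x - g k n)) p≡f) (e (Σl (λ α → Σl (ind α) T) T) (κ (length L)) (κ (length T)))))))))
        where
        t≤l = subst (g k n ≤_) p≡f distinct≤p
        e : ∀ s l t → s + κ 2 * l * (l - t) ≡ s + t * (l - t) + l * (l - t) + (l - t) * (l - t)
        e = solve-∀ ring
        Σl-swap : ∀ (xs ys : List (List ℕ)) → Σl (λ α → Σl (ind α) ys) xs ≡ Σl (λ β → Σl (λ α → ind α β) xs) ys
        Σl-swap []       ys = sym (trans (Σl-const 0ℚ ys) (*-zeroʳ (κ (length ys))))
        Σl-swap (x ∷ xs) ys = trans (cong (Σl (ind x) ys +_) (Σl-swap xs ys)) (sym (Σl-+ (ind x) (λ β → Σl (λ α → ind α β) xs) ys))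

-- The integrated symmetric walk and its moments.

module RandomWalk where

  open import Data.Nat as ℕ using (ℕ; zero; suc)
  import Data.Nat.Properties as ℕ
  open import Data.Rational
  open import Data.Rational.Properties
  open import Data.Product using (_,_; proj₁; proj₂)
  open import Data.Sum using (inj₁; inj₂)
  open import Data.Empty using (⊥-elim)
  open import Relation.Nullary using (yes; no)
  open import Relation.Binary.PropositionalEquality using (_≡_; refl; sym; trans; cong; cong₂; subst)
  open import Tactic.RingSolver using (solve-∀)
  open Rationals
  open Riccati using (1≥0)

  𝟙 : ℚ → ℚ
  𝟙 x with 0ℚ ≤? x
  ... | yes _ = 1ℚ
  ... | no  _ = 0ℚ

  𝟙≥0 : ∀ x → 0ℚ ≤ 𝟙 x
  𝟙≥0 x with 0ℚ ≤? x
  ... | yes _ = 1≥0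
  ... | no  _ = ≤-refl

  𝟙-yes : ∀ {x} → 0ℚ ≤ x → 𝟙 x ≡ 1ℚ
  𝟙-yes {x} h with 0ℚ ≤? x
  ... | yes _ = refl
  ... | no x≱0 = ⊥-elim (x≱0 h)

  𝟙≤1 : ∀ x → 𝟙 x ≤ 1ℚ
  𝟙≤1 x with 0ℚ ≤? x
  ... | yes _ = ≤-refl
  ... | no  _ = 1≥0

  -- The left side averages two points symmetric about R. The right side is 2 - (2u - u²) with u = t (y² - R²):
  -- 2u - u² is at most 1, and at most 0 when y² ≤ R².
  𝟙-symmetric : ∀ t R y → 0ℚ ≤ t →
    𝟙 (R + y) + 𝟙 (R - y) ≤ κ 2 - (κ 2 * t * (y * y - R * R) - t * t * ((y * y - R * R) * (y * y - R * R)))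
  𝟙-symmetric t R y t≥0 with ≤-total (y * y) (R * R)
  ... | inj₁ small = by (gap (𝟙≤1 (R + y)) ⊕ gap (𝟙≤1 (R - y)) ⊕ κ≥0 2 ⊗ t≥0 ⊗ gap small ⊕ sq≥0 (t * (y * y - R * R))) (e t R y (𝟙 (R + y)) (𝟙 (R - y)))
    where e : ∀ t R y a b → κ 2 - (κ 2 * t * (y * y - R * R) - t * t * ((y * y - R * R) * (y * y - R * R))) ≡
                a + b + ((1ℚ - a) + (1ℚ - b) + κ 2 * t * (R * R - y * y) + t * (y * y - R * R) * (t * (y * y - R * R)))
          e = solve-∀ ring
  ... | inj₂ large with y * y ≤? R * R
  ...   | yes small = by (gap (𝟙≤1 (R + y)) ⊕ gap (𝟙≤1 (R - y)) ⊕ κ≥0 2 ⊗ t≥0 ⊗ gap small ⊕ sq≥0 (t * (y * y - R * R))) (e t R y (𝟙 (R + y)) (𝟙 (R - y)))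
    where e : ∀ t R y a b → κ 2 - (κ 2 * t * (y * y - R * R) - t * t * ((y * y - R * R) * (y * y - R * R))) ≡
                a + b + ((1ℚ - a) + (1ℚ - b) + κ 2 * t * (R * R - y * y) + t * (y * y - R * R) * (t * (y * y - R * R)))
          e = solve-∀ ring
  ...   | no ¬small = ≤-trans one (by (sq≥0 (1ℚ - t * (y * y - R * R))) (e t R y))
    where
    e : ∀ t R y → κ 2 - (κ 2 * t * (y * y - R * R) - t * t * ((y * y - R * R) * (y * y - R * R))) ≡ 1ℚ + (1ℚ - t * (y * y - R * R)) * (1ℚ - t * (y * y - R * R))
    e = solve-∀ ring
    e′ : ∀ R y → R * R ≡ y * y + (R + y) * (R - y)
    e′ = solve-∀ ring
    one : 𝟙 (R + y) + 𝟙 (R - y) ≤ 1ℚ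
    one with 0ℚ ≤? R + y | 0ℚ ≤? R - y
    ... | yes p | yes q = ⊥-elim (¬small (by (p ⊗ q) (e′ R y)))
    ... | yes p | no _  = ≤-refl
    ... | no _  | yes q = ≤-refl
    ... | no _  | no _  = 1≥0

  avg : ℚ → ℚ → ℚ → ℚ → ℚ
  avg π a b c = (1ℚ - κ 2 * π) * a + π * b + π * c

  module Walk (π : ℕ → ℚ) (π≥0 : ∀ k → 0ℚ ≤ π k) (π≤½ : ∀ k → κ 2 * π k ≤ 1ℚ) where

    avg-mono : ∀ k {a b c a′ b′ c′} → a ≤ a′ → b ≤ b′ → c ≤ c′ → avg (π k) a b c ≤ avg (π k) a′ b′ c′
    avg-mono k p q s = +-mono-≤ (+-mono-≤ (*-monoʳ (gap (π≤½ k)) p) (*-monoʳ (π≥0 k) q)) (*-monoʳ (π≥0 k) s)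

    avg≥0 : ∀ k {a b c} → 0ℚ ≤ a → 0ℚ ≤ b → 0ℚ ≤ c → 0ℚ ≤ avg (π k) a b c
    avg≥0 k p q s = gap (π≤½ k) ⊗ p ⊕ π≥0 k ⊗ q ⊕ π≥0 k ⊗ s

    -- From level l + k down to level k; the level i step adds W to X and then ±1 to W, each with probability π i.
    run : ℕ → ℕ → (ℚ → ℚ → ℚ) → ℚ → ℚ → ℚ
    run k zero    F X W = F X W
    run k (suc l) F X W = avg (π (l ℕ.+ k)) (run k l F (X + W) W) (run k l F (X + W) (W + 1ℚ)) (run k l F (X + W) (W - 1ℚ))

    -- The probability that X stays nonnegative down to level 0.
    value : ℕ → ℚ → ℚ → ℚ
    value zero    X W = 𝟙 X
    value (suc k) X W = 𝟙 X * avg (π k) (value k (X + W) W) (value k (X + W) (W + 1ℚ)) (value k (X + W) (W - 1ℚ))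

    value≥0 : ∀ k X W → 0ℚ ≤ value k X W
    value≥0 zero    X W = 𝟙≥0 X
    value≥0 (suc k) X W = 𝟙≥0 X ⊗ avg≥0 k (value≥0 k (X + W) W) (value≥0 k (X + W) (W + 1ℚ)) (value≥0 k (X + W) (W - 1ℚ))

    -- Inside a block the sign constraints are simply dropped; only the ends of blocks are tested.
    value≤run : ∀ k l X W → value (l ℕ.+ k) X W ≤ run k l (value k) X W
    value≤run k zero    X W = ≤-refl
    value≤run k (suc l) X W = ≤-trans (by (gap (𝟙≤1 X) ⊗ avg≥0 (l ℕ.+ k) (value≥0 (l ℕ.+ k) (X + W) W) (value≥0 (l ℕ.+ k) (X + W) (W + 1ℚ)) (value≥0 (l ℕ.+ k) (X + W) (W - 1ℚ))) (e (𝟙 X) _))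
        (avg-mono (l ℕ.+ k) (value≤run k l _ _) (value≤run k l _ _) (value≤run k l _ _))
      where e : ∀ i a → a ≡ i * a + (1ℚ - i) * a
            e = solve-∀ ring

    value-𝟙 : ∀ k X W → value k X W ≤ 𝟙 X * value k X W
    value-𝟙 zero    X W with 0ℚ ≤? X
    ... | yes _ = ≤-refl
    ... | no _  = ≤-refl
    value-𝟙 (suc k) X W with 0ℚ ≤? X
    ... | yes _ = ≤-reflexive (sym (*-identityˡ _))
    ... | no _  = ≤-reflexive (trans (*-zeroˡ a) (sym (trans (cong (0ℚ *_) (*-zeroˡ a)) (*-zeroˡ 0ℚ))))
      where a = avg (π k) (value k (X + W) W) (value k (X + W) (W + 1ℚ)) (value k (X + W) (W - 1ℚ))

    run-mono : ∀ k l {F G : ℚ → ℚ → ℚ} → (∀ X W → F X W ≤ G X W) → ∀ X W → run k l F X W ≤ run k l G X W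
    run-mono k zero    h X W = h X W
    run-mono k (suc l) h X W = avg-mono (l ℕ.+ k) (run-mono k l h _ _) (run-mono k l h _ _) (run-mono k l h _ _)

    run-const : ∀ k l c X W → run k l (λ _ _ → c) X W ≡ c
    run-const k zero    c X W = refl
    run-const k (suc l) c X W rewrite run-const k l c (X + W) W | run-const k l c (X + W) (W + 1ℚ) | run-const k l c (X + W) (W - 1ℚ) = e (π (l ℕ.+ k)) c
      where e : ∀ p c → (1ℚ - κ 2 * p) * c + p * c + p * c ≡ c
            e = solve-∀ ring

    run-linear : ∀ k l c (F G : ℚ → ℚ → ℚ) X W → run k l (λ X W → F X W + c * G X W) X W ≡ run k l F X W + c * run k l G X W
    run-linear k zero    c F G X W = refl
    run-linear k (suc l) c F G X W
      rewrite run-linear k l c F G (X + W) W | run-linear k l c F G (X + W) (W + 1ℚ) | run-linear k l c F G (X + W) (W - 1ℚ) =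
        e (π (l ℕ.+ k)) c (run k l F (X + W) W) (run k l F (X + W) (W + 1ℚ)) (run k l F (X + W) (W - 1ℚ))
                          (run k l G (X + W) W) (run k l G (X + W) (W + 1ℚ)) (run k l G (X + W) (W - 1ℚ))
      where e : ∀ p c x y z x′ y′ z′ → (1ℚ - κ 2 * p) * (x + c * x′) + p * (y + c * y′) + p * (z + c * z′) ≡
                  (1ℚ - κ 2 * p) * x + p * y + p * z + c * ((1ℚ - κ 2 * p) * x′ + p * y′ + p * z′)
            e = solve-∀ ring

    -- The variance of X + c W at the end of the block: a unit jump of W made with j levels left is
    -- accumulated j times in X and counts c more through W.
    moment : ℕ → ℚ → ℕ → ℚ
    moment k c l = Σ< l (λ j → κ 2 * π (j ℕ.+ k) * ((κ j + c) * (κ j + c)))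

    variance : ℕ → ℕ → ℚ
    variance k l = Σ< l (λ j → κ 2 * π (j ℕ.+ k))

    moment≥0 : ∀ k c l → 0ℚ ≤ moment k c l
    moment≥0 k c l = Σ<≥0 l (λ j _ → κ≥0 2 ⊗ π≥0 (j ℕ.+ k) ⊗ sq≥0 (κ j + c))

    private
      drift-c₀ : ∀ X W l c → X + W + (l + c) * W ≡ X + (1ℚ + l + c) * W
      drift-c₀ = solve-∀ ring
      drift-c₊ : ∀ X W l c → X + W + (l + c) * (W + 1ℚ) ≡ X + (1ℚ + l + c) * W + (l + c)
      drift-c₊ = solve-∀ ring
      drift-c₋ : ∀ X W l c → X + W + (l + c) * (W - 1ℚ) ≡ X + (1ℚ + l + c) * W - (l + c)
      drift-c₋ = solve-∀ ring

    run-square : ∀ k l c X W → run k l (λ X W → (X + c * W) * (X + c * W)) X W ≡ (X + (κ l + c) * W) * (X + (κ l + c) * W) + moment k c l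
    run-square k zero    c X W = e X W c
      where e : ∀ X W c → (X + c * W) * (X + c * W) ≡ (X + (0ℚ + c) * W) * (X + (0ℚ + c) * W) + 0ℚ
            e = solve-∀ ring
    run-square k (suc l) c X W =
      trans (cong₂ _+_ (cong₂ _+_ (cong ((1ℚ - κ 2 * p) *_) (step W (drift-c₀ X W (κ l) c))) (cong (p *_) (step (W + 1ℚ) (drift-c₊ X W (κ l) c)))) (cong (p *_) (step (W - 1ℚ) (drift-c₋ X W (κ l) c))))
        (e p (X + (1ℚ + κ l + c) * W) (κ l + c) (moment k c l))
      where
      p = π (l ℕ.+ k)
      step : ∀ V {Y} → X + W + (κ l + c) * V ≡ Y → run k l (λ X W → (X + c * W) * (X + c * W)) (X + W) V ≡ Y * Y + moment k c l
      step V eq = trans (run-square k l c (X + W) V) (cong (λ y → y * y + moment k c l) eq)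
      e : ∀ p R d m → (1ℚ - κ 2 * p) * (R * R + m) + p * ((R + d) * (R + d) + m) + p * ((R - d) * (R - d) + m) ≡ R * R + (m + κ 2 * p * (d * d))
      e = solve-∀ ring

    run-drift : ∀ k l X W → run k l (λ X W → W * W) X W ≡ W * W + variance k l
    run-drift k zero    X W = sym (+-identityʳ (W * W))
    run-drift k (suc l) X W rewrite run-drift k l (X + W) W | run-drift k l (X + W) (W + 1ℚ) | run-drift k l (X + W) (W - 1ℚ) =
        e (π (l ℕ.+ k)) W (variance k l)
      where e : ∀ p W m → (1ℚ - κ 2 * p) * (W * W + m) + p * ((W + 1ℚ) * (W + 1ℚ) + m) + p * ((W - 1ℚ) * (W - 1ℚ) + m) ≡ W * W + (m + κ 2 * p)
            e = solve-∀ ring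

    -- Unrolling the accumulation, the final X is X + l W plus independent symmetric jumps of sizes
    -- 0, ..., l - 1, so W can be eliminated.
    sums : ℕ → ℕ → (ℚ → ℚ) → ℚ → ℚ
    sums k zero    F y = F y
    sums k (suc l) F y = avg (π (l ℕ.+ k)) (sums k l F y) (sums k l F (y + κ l)) (sums k l F (y - κ l))

    private
      drift₀ : ∀ X W l → X + W + l * W ≡ X + (1ℚ + l) * W
      drift₀ = solve-∀ ring
      drift₊ : ∀ X W l → X + W + l * (W + 1ℚ) ≡ X + (1ℚ + l) * W + l
      drift₊ = solve-∀ ring
      drift₋ : ∀ X W l → X + W + l * (W - 1ℚ) ≡ X + (1ℚ + l) * W - l
      drift₋ = solve-∀ ring

    run-sums : ∀ k l F X W → run k l (λ X _ → F X) X W ≡ sums k l F (X + κ l * W)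
    run-sums k zero    F X W = cong F (e X W)
      where e : ∀ X W → X ≡ X + 0ℚ * W
            e = solve-∀ ring
    run-sums k (suc l) F X W = cong₂ _+_ (cong₂ _+_ (cong ((1ℚ - κ 2 * p) *_) (step W (drift₀ X W (κ l)))) (cong (p *_) (step (W + 1ℚ) (drift₊ X W (κ l))))) (cong (p *_) (step (W - 1ℚ) (drift₋ X W (κ l))))
      where
      p = π (l ℕ.+ k)
      step : ∀ V {Y} → X + W + κ l * V ≡ Y → run k l (λ X _ → F X) (X + W) V ≡ sums k l F Y
      step V eq = trans (run-sums k l F (X + W) V) (cong (sums k l F) eq)

    -- Changing the sign of all jumps preserves their law, so the walks from R + y and R - y can be
    -- kept mirror images about R.
    sums-symmetric : ∀ k l {F G : ℚ → ℚ} R → (∀ y → F (R + y) + F (R - y) ≤ G y) → ∀ y → sums k l F (R + y) + sums k l F (R - y) ≤ sums k l G y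
    sums-symmetric k zero    R h y = h y
    sums-symmetric k (suc l) {F} {G} R h y =
      ≤-trans (≤-reflexive (trans (cong₂ (λ a b → avg p (sums k l F (R + y)) a (sums k l F (R + y - κ l)) + avg p (sums k l F (R - y)) b (sums k l F (R - y - κ l))) (cong (sums k l F) (e₁ R y (κ l))) (cong (sums k l F) (e₂ R y (κ l))))
         (trans (cong₂ (λ a b → avg p (sums k l F (R + y)) (sums k l F (R + (y + κ l))) a + avg p (sums k l F (R - y)) (sums k l F (R - (y - κ l))) b) (cong (sums k l F) (e₃ R y (κ l))) (cong (sums k l F) (e₄ R y (κ l))))
           (e p (sums k l F (R + y)) (sums k l F (R + (y + κ l))) (sums k l F (R + (y - κ l))) (sums k l F (R - y)) (sums k l F (R - (y - κ l))) (sums k l F (R - (y + κ l)))))))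
        (avg-mono (l ℕ.+ k) (sums-symmetric k l R h y) (sums-symmetric k l R h (y + κ l)) (sums-symmetric k l R h (y - κ l)))
      where
      p = π (l ℕ.+ k)
      e₁ : ∀ R y l → R + y + l ≡ R + (y + l)
      e₁ = solve-∀ ring
      e₂ : ∀ R y l → R - y + l ≡ R - (y - l)
      e₂ = solve-∀ ring
      e₃ : ∀ R y l → R + y - l ≡ R + (y - l)
      e₃ = solve-∀ ring
      e₄ : ∀ R y l → R - y - l ≡ R - (y + l)
      e₄ = solve-∀ ring
      e : ∀ p a b c a′ b′ c′ → (1ℚ - κ 2 * p) * a + p * b + p * c + ((1ℚ - κ 2 * p) * a′ + p * b′ + p * c′) ≡
            (1ℚ - κ 2 * p) * (a + a′) + p * (b + c′) + p * (c + b′)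
      e = solve-∀ ring

    -- Odd moments of the jumps vanish, and the fourth moment of one jump is at most `hh` times its
    -- second. The second moment is exact, so b may have either sign, while a must be nonnegative.
    sums-poly : ∀ k l hh a b c → 0ℚ ≤ a → (∀ j → j ℕ.< l → κ j * κ j ≤ hh) → ∀ y → let S = moment k 0ℚ l in
      sums k l (λ y → a * (y * y * (y * y)) + b * (y * y) + c) y ≤
        a * (y * y * (y * y) + κ 6 * (y * y) * S + κ 3 * (S * S) + hh * S) + b * (y * y + S) + c
    sums-poly k zero    hh a b c a≥0 h y = ≤-reflexive (e a b c y hh)
      where e : ∀ a b c y hh → a * (y * y * (y * y)) + b * (y * y) + c ≡ a * (y * y * (y * y) + κ 6 * (y * y) * 0ℚ + κ 3 * (0ℚ * 0ℚ) + hh * 0ℚ) + b * (y * y + 0ℚ) + c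
            e = solve-∀ ring
    sums-poly k (suc l) hh a b c a≥0 h y = ≤-trans (avg-mono (l ℕ.+ k) (ih y) (ih (y + κ l)) (ih (y - κ l)))
       (≤-trans (≤-reflexive (trans (linear p (fourth y) (fourth (y + κ l)) (fourth (y - κ l)) (y * y) ((y + κ l) * (y + κ l)) ((y - κ l) * (y - κ l)) a b c S (κ 3 * (S * S) + hh * S))
                  (cong₂ (λ u v → a * (u + κ 6 * v * S + (κ 3 * (S * S) + hh * S)) + b * (v + S) + c) (avg⁴ p y (κ l)) (avg² p y (κ l)))))
         (subst (λ z → a * (fourth y + κ 6 * (y * y) * s + s * (κ l * κ l) + κ 6 * (y * y + s) * S + (κ 3 * (S * S) + hh * S)) + b * (y * y + s + S) + c ≤
                       a * (fourth y + κ 6 * (y * y) * (S + z) + κ 3 * ((S + z) * (S + z)) + hh * (S + z)) + b * (y * y + (S + z)) + c)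
            (e₀ p (κ l))
            (by (a≥0 ⊗ (s≥0 ⊗ gap (h l ℕ.≤-refl) ⊕ κ≥0 3 ⊗ (s≥0 ⊗ s≥0))) (e a b c hh (fourth y) (y * y) s S (κ l * κ l)))))
      where
      p = π (l ℕ.+ k)
      S = moment k 0ℚ l
      s = κ 2 * p * (κ l * κ l)
      s≥0 = κ≥0 2 ⊗ π≥0 (l ℕ.+ k) ⊗ sq≥0 (κ l)
      fourth : ℚ → ℚ
      fourth y = y * y * (y * y)
      ih : ∀ y → sums k l (λ y → a * (y * y * (y * y)) + b * (y * y) + c) y ≤ a * (fourth y + κ 6 * (y * y) * S + (κ 3 * (S * S) + hh * S)) + b * (y * y + S) + c
      ih y = ≤-trans (sums-poly k l hh a b c a≥0 (λ j j<l → h j (ℕ.m≤n⇒m≤1+n j<l)) y)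
               (≤-reflexive (cong (λ z → a * z + b * (y * y + S) + c) (+-assoc (fourth y + κ 6 * (y * y) * S) (κ 3 * (S * S)) (hh * S))))
      linear : ∀ p u u₊ u₋ v v₊ v₋ a b c S t →
        (1ℚ - κ 2 * p) * (a * (u + κ 6 * v * S + t) + b * (v + S) + c) + p * (a * (u₊ + κ 6 * v₊ * S + t) + b * (v₊ + S) + c) + p * (a * (u₋ + κ 6 * v₋ * S + t) + b * (v₋ + S) + c)
        ≡ a * (((1ℚ - κ 2 * p) * u + p * u₊ + p * u₋) + κ 6 * ((1ℚ - κ 2 * p) * v + p * v₊ + p * v₋) * S + t) + b * (((1ℚ - κ 2 * p) * v + p * v₊ + p * v₋) + S) + c
      linear = solve-∀ ring
      avg⁴ : ∀ p y l → (1ℚ - κ 2 * p) * (y * y * (y * y)) + p * ((y + l) * (y + l) * ((y + l) * (y + l))) + p * ((y - l) * (y - l) * ((y - l) * (y - l)))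
               ≡ y * y * (y * y) + κ 6 * (y * y) * (κ 2 * p * (l * l)) + κ 2 * p * (l * l) * (l * l)
      avg⁴ = solve-∀ ring
      avg² : ∀ p y l → (1ℚ - κ 2 * p) * (y * y) + p * ((y + l) * (y + l)) + p * ((y - l) * (y - l)) ≡ y * y + κ 2 * p * (l * l)
      avg² = solve-∀ ring
      e₀ : ∀ p l → κ 2 * p * (l * l) ≡ κ 2 * p * ((l + 0ℚ) * (l + 0ℚ))
      e₀ = solve-∀ ring
      e : ∀ a b c hh u v s S l → a * (u + κ 6 * v * (S + s) + κ 3 * ((S + s) * (S + s)) + hh * (S + s)) + b * (v + (S + s)) + c ≡
            a * (u + κ 6 * v * s + s * l + κ 6 * (v + s) * S + (κ 3 * (S * S) + hh * S)) + b * (v + s + S) + c + a * (s * (hh - l) + κ 3 * (s * s))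
      e = solve-∀ ring

    -- Paley–Zygmund with the fourth moment bound E Y⁴ ≤ 3 (E Y²)² + h² E Y².
    run-𝟙 : ∀ k l τ → 0ℚ ≤ τ → 1ℚ ≤ κ 3 * moment k 0ℚ l * τ → ∀ X W → let R = X + κ l * W in
      κ 6 * run k l (λ X _ → 𝟙 X) X W ≤ κ 5 + τ * (κ l * κ l) + κ 5 * τ * (R * R)
    run-𝟙 k l τ τ≥0 hS X W = subst (λ x → κ 6 * x ≤ κ 5 + τ * (κ l * κ l) + κ 5 * τ * (R * R)) (sym (run-sums k l 𝟙 X W)) main
      where
      R = X + κ l * W
      S = moment k 0ℚ l
      E = sums k l 𝟙 R
      S>0 : 0ℚ < S
      S>0 with ≤-total S 0ℚ
      ... | inj₁ S≤0 = ⊥-elim (<-irrefl refl (<-≤-trans (positive⁻¹ 1ℚ) (≤-trans hS (by (κ≥0 3 ⊗ gap S≤0 ⊗ τ≥0) (e S τ)))))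
        where e : ∀ s t → 0ℚ ≡ κ 3 * s * t + κ 3 * (0ℚ - s) * t
              e = solve-∀ ring
      ... | inj₂ S≥0 with S ≤? 0ℚ
      ...   | no  S≰0 = ≰⇒> S≰0
      ...   | yes S≤0 = ⊥-elim (<-irrefl refl (<-≤-trans (positive⁻¹ 1ℚ) (≤-trans hS (by (κ≥0 3 ⊗ gap S≤0 ⊗ τ≥0) (e S τ)))))
        where e : ∀ s t → 0ℚ ≡ κ 3 * s * t + κ 3 * (0ℚ - s) * t
              e = solve-∀ ring
      3S>0 = positive⁻¹ (κ 3) ⊗⁺ S>0
      -- t = 1 / (3 S) minimises 3 S² t² - 2 S t. The minimum -1/3 turns 2 E ≤ 2 into E ≤ 5/6 when R
      -- = 0, up to the term with h².
      t = proj₁ (inv 3S>0)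
      t≥0 = <⇒≤ (proj₁ (proj₂ (inv 3S>0)))
      tS : κ 3 * S * t ≡ 1ℚ
      tS = proj₂ (proj₂ (inv 3S>0))
      t≤τ : t ≤ τ
      t≤τ = *-cancelˡ 3S>0 (≤-trans (≤-reflexive tS) hS)
      E≤1 : E ≤ 1ℚ
      E≤1 = subst (_≤ 1ℚ) (run-sums k l 𝟙 X W) (≤-trans (run-mono k l (λ X _ → 𝟙≤1 X) X W) (≤-reflexive (run-const k l 1ℚ X W)))
      RR = R * R
      pair : E + E ≤ (t * t) * (κ 3 * (S * S) + κ l * κ l * S) + (- (κ 2 * t) - κ 2 * (t * t) * RR) * S + (κ 2 + κ 2 * t * RR + t * t * (RR * RR))
      pair = ≤-trans (≤-reflexive (cong₂ (λ x y → sums k l 𝟙 x + sums k l 𝟙 y) (e₀ R) (e₁ R)))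
        (≤-trans (sums-symmetric k l R (λ y → ≤-trans (𝟙-symmetric t R y t≥0) (≤-reflexive (e₂ t RR (y * y)))) 0ℚ)
          (≤-trans (sums-poly k l (κ l * κ l) (t * t) (- (κ 2 * t) - κ 2 * (t * t) * RR) (κ 2 + κ 2 * t * RR + t * t * (RR * RR)) (t≥0 ⊗ t≥0)
               (λ j j<l → *-mono (κ≥0 j) (κ≥0 l) (κ-mono (ℕ.<⇒≤ j<l)) (κ-mono (ℕ.<⇒≤ j<l))) 0ℚ)
            (≤-reflexive (e₃ (t * t) (- (κ 2 * t) - κ 2 * (t * t) * RR) (κ 2 + κ 2 * t * RR + t * t * (RR * RR)) S (κ l * κ l)))))
        where
        e₀ : ∀ R → R ≡ R + 0ℚ
        e₀ = solve-∀ ring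
        e₁ : ∀ R → R ≡ R - 0ℚ
        e₁ = solve-∀ ring
        e₂ : ∀ t RR yy → κ 2 - (κ 2 * t * (yy - RR) - t * t * ((yy - RR) * (yy - RR))) ≡ t * t * (yy * yy) + (- (κ 2 * t) - κ 2 * (t * t) * RR) * yy + (κ 2 + κ 2 * t * RR + t * t * (RR * RR))
        e₂ = solve-∀ ring
        e₃ : ∀ a b c S hh → a * (0ℚ * 0ℚ * (0ℚ * 0ℚ) + κ 6 * (0ℚ * 0ℚ) * S + κ 3 * (S * S) + hh * S) + b * (0ℚ * 0ℚ + S) + c ≡ a * (κ 3 * (S * S) + hh * S) + b * S + c
        e₃ = solve-∀ ring
      main : κ 6 * E ≤ κ 5 + τ * (κ l * κ l) + κ 5 * τ * RR
      main with ≤-total RR S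
      ... | inj₁ near = ≤-trans (by (κ≥0 3 ⊗ gap pair ⊕ κ≥0 3 ⊗ (t≥0 ⊗ t≥0) ⊗ sq≥0 R ⊗ gap near ⊕ gap t≤τ ⊗ sq≥0 (κ l) ⊕ κ≥0 5 ⊗ gap t≤τ ⊗ sq≥0 R)
              (e E t S τ (κ l * κ l) RR))
              (≤-reflexive (trans (cong (λ z → κ 5 + τ * (κ l * κ l) + κ 5 * τ * RR + (z - 1ℚ) * (z - 1ℚ) + (z - 1ℚ) * ((t * (κ l * κ l)) - t * RR)) tS) (e′ (κ 5 + τ * (κ l * κ l) + κ 5 * τ * RR) (t * (κ l * κ l) - t * RR))))
        where e : ∀ E t S τ hh RR → κ 5 + τ * hh + κ 5 * τ * RR + (κ 3 * S * t - 1ℚ) * (κ 3 * S * t - 1ℚ) + (κ 3 * S * t - 1ℚ) * (t * hh - t * RR) ≡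
                  κ 6 * E + (κ 3 * ((t * t) * (κ 3 * (S * S) + hh * S) + (- (κ 2 * t) - κ 2 * (t * t) * RR) * S + (κ 2 + κ 2 * t * RR + t * t * (RR * RR)) - (E + E))
                   + κ 3 * (t * t) * RR * (S - RR) + (τ - t) * hh + κ 5 * (τ - t) * RR)
              e = solve-∀ ring
              e′ : ∀ a b → a + (1ℚ - 1ℚ) * (1ℚ - 1ℚ) + (1ℚ - 1ℚ) * b ≡ a
              e′ = solve-∀ ring
      -- For R² ≥ S the right side is trivially above 6, as 5 τ R² ≥ 5 τ S ≥ 5/3.
      ... | inj₂ far = by (κ≥0 6 ⊗ gap E≤1 ⊕ τ≥0 ⊗ sq≥0 (κ l) ⊕ κ≥0 5 ⊗ τ≥0 ⊗ gap far ⊕ κ≥0 5 ⊗ τS ⊕ ⅔≥0) (e E τ S (κ l * κ l) RR)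
        where
        third = 1 ⁄ 3
        τS : 0ℚ ≤ τ * S - third
        τS = subst (0ℚ ≤_) (e″ S τ) (nonNegative⁻¹ third ⊗ gap hS)
          where e″ : ∀ S τ → 1 ⁄ 3 * (κ 3 * S * τ - 1ℚ) ≡ τ * S - 1 ⁄ 3
                e″ = solve-∀ ring
        ⅔≥0 : 0ℚ ≤ 2 ⁄ 3
        ⅔≥0 = nonNegative⁻¹ (2 ⁄ 3)
        e : ∀ E τ S hh RR → κ 5 + τ * hh + κ 5 * τ * RR ≡ κ 6 * E + (κ 6 * (1ℚ - E) + τ * hh + κ 5 * τ * (RR - S) + κ 5 * (τ * S - 1 ⁄ 3) + 2 ⁄ 3)
        e = solve-∀ ring

-- The Lyapunov function over blocks, and passing from pairs of partitions to the walk.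

module Comparison where

  open import Data.Nat as ℕ using (ℕ; zero; suc)
  import Data.Nat.Properties as ℕ
  open import Data.Rational
  open import Data.Rational.Properties
  open import Data.List using (List; []; _∷_; _++_; map; length)
  open import Data.List.Membership.Propositional using (_∈_)
  open import Data.List.Relation.Unary.All as All using ([]; _∷_)
  open import Data.List.Relation.Unary.Linked using (Linked)
  open import Data.Product using (_×_; _,_; ∃; proj₁; proj₂)
  open import Data.Sum using (_⊎_; inj₁; inj₂)
  open import Data.Empty using (⊥-elim)
  open import Relation.Nullary using (Dec; yes; no)
  open import Relation.Binary.PropositionalEquality using (_≡_; refl; sym; trans; cong; cong₂; subst)
  open import Tactic.RingSolver using (solve-∀)
  open import Defs using (_⪯?_)
  open Rationals
  open CellSums
  open Riccati using (1≥0)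
  open PartitionLists
  open Counting
  open RandomWalk

  -- 5/6 is what the fourth moment bound leaves. The remaining 1/18 is spent in `block`: 1/600 on
  -- the size of single jumps, 1/25 on the variance added to the quadratic term, and 25/1800 as
  -- slack.
  θ : ℚ
  θ = 8 ⁄ 9

  θ≥0 : 0ℚ ≤ θ
  θ≥0 = nonNegative⁻¹ θ

  module Survival (π : ℕ → ℚ) (π≥0 : ∀ k → 0ℚ ≤ π k) (π≤½ : ∀ k → κ 2 * π k ≤ 1ℚ) where
    open Walk π π≥0 π≤½

    -- X + h W is the mean of X after the coming h levels and h W the drift during them; both are to
    -- be compared with the spread that these levels create.
    Φ : ℕ → ℚ → ℚ → ℚ
    Φ h X W = (X + κ h * W) * (X + κ h * W) + κ h * κ h * (W * W)

    Φ≥0 : ∀ h X W → 0ℚ ≤ Φ h X W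
    Φ≥0 h X W = sq≥0 (X + κ h * W) ⊕ sq≥0 (κ h) ⊗ sq≥0 W

    moment≤variance : ∀ k h → moment k (κ h) h ≤ κ 4 * (κ h * κ h) * variance k h
    moment≤variance k h = ≤-trans (Σ<-mono h {g = λ j → κ 4 * (κ h * κ h) * (κ 2 * π (j ℕ.+ k))} (λ j j<h →
          by (κ≥0 2 ⊗ π≥0 (j ℕ.+ k) ⊗ gap (κ-mono (ℕ.<⇒≤ j<h)) ⊗ (κ≥0 3 ⊗ κ≥0 h ⊕ κ≥0 j)) (e (π (j ℕ.+ k)) (κ j) (κ h))))
        (≤-reflexive (Σ<-* h (κ 4 * (κ h * κ h)) (λ j → κ 2 * π (j ℕ.+ k))))
      where e : ∀ p j h → κ 4 * (h * h) * (κ 2 * p) ≡ κ 2 * p * ((j + h) * (j + h)) + κ 2 * p * (h - j) * (κ 3 * h + j)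
            e = solve-∀ ring

    run-Φ : ∀ k l h c X W → run k l (λ X W → 𝟙 X + c * Φ h X W) X W ≡
      run k l (λ X _ → 𝟙 X) X W + c * ((X + (κ l + κ h) * W) * (X + (κ l + κ h) * W) + moment k (κ h) l + κ h * κ h * (W * W + variance k l))
    run-Φ k l h c X W = trans (run-linear k l c (λ X _ → 𝟙 X) (Φ h) X W) (cong (λ z → run k l (λ X _ → 𝟙 X) X W + c * z)
      (trans (run-linear k l (κ h * κ h) (λ X W → (X + κ h * W) * (X + κ h * W)) (λ X W → W * W) X W)
        (cong₂ (λ a b → a + κ h * κ h * b) (run-square k l (κ h) X W) (run-drift k l X W))))

    -- The Lyapunov step across a block of h levels: surviving costs at least the factor 1 - 1/6 + o(1) unless X + hW is large
    -- on the scale of the block, and on the scale of the next block, here 1/τ′, every quadratic quantity is small.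
    block : ∀ k h τ τ′ → 0ℚ ≤ τ → 0ℚ ≤ τ′ → 1ℚ ≤ κ 3 * moment k 0ℚ h * τ → τ * (κ h * κ h) ≤ 1 ⁄ 100 → κ 100 * τ′ ≤ τ →
      κ 5 * (κ h * κ h * variance k h) * τ′ ≤ 1 ⁄ 25 → ∀ X W →
      run k h (λ X W → 𝟙 X + τ′ * Φ h X W) X W ≤ θ * (1ℚ + τ * Φ h X W)
    block k h τ τ′ τ≥0 τ′≥0 hS hτ hτ′ hV X W = ≤-trans (≤-reflexive (trans (run-Φ k h h τ′ X W) (cong (λ z → E + τ′ * (z * z + moment k (κ h) h + κ h * κ h * (W * W + V))) (e₀ X W (κ h)))))
       (by (nonNegative⁻¹ (1 ⁄ 6) ⊗ gap (run-𝟙 k h τ τ≥0 hS X W) ⊕ nonNegative⁻¹ (1 ⁄ 6) ⊗ gap hτ ⊕ gap hV ⊕ τ′≥0 ⊗ gap (moment≤variance k h)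
            ⊕ τ′≥0 ⊗ sq≥0 (R - κ h * W) ⊕ nonNegative⁻¹ (1 ⁄ 100) ⊗ gap hτ′ ⊗ (κ≥0 2 ⊗ sq≥0 R ⊕ κ≥0 3 ⊗ sq≥0 (κ h * W))
            ⊕ (nonNegative⁻¹ (16 ⁄ 450) ⊗ τ≥0 ⊗ sq≥0 R ⊕ nonNegative⁻¹ (773 ⁄ 900) ⊗ τ≥0 ⊗ sq≥0 (κ h * W)) ⊕ nonNegative⁻¹ (25 ⁄ 1800))
          (e E τ τ′ (κ h) V R W (moment k (κ h) h)))
      where
      R = X + κ h * W
      V = variance k h
      E = run k h (λ X _ → 𝟙 X) X W
      e₀ : ∀ X W h → X + (h + h) * W ≡ X + h * W + h * W
      e₀ = solve-∀ ring
      e : ∀ E τ τ′ h V R W m → 8 ⁄ 9 * (1ℚ + τ * (R * R + h * h * (W * W))) ≡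
          E + τ′ * ((R + h * W) * (R + h * W) + m + h * h * (W * W + V)) +
          (1 ⁄ 6 * (κ 5 + τ * (h * h) + κ 5 * τ * (R * R) - κ 6 * E) + 1 ⁄ 6 * (1 ⁄ 100 - τ * (h * h)) + (1 ⁄ 25 - κ 5 * (h * h * V) * τ′)
            + τ′ * (κ 4 * (h * h) * V - m) + τ′ * ((R - h * W) * (R - h * W)) + 1 ⁄ 100 * (τ - κ 100 * τ′) * (κ 2 * (R * R) + κ 3 * (h * W * (h * W)))
            + (16 ⁄ 450 * τ * (R * R) + 773 ⁄ 900 * τ * (h * W * (h * W))) + 25 ⁄ 1800)
      e = solve-∀ ring

    module Blocks (h M : ℕ) (τ : ℕ → ℚ) (τ≥0 : ∀ j → 0ℚ ≤ τ j)
      (spread : ∀ j → j ℕ.< M → 1ℚ ≤ κ 3 * moment (j ℕ.* h) 0ℚ h * τ (suc j))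
      (fine : ∀ j → j ℕ.< M → τ (suc j) * (κ h * κ h) ≤ 1 ⁄ 100)
      (growth : ∀ j → j ℕ.< M → κ 100 * τ j ≤ τ (suc j))
      (narrow : ∀ j → j ℕ.< M → κ 5 * (κ h * κ h * variance (j ℕ.* h) h) * τ j ≤ 1 ⁄ 25) where

      -- The gain θ is available only if X ≥ 0 at the top of the block, so `value-𝟙` first restores
      -- that indicator. It may then be dropped in front of the quadratic term.
      survive : ∀ j → j ℕ.≤ M → ∀ X W → value (j ℕ.* h) X W ≤ θ ^ j * (𝟙 X + τ j * Φ h X W)
      survive zero    l X W = by (τ≥0 0 ⊗ Φ≥0 h X W) (e (𝟙 X) (τ 0 * Φ h X W))
        where e : ∀ a b → 1ℚ * (a + b) ≡ a + b
              e = solve-∀ ring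
      survive (suc j) l X W = ≤-trans (value-𝟙 (h ℕ.+ j ℕ.* h) X W)
        (≤-trans (*-monoʳ (𝟙≥0 X) (≤-trans (value≤run (j ℕ.* h) h X W) (≤-trans (run-mono (j ℕ.* h) h {G = λ X W → 0ℚ + θ ^ j * (𝟙 X + τ j * Φ h X W)} (λ X W → ≤-trans (survive j (ℕ.<⇒≤ l) X W) (≤-reflexive (sym (+-identityˡ _)))) X W)
            (≤-trans (≤-reflexive (trans (run-linear (j ℕ.* h) h (θ ^ j) (λ _ _ → 0ℚ) (λ X W → 𝟙 X + τ j * Φ h X W) X W) (cong (_+ θ ^ j * run (j ℕ.* h) h (λ X W → 𝟙 X + τ j * Φ h X W) X W) (run-const (j ℕ.* h) h 0ℚ X W))))
              (+-monoʳ-≤ 0ℚ (*-monoʳ (^≥0 j θ≥0) (block (j ℕ.* h) h (τ (suc j)) (τ j) (τ≥0 (suc j)) (τ≥0 j) (spread j l) (fine j l) (growth j l) (narrow j l) X W)))))))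
          (by (gap (𝟙≤1 X) ⊗ (θ≥0 ⊗ ^≥0 j θ≥0) ⊗ (τ≥0 (suc j) ⊗ Φ≥0 h X W)) (e (𝟙 X) θ (θ ^ j) (τ (suc j) * Φ h X W))))
        where e : ∀ i t p b → t * p * (i + b) ≡ i * (0ℚ + p * (t * (1ℚ + b))) + (1ℚ - i) * (t * p) * b
              e = solve-∀ ring

      -- The l levels above the blocks carry too few parts to gain anything; they enter only through
      -- the second moments of the walk when it reaches the first block.
      survive-all : ∀ l → value (l ℕ.+ M ℕ.* h) 0ℚ 0ℚ ≤ θ ^ M * (1ℚ + τ M * (moment (M ℕ.* h) (κ h) l + κ h * κ h * variance (M ℕ.* h) l))
      survive-all l = ≤-trans (value≤run (M ℕ.* h) l 0ℚ 0ℚ)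
        (≤-trans (run-mono (M ℕ.* h) l {G = λ X W → 0ℚ + θ ^ M * (𝟙 X + τ M * Φ h X W)} (λ X W → ≤-trans (survive M ℕ.≤-refl X W) (≤-reflexive (sym (+-identityˡ _)))) 0ℚ 0ℚ)
        (≤-trans (≤-reflexive (trans (run-linear (M ℕ.* h) l (θ ^ M) (λ _ _ → 0ℚ) (λ X W → 𝟙 X + τ M * Φ h X W) 0ℚ 0ℚ)
            (cong₂ (λ a b → a + θ ^ M * b) (run-const (M ℕ.* h) l 0ℚ 0ℚ 0ℚ) (run-Φ (M ℕ.* h) l h (τ M) 0ℚ 0ℚ))))
          (by (^≥0 M θ≥0 ⊗ gap E≤1) (e (θ ^ M) E (τ M) (κ l) (κ h) (moment (M ℕ.* h) (κ h) l) (variance (M ℕ.* h) l)))))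
        where
        E = run (M ℕ.* h) l (λ X _ → 𝟙 X) 0ℚ 0ℚ
        E≤1 : E ≤ 1ℚ
        E≤1 = ≤-trans (run-mono (M ℕ.* h) l (λ X _ → 𝟙≤1 X) 0ℚ 0ℚ) (≤-reflexive (run-const (M ℕ.* h) l 1ℚ 0ℚ 0ℚ))
        e : ∀ p E t l h m v → p * (1ℚ + t * (m + h * h * v)) ≡ 0ℚ + p * (E + t * ((0ℚ + (l + h) * 0ℚ) * (0ℚ + (l + h) * 0ℚ) + m + h * h * (0ℚ * 0ℚ + v))) + p * (1ℚ - E)
        e = solve-∀ ring

  module Mass (θ′ : ℕ) (y : ℕ → ℚ) (y≥0 : ∀ k → 0ℚ ≤ y k) where
    open Distinct θ′

    Z : ℕ → ℚ
    Z zero    = 1ℚ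
    Z (suc k) = Z k * (1ℚ + y k)

    Z≥0 : ∀ k → 0ℚ ≤ Z k
    Z≥0 zero    = 1≥0
    Z≥0 (suc k) = Z≥0 k ⊗ (1≥0 ⊕ y≥0 k)

    -- An upper bound for the mean total of the large parts when each is present with odds y : 1.
    μ : ℕ → ℚ
    μ k = Σ< k (λ i → κ (part i) * y i)

    μ≥0 : ∀ k → 0ℚ ≤ μ k
    μ≥0 k = Σ<≥0 k (λ i _ → κ≥0 (part i) ⊗ y≥0 i)

    -- Markov's inequality in the form of the linear test function S₀ - s.
    module LowerMass (n : ℕ) (r q c S₀ : ℚ) (q≥0 : 0ℚ ≤ q) (r≥0 : 0ℚ ≤ r) (c≥0 : 0ℚ ≤ c) (S₀≤n : S₀ ≤ κ n)
      (y-def : ∀ k → y k ≡ r ^ part k)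
      (base : ∀ m s → m ℕ.+ s ≡ n → q * r ^ s * (S₀ - κ s) ≤ c * f θ′ m) where

      -- Write A for S₀ - s - μ. Leaving out or taking the part v gives A + y (A - v), which exceeds
      -- (1 + y) (A - v y) by y² v; so the odds y may replace the probability y / (1 + y) in `μ`.
      mass-lower : ∀ k m s → m ℕ.+ s ≡ n → q * r ^ s * Z k * (S₀ - κ s - μ k) ≤ c * g k m
      mass-lower zero    m s ms = ≤-trans (≤-reflexive (e (q * r ^ s) S₀ (κ s))) (≤-trans (base m s ms) (≤-reflexive (cong (λ x → c * κ (length x)) (sym (Q-zero m)))))
        where e : ∀ a S s → a * 1ℚ * (S - s - 0ℚ) ≡ a * (S - s)
              e = solve-∀ ring
      mass-lower (suc k) m s ms = ≤-trans (by (qr ⊗ Z≥0 k ⊗ y≥0 k ⊗ (y≥0 k ⊗ κ≥0 v)) (e (q * r ^ s) (Z k) S₀ (κ s) (μ k) (κ v) (y k)))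
        (≤-trans (+-mono-≤ (mass-lower k m s ms) second) (≤-reflexive (trans (sym (*-distribˡ-+ c (g k m) _)) (cong (c *_) (sym (g-step k m))))))
        where
        v = part k
        qr = q≥0 ⊗ ^≥0 s r≥0
        e : ∀ a z S s m v y → a * z * (S - s - m) + a * z * y * (S - s - v - m) ≡ a * (z * (1ℚ + y)) * (S - s - (m + v * y)) + a * z * y * (y * v)
        e = solve-∀ ring
        second : q * r ^ s * Z k * y k * (S₀ - κ s - κ v - μ k) ≤ c * sh v (g k) m
        second with ℕ-split m v
        ... | inj₁ m<v = ≤-trans (by (qr ⊗ Z≥0 k ⊗ y≥0 k ⊗ (gap S₀≤n ⊕ gap n≤ ⊕ μ≥0 k)) (e′ (q * r ^ s * Z k * y k) S₀ (κ s) (κ v) (μ k) (κ n)))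
                (≤-reflexive (sym (trans (cong (c *_) (sh-miss v (g k) m m<v)) (*-zeroʳ c))))
          where
          e′ : ∀ a S s v m n → 0ℚ ≡ a * (S - s - v - m) + a * (n - S + (s + v - n) + m)
          e′ = solve-∀ ring
          n≤ : κ n ≤ κ s + κ v
          n≤ = subst (κ n ≤_) (κ-+ s v) (κ-mono (subst (ℕ._≤ s ℕ.+ v) (trans (ℕ.+-comm s m) ms) (ℕ.+-monoʳ-≤ s (ℕ.<⇒≤ m<v))))
        ... | inj₂ (m′ , refl) = ≤-trans (≤-reflexive (trans (cong₂ (λ a b → q * r ^ s * Z k * a * (S₀ - κ s - b - μ k)) (y-def k) refl)
                (trans (e″ q (r ^ s) (Z k) (r ^ v) S₀ (κ s) (κ v) (μ k)) (cong₂ (λ a b → q * a * Z k * (S₀ - b - μ k)) (sym (^-+ r s v)) (sym (κ-+ s v))))))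
              (≤-trans (mass-lower k m′ (s ℕ.+ v) (trans (ℕ.+-comm m′ (s ℕ.+ v)) (trans (ℕ.+-assoc s v m′) (trans (ℕ.+-comm s (v ℕ.+ m′)) ms))))
                (≤-reflexive (cong (c *_) (sym (sh-hit v (g k) m′)))))
          where e″ : ∀ q a z b S s v m → q * a * z * b * (S - s - v - m) ≡ q * (a * b) * z * (S - (s + v) - m)
                e″ = solve-∀ ring

    module UpperMass (n : ℕ) (wt : ℕ → ℚ) (wt≥0 : ∀ m → 0ℚ ≤ wt m)
      (wt-step : ∀ k m → part k ℕ.+ m ℕ.≤ n → wt m ≤ wt (part k ℕ.+ m) * y k)
      (base : ∀ m → m ℕ.≤ n → f θ′ m ≤ wt m)
      (π : ℕ → ℚ) (π≥0 : ∀ k → 0ℚ ≤ π k) (π≤½ : ∀ k → κ 2 * π k ≤ 1ℚ)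
      (π-def : ∀ k → (1ℚ + y k) * (1ℚ + y k) * π k ≡ y k) where
      open Walk π π≥0 π≤½

      -- α and β are the parts still to be chosen. The chosen ones are remembered by X, their excess
      -- difference at `part k`, and W, the difference of their numbers: at the lower threshold
      -- `part i` each gains k - i. F keeps the chosen parts inside it, and its first alternative
      -- covers pairs without dominance.
      Compatible : ℕ → ℚ → ℚ → (List ℕ → List ℕ → ℚ) → Set
      Compatible k X W F = ∀ {α β} → Linked ℕ._≥_ α → Bounded (k ℕ.+ θ′) α → Linked ℕ._≥_ β → Bounded (k ℕ.+ θ′) β →
        F α β ≤ 0ℚ ⊎ (F α β ≤ 1ℚ × ∀ i → i ℕ.≤ k → 0ℚ ≤ X + (κ k - κ i) * W + (κ (excess (part i) β) - κ (excess (part i) α)))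

      -- Taking a part either leaves a list of the same kind or, if the part exceeds m, nothing.
      -- Both cases are treated as a list of weight at most w.
      Below : ℕ → ℚ → List (List ℕ) → Set
      Below k w xs = xs ≡ [] ⊎ ∃ λ m → xs ≡ Q k m × wt m ≤ w × m ℕ.≤ n

      sumsum : (List ℕ → List ℕ → ℚ) → List (List ℕ) → List (List ℕ) → ℚ
      sumsum F xs ys = Σl (λ α → Σl (F α) ys) xs

      sumsum-split : ∀ F v xs xs′ ys ys′ → sumsum F (xs ++ map (v ∷_) xs′) (ys ++ map (v ∷_) ys′) ≡
        sumsum F xs ys + sumsum (λ α β → F α (v ∷ β)) xs ys′ + (sumsum (λ α β → F (v ∷ α) β) xs′ ys + sumsum (λ α β → F (v ∷ α) (v ∷ β)) xs′ ys′)
      sumsum-split F v xs xs′ ys ys′ = trans (Σl-++ _ xs (map (v ∷_) xs′)) (cong₂ _+_ (inner F xs)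
          (trans (Σl-map _ (v ∷_) xs′) (inner (λ α → F (v ∷ α)) xs′)))
        where
        inner : ∀ F xs → Σl (λ α → Σl (F α) (ys ++ map (v ∷_) ys′)) xs ≡ sumsum F xs ys + sumsum (λ α β → F α (v ∷ β)) xs ys′
        inner F []       = refl
        inner F (x ∷ xs) = trans (cong₂ _+_ (trans (Σl-++ (F x) ys (map (v ∷_) ys′)) (cong (λ z → Σl (F x) ys + z) (Σl-map (F x) (v ∷_) ys′))) (inner F xs))
                             (e (Σl (F x) ys) (Σl (λ β → F x (v ∷ β)) ys′) (sumsum F xs ys) (sumsum (λ α β → F α (v ∷ β)) xs ys′))
          where e : ∀ a b c d → a + b + (c + d) ≡ a + c + (b + d)
                e = solve-∀ ring

      excess-cons : ∀ k i α → i ℕ.≤ k → κ (excess (part i) (part k ∷ α)) ≡ κ k - κ i + κ (excess (part i) α)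
      excess-cons k i α i≤k = trans (κ-+ (part k ℕ.∸ part i) (excess (part i) α)) (cong (_+ κ (excess (part i) α)) (trans (cong κ ([a+c]∸[b+c] k i θ′)) (κ-∸ i≤k)))
        where [a+c]∸[b+c] : ∀ a b c → (a ℕ.+ c) ℕ.∸ (b ℕ.+ c) ≡ a ℕ.∸ b
              [a+c]∸[b+c] a b c = trans (cong₂ ℕ._∸_ (ℕ.+-comm a c) (ℕ.+-comm b c)) (ℕ.[m+n]∸[m+o]≡n∸o c a b)

      -- In pairs (a , b) the entry a says whether α is extended by part k, and b whether β is.
      extend : ∀ k X W {F} → Compatible (suc k) X W F →
        Compatible k (X + W) W F × Compatible k (X + W) (W + 1ℚ) (λ α β → F α (part k ∷ β)) ×
        Compatible k (X + W) (W - 1ℚ) (λ α β → F (part k ∷ α) β) × Compatible k (X + W) W (λ α β → F (part k ∷ α) (part k ∷ β))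
      extend k X W {F} comp =
          (λ {α} {β} l b l′ b′ → conv α β α β W (λ i i≤k → e₀₀ X W (κ k) (κ i) (κ (excess (part i) β)) (κ (excess (part i) α))) (comp l (up b) l′ (up b′)))
        , (λ {α} {β} l b l′ b′ → conv α β α (part k ∷ β) (W + 1ℚ) (λ i i≤k → trans (cong (λ z → X + (κ (suc k) - κ i) * W + (z - κ (excess (part i) α))) (excess-cons k i β i≤k))
                                      (e₀₁ X W (κ k) (κ i) (κ (excess (part i) β)) (κ (excess (part i) α)))) (comp l (up b) (link b′ l′) (cons b′)))
        , (λ {α} {β} l b l′ b′ → conv α β (part k ∷ α) β (W - 1ℚ) (λ i i≤k → trans (cong (λ z → X + (κ (suc k) - κ i) * W + (κ (excess (part i) β) - z)) (excess-cons k i α i≤k))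
                                      (e₁₀ X W (κ k) (κ i) (κ (excess (part i) β)) (κ (excess (part i) α)))) (comp (link b l) (cons b) l′ (up b′)))
        , (λ {α} {β} l b l′ b′ → conv α β (part k ∷ α) (part k ∷ β) W (λ i i≤k → trans (cong₂ (λ w z → X + (κ (suc k) - κ i) * W + (w - z)) (excess-cons k i β i≤k) (excess-cons k i α i≤k))
                                      (e₁₁ X W (κ k) (κ i) (κ (excess (part i) β)) (κ (excess (part i) α)))) (comp (link b l) (cons b) (link b′ l′) (cons b′)))
        where
        up : ∀ {α} → Bounded (k ℕ.+ θ′) α → Bounded (suc k ℕ.+ θ′) α
        up = Bounded-mono (ℕ.n≤1+n _)
        cons : ∀ {α} → Bounded (k ℕ.+ θ′) α → Bounded (suc k ℕ.+ θ′) (part k ∷ α)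
        cons b = (ℕ.s≤s ℕ.z≤n , ℕ.≤-refl) ∷ up b
        link : ∀ {α} → Bounded (k ℕ.+ θ′) α → Linked ℕ._≥_ α → Linked ℕ._≥_ (part k ∷ α)
        link b l = Linked-cons (up b) l
        conv : ∀ {z} α β α′ β′ W′ → (∀ i → i ℕ.≤ k → X + (κ (suc k) - κ i) * W + (κ (excess (part i) β′) - κ (excess (part i) α′)) ≡
                                         X + W + (κ k - κ i) * W′ + (κ (excess (part i) β) - κ (excess (part i) α))) →
          z ≤ 0ℚ ⊎ (z ≤ 1ℚ × ∀ i → i ℕ.≤ suc k → 0ℚ ≤ X + (κ (suc k) - κ i) * W + (κ (excess (part i) β′) - κ (excess (part i) α′))) →
          z ≤ 0ℚ ⊎ (z ≤ 1ℚ × ∀ i → i ℕ.≤ k → 0ℚ ≤ X + W + (κ k - κ i) * W′ + (κ (excess (part i) β) - κ (excess (part i) α)))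
        conv α β α′ β′ W′ eq (inj₁ z)       = inj₁ z
        conv α β α′ β′ W′ eq (inj₂ (z , h)) = inj₂ (z , λ i i≤k → subst (0ℚ ≤_) (eq i i≤k) (h i (ℕ.m≤n⇒m≤1+n i≤k)))
        e₀₀ : ∀ X W k i b a → X + (1ℚ + k - i) * W + (b - a) ≡ X + W + (k - i) * W + (b - a)
        e₀₀ = solve-∀ ring
        e₀₁ : ∀ X W k i b a → X + (1ℚ + k - i) * W + (k - i + b - a) ≡ X + W + (k - i) * (W + 1ℚ) + (b - a)
        e₀₁ = solve-∀ ring
        e₁₀ : ∀ X W k i b a → X + (1ℚ + k - i) * W + (b - (k - i + a)) ≡ X + W + (k - i) * (W - 1ℚ) + (b - a)
        e₁₀ = solve-∀ ring
        e₁₁ : ∀ X W k i b a → X + (1ℚ + k - i) * W + (k - i + b - (k - i + a)) ≡ X + W + (k - i) * W + (b - a)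
        e₁₁ = solve-∀ ring

      shift-below : ∀ k m → m ℕ.≤ n → Below k (wt m * y k) (shift (part k) (Q k) m)
      shift-below k m l with ℕ-split m (part k)
      ... | inj₁ m<v = inj₁ (miss (part k) m m<v)
        where miss : ∀ v m → m ℕ.< v → shift v (Q k) m ≡ []
              miss (suc v) zero    _           = refl
              miss (suc v) (suc m) (ℕ.s≤s m<v) = miss v m m<v
      ... | inj₂ (m′ , refl) = inj₂ (m′ , hit (part k) m′ , wt-step k m′ l , ℕ.≤-trans (ℕ.m≤n+m m′ (part k)) l)
        where hit : ∀ v m → shift v (Q k) (v ℕ.+ m) ≡ Q k m
              hit zero    m = refl
              hit (suc v) m = hit v m

      Q-info : ∀ k m {α} → α ∈ Q k m → Linked ℕ._≥_ α × Bounded (k ℕ.+ θ′) α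
      Q-info k m α∈ with ∈-parts⁻ (distinct θ′) m (k ℕ.+ θ′) m α∈
      ... | l , _ , b = l , b

      mutual
        -- The current part goes into neither, only β, only α, or both. The first and last case
        -- leave W unchanged, so the coefficients are 1 + y², y, y; divided by (1 + y)² they are the
        -- step law with probability π.
        mass-upper : ∀ k {F} m m′ X W → m ℕ.≤ n → m′ ℕ.≤ n → Compatible k X W F →
          sumsum F (Q k m) (Q k m′) ≤ wt m * wt m′ * (Z k * Z k) * value k X W
        mass-upper k m m′ X W l l′ comp = mass-case k m m′ X W l l′ comp (0ℚ ≤? X)

        mass-case : ∀ k {F} m m′ X W → m ℕ.≤ n → m′ ℕ.≤ n → Compatible k X W F → Dec (0ℚ ≤ X) →
          sumsum F (Q k m) (Q k m′) ≤ wt m * wt m′ * (Z k * Z k) * value k X W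
        -- At the threshold i = k all remaining parts are too small to have any excess, so the
        -- condition reads X ≥ 0 and no pair contributes.
        mass-case k {F} m m′ X W l l′ comp (no X≱0) = ≤-trans (≤-trans (Σl-mono {G = λ _ → 0ℚ} (Q k m) (λ {α} α∈ → ≤-trans (Σl-mono {G = λ _ → 0ℚ} (Q k m′) (λ {β} β∈ → vanish α∈ β∈)) (zeros (Q k m′)))) (zeros (Q k m)))
            (wt≥0 m ⊗ wt≥0 m′ ⊗ (Z≥0 k ⊗ Z≥0 k) ⊗ value≥0 k X W)
          where
          zeros : ∀ (xs : List (List ℕ)) → Σl (λ _ → 0ℚ) xs ≤ 0ℚ
          zeros xs = ≤-reflexive (trans (Σl-const 0ℚ xs) (*-zeroʳ (κ (length xs))))
          e : ∀ X k W → X + (k - k) * W + (0ℚ - 0ℚ) ≡ X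
          e = solve-∀ ring
          vanish : ∀ {α β} → α ∈ Q k m → β ∈ Q k m′ → F α β ≤ 0ℚ
          vanish {α} {β} α∈ β∈ with Q-info k m α∈ | Q-info k m′ β∈
          ... | lα , bα | lβ , bβ with comp lα bα lβ bβ
          ...   | inj₁ z = z
          ...   | inj₂ (_ , h) = ⊥-elim (X≱0 (subst (0ℚ ≤_) (trans (cong₂ (λ a b → X + (κ k - κ k) * W + (κ a - κ b)) (excess-zero (part k) (ℕ.n≤1+n _) bβ) (excess-zero (part k) (ℕ.n≤1+n _) bα)) (e X (κ k) W)) (h k ℕ.≤-refl)))
        mass-case zero {F} m m′ X W l l′ comp (yes X≥0) = ≤-trans (≤-trans (Σl-mono {G = λ _ → κ (length (Q 0 m′))} (Q 0 m) (λ {α} α∈ → ≤-trans (Σl-mono {G = λ _ → 1ℚ} (Q 0 m′) (λ {β} β∈ → one α∈ β∈)) (≤-reflexive (Σl-length (Q 0 m′))))) (≤-reflexive (Σl-const _ (Q 0 m))))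
            (≤-trans (*-mono (κ≥0 (length (Q 0 m))) (wt≥0 m′) (low m l) (low m′ l′)) (≤-reflexive (trans (e (wt m * wt m′)) (cong (λ z → wt m * wt m′ * (1ℚ * 1ℚ) * z) (sym 𝟙X)))))
          where
          𝟙X = 𝟙-yes X≥0
          e : ∀ w → w ≡ w * (1ℚ * 1ℚ) * 1ℚ
          e = solve-∀ ring
          low : ∀ m → m ℕ.≤ n → κ (length (Q 0 m)) ≤ wt m
          low m l = ≤-trans (≤-reflexive (cong (λ x → κ (length x)) (Q-zero m))) (base m l)
          one : ∀ {α β} → α ∈ Q 0 m → β ∈ Q 0 m′ → F α β ≤ 1ℚ
          one {α} {β} α∈ β∈ with Q-info 0 m α∈ | Q-info 0 m′ β∈
          ... | lα , bα | lβ , bβ with comp lα bα lβ bβ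
          ...   | inj₁ z = ≤-trans z 1≥0
          ...   | inj₂ (z , _) = z
        mass-case (suc k) {F} m m′ X W l l′ comp (yes X≥0) = ≤-trans (≤-reflexive (trans (cong₂ (sumsum F) (Q-step k m) (Q-step k m′)) (sumsum-split F (part k) (Q k m) (shift (part k) (Q k) m) (Q k m′) (shift (part k) (Q k) m′))))
            (≤-trans (+-mono-≤ (+-mono-≤ (mass-below k (keep m l) (keep m′ l′) w w′ (proj₁ ext)) (mass-below k (keep m l) (shift-below k m′ l′) w wy′ (proj₁ (proj₂ ext))))
                               (+-mono-≤ (mass-below k (shift-below k m l) (keep m′ l′) wy w′ (proj₁ (proj₂ (proj₂ ext)))) (mass-below k (shift-below k m l) (shift-below k m′ l′) wy wy′ (proj₂ (proj₂ (proj₂ ext))))))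
              (≤-reflexive (trans (e (wt m) (wt m′) (Z k * Z k) (y k) v₀ v₊ v₋)
                (trans (cong (λ z → wt m * wt m′ * (Z k * Z k) * (((1ℚ + y k) * (1ℚ + y k) - κ 2 * z) * v₀ + z * v₊ + z * v₋)) (sym (π-def k)))
                (trans (e′ (wt m * wt m′ * (Z k * Z k)) ((1ℚ + y k) * (1ℚ + y k)) (π k) v₀ v₊ v₋)
                       (cong₂ _*_ (e″ (wt m * wt m′) (Z k) (y k)) (trans (sym (*-identityˡ a)) (cong (_* a) (sym 𝟙X)))))))))
          where
          𝟙X = 𝟙-yes X≥0
          ext = extend k X W comp
          w = wt≥0 m
          w′ = wt≥0 m′
          wy = wt≥0 m ⊗ y≥0 k
          wy′ = wt≥0 m′ ⊗ y≥0 k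
          keep : ∀ m → m ℕ.≤ n → Below k (wt m) (Q k m)
          keep m l = inj₂ (m , refl , ≤-refl , l)
          v₀ = value k (X + W) W
          v₊ = value k (X + W) (W + 1ℚ)
          v₋ = value k (X + W) (W - 1ℚ)
          a = avg (π k) v₀ v₊ v₋
          e : ∀ w w′ q y v₀ v₊ v₋ → w * w′ * q * v₀ + w * (w′ * y) * q * v₊ + (w * y * w′ * q * v₋ + w * y * (w′ * y) * q * v₀) ≡
                w * w′ * q * (((1ℚ + y) * (1ℚ + y) - κ 2 * y) * v₀ + y * v₊ + y * v₋)
          e = solve-∀ ring
          e′ : ∀ c t p v₀ v₊ v₋ → c * ((t - κ 2 * (t * p)) * v₀ + t * p * v₊ + t * p * v₋) ≡ c * t * ((1ℚ - κ 2 * p) * v₀ + p * v₊ + p * v₋)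
          e′ = solve-∀ ring
          e″ : ∀ c z y → c * (z * z) * ((1ℚ + y) * (1ℚ + y)) ≡ c * (z * (1ℚ + y) * (z * (1ℚ + y)))
          e″ = solve-∀ ring

        mass-below : ∀ k {F w w′ xs ys X W} → Below k w xs → Below k w′ ys → 0ℚ ≤ w → 0ℚ ≤ w′ → Compatible k X W F →
          sumsum F xs ys ≤ w * w′ * (Z k * Z k) * value k X W
        mass-below k {X = X} {W} (inj₁ refl) _ w w′ comp = w ⊗ w′ ⊗ (Z≥0 k ⊗ Z≥0 k) ⊗ value≥0 k X W
        mass-below k {xs = xs} {X = X} {W} (inj₂ _) (inj₁ refl) w w′ comp = ≤-trans (≤-reflexive (trans (Σl-const 0ℚ xs) (*-zeroʳ (κ (length xs))))) (w ⊗ w′ ⊗ (Z≥0 k ⊗ Z≥0 k) ⊗ value≥0 k X W)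
        mass-below k {X = X} {W} (inj₂ (m , refl , wm , l)) (inj₂ (m′ , refl , wm′ , l′)) w w′ comp =
          ≤-trans (mass-upper k m m′ X W l l′ comp) (*-monoˡ (value≥0 k X W) (*-monoˡ (Z≥0 k ⊗ Z≥0 k) (*-mono (wt≥0 m) w′ wm wm′)))

      ind-compatible : ∀ k → Compatible k 0ℚ 0ℚ ind
      ind-compatible k {α} {β} l b l′ b′ with α ⪯? β
      ... | no _ = inj₁ ≤-refl
      ... | yes dom = inj₂ (≤-refl , λ i _ → by (gap (κ-mono (⪯⇒excess l b dom (part i)))) (e (κ k) (κ i) (κ (excess (part i) β)) (κ (excess (part i) α))))
        where e : ∀ k i b a → 0ℚ + (k - i) * 0ℚ + (b - a) ≡ 0ℚ + (b - a)
              e = solve-∀ ring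

-- Geometric sums and the scales of the blocks.

module Scaling where

  open import Data.Nat as ℕ using (ℕ; zero; suc)
  import Data.Nat.Properties as ℕ
  open import Data.Rational
  open import Data.Rational.Properties
  open import Data.Product using (_,_; proj₁; proj₂)
  open import Relation.Binary.PropositionalEquality using (_≡_; refl; sym; trans; cong; cong₂; subst)
  open import Relation.Nullary.Decidable using (toWitness)
  open import Tactic.RingSolver using (solve-∀)
  open Rationals
  open CellSums
  open Riccati using (1≥0)
  open RandomWalk
  open Comparison

  module Geometric (r u : ℚ) (r≥0 : 0ℚ ≤ r) (u≥0 : 0ℚ ≤ u) (ur : u * r ≡ u - 1ℚ) where

    Σ-geometric : ∀ l → Σ< l (λ i → r ^ i) ≡ u - u * r ^ l
    Σ-geometric zero    = e u
      where e : ∀ u → 0ℚ ≡ u - u * 1ℚ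
            e = solve-∀ ring
    Σ-geometric (suc l) = trans (cong (_+ r ^ l) (Σ-geometric l)) (trans (e u (r ^ l)) (trans (cong (λ z → u - z * r ^ l) (sym ur)) (cong (λ z → u - z) (*-assoc u r (r ^ l)))))
      where e : ∀ u x → u - u * x + x ≡ u - (u - 1ℚ) * x
            e = solve-∀ ring

    Σ-geometric-≤ : ∀ l → Σ< l (λ i → r ^ i) ≤ u
    Σ-geometric-≤ l = ≤-trans (≤-reflexive (Σ-geometric l)) (by (u≥0 ⊗ ^≥0 l r≥0) (e u (u * r ^ l)))
      where e : ∀ u x → u ≡ u - x + x
            e = solve-∀ ring

    private
      -- The second term on the left dominates the series continued from l, so the whole left side
      -- can only decrease as l grows. `quadratic` works in the same way.
      linear : ∀ c l → 0ℚ ≤ c → Σ< l (λ i → r ^ i * (κ i + c)) + r ^ l * ((κ l + c) * u + u * u) ≤ c * u + u * u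
      linear c zero    c≥0 = ≤-reflexive (e c u)
        where e : ∀ c u → 0ℚ + 1ℚ * ((0ℚ + c) * u + u * u) ≡ c * u + u * u
              e = solve-∀ ring
      linear c (suc l) c≥0 = ≤-trans (≤-trans (≤-reflexive (trans (e₁ s (r ^ l) r (κ l) c u) (cong (λ z → s + r ^ l * (κ l + c) + r ^ l * (1ℚ + κ l + c + u) * z) ur)))
          (by (^≥0 l r≥0) (e₂ s (r ^ l) (κ l) c u))) (linear c l c≥0)
        where
        s = Σ< l (λ i → r ^ i * (κ i + c))
        e₁ : ∀ s x r l c u → s + x * (l + c) + r * x * ((1ℚ + l + c) * u + u * u) ≡ s + x * (l + c) + x * (1ℚ + l + c + u) * (u * r)
        e₁ = solve-∀ ring
        e₂ : ∀ s x l c u → s + x * ((l + c) * u + u * u) ≡ s + x * (l + c) + x * (1ℚ + l + c + u) * (u - 1ℚ) + x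
        e₂ = solve-∀ ring

      quadratic : ∀ c l → 0ℚ ≤ c → Σ< l (λ i → r ^ i * ((κ i + c) * (κ i + c))) + r ^ l * ((κ l + c) * (κ l + c) * u + κ 2 * (κ l + c) * (u * u) + κ 2 * (u * u * u))
        ≤ c * c * u + κ 2 * c * (u * u) + κ 2 * (u * u * u)
      quadratic c zero    c≥0 = ≤-reflexive (e c u)
        where e : ∀ c u → 0ℚ + 1ℚ * ((0ℚ + c) * (0ℚ + c) * u + κ 2 * (0ℚ + c) * (u * u) + κ 2 * (u * u * u)) ≡ c * c * u + κ 2 * c * (u * u) + κ 2 * (u * u * u)
              e = solve-∀ ring
      quadratic c (suc l) c≥0 = ≤-trans (≤-trans (≤-reflexive (trans (e₁ s (r ^ l) r (κ l) c u)
            (cong (λ z → s + r ^ l * ((κ l + c) * (κ l + c)) + r ^ l * ((1ℚ + κ l + c) * (1ℚ + κ l + c) + κ 2 * (1ℚ + κ l + c) * u + κ 2 * (u * u)) * z) ur)))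
          (by (^≥0 l r≥0 ⊗ (u≥0 ⊕ κ≥0 2 ⊗ (κ≥0 l ⊕ c≥0) ⊕ 1≥0)) (e₂ s (r ^ l) (κ l) c u))) (quadratic c l c≥0)
        where
        s = Σ< l (λ i → r ^ i * ((κ i + c) * (κ i + c)))
        e₁ : ∀ s x r l c u → s + x * ((l + c) * (l + c)) + r * x * ((1ℚ + l + c) * (1ℚ + l + c) * u + κ 2 * (1ℚ + l + c) * (u * u) + κ 2 * (u * u * u)) ≡
               s + x * ((l + c) * (l + c)) + x * ((1ℚ + l + c) * (1ℚ + l + c) + κ 2 * (1ℚ + l + c) * u + κ 2 * (u * u)) * (u * r)
        e₁ = solve-∀ ring
        e₂ : ∀ s x l c u → s + x * ((l + c) * (l + c) * u + κ 2 * (l + c) * (u * u) + κ 2 * (u * u * u)) ≡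
               s + x * ((l + c) * (l + c)) + x * ((1ℚ + l + c) * (1ℚ + l + c) + κ 2 * (1ℚ + l + c) * u + κ 2 * (u * u)) * (u - 1ℚ)
                 + x * (u + κ 2 * (l + c) + 1ℚ)
        e₂ = solve-∀ ring

    Σ-linear : ∀ c l → 0ℚ ≤ c → Σ< l (λ i → r ^ i * (κ i + c)) ≤ c * u + u * u
    Σ-linear c l c≥0 = ≤-trans (by (^≥0 l r≥0 ⊗ ((κ≥0 l ⊕ c≥0) ⊗ u≥0 ⊕ u≥0 ⊗ u≥0)) refl) (linear c l c≥0)

    Σ-quadratic : ∀ c l → 0ℚ ≤ c → Σ< l (λ i → r ^ i * ((κ i + c) * (κ i + c))) ≤ c * c * u + κ 2 * c * (u * u) + κ 2 * (u * u * u)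
    Σ-quadratic c l c≥0 = ≤-trans (by (^≥0 l r≥0 ⊗ (sq≥0 (κ l + c) ⊗ u≥0 ⊕ κ≥0 2 ⊗ (κ≥0 l ⊕ c≥0) ⊗ (u≥0 ⊗ u≥0) ⊕ κ≥0 2 ⊗ (u≥0 ⊗ u≥0 ⊗ u≥0))) refl) (quadratic c l c≥0)

  module Scales (r ρ u : ℚ) (r≥0 : 0ℚ ≤ r) (r≤1 : r ≤ 1ℚ) (ρ≥0 : 0ℚ ≤ ρ) (ρr : ρ * r ≡ 1ℚ) (u>0 : 0ℚ < u) (ur : u * r ≡ u - 1ℚ)
    (h₀ : ℕ) (h₀>0 : 0ℚ < κ h₀) (u≤3h₀ : u ≤ κ 3 * κ h₀) (half : r ^ h₀ ≤ ½) (half⁻ : 499 ⁄ 1000 ≤ r ^ h₀)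
    (y : ℕ → ℚ) (y>0 : ∀ k → 0ℚ < y k) (y-+ : ∀ i k → y (i ℕ.+ k) ≡ r ^ i * y k) (y-small : ∀ k → y k ≤ 1 ⁄ 300)
    (π : ℕ → ℚ) (π≥0 : ∀ k → 0ℚ ≤ π k) (π≤½ : ∀ k → κ 2 * π k ≤ 1ℚ) (π-def : ∀ k → (1ℚ + y k) * (1ℚ + y k) * π k ≡ y k) where

    private
      u≥0 = <⇒≤ u>0
    open Geometric r u r≥0 u≥0 ur
    open Walk π π≥0 π≤½

    h : ℕ
    h = 12 ℕ.* h₀

    π≤y : ∀ k → π k ≤ y k
    π≤y k = by ((κ≥0 2 ⊗ y≥0 ⊕ y≥0 ⊗ y≥0) ⊗ π≥0 k) (trans (sym (π-def k)) (e (y k) (π k)))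
      where y≥0 = <⇒≤ (y>0 k)
            e : ∀ y p → (1ℚ + y) * (1ℚ + y) * p ≡ p + (κ 2 * y + y * y) * p
            e = solve-∀ ring

    π≥y : ∀ k → 99 ⁄ 100 * y k ≤ π k
    π≥y k = by (y≥0 ⊗ gap small) (trans (e₀ (π k) (y k)) (trans (cong (λ z → z - (κ 2 + y k) * y k * π k) (π-def k)) (e (y k) (π k))))
      where
      y≥0 = <⇒≤ (y>0 k)
      p≤ = ≤-trans (π≤y k) (y-small k)
      small : (κ 2 + y k) * π k ≤ 1 ⁄ 100
      small = ≤-trans (*-mono (κ≥0 2 ⊕ y≥0) (nonNegative⁻¹ (1 ⁄ 300)) (+-monoʳ-≤ (κ 2) (≤-trans (y-small k) (toWitness {a? = 1 ⁄ 300 ≤? 1ℚ} _))) p≤) ≤-refl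
      e₀ : ∀ p y → p ≡ (1ℚ + y) * (1ℚ + y) * p - (κ 2 + y) * y * p
      e₀ = solve-∀ ring
      e : ∀ y p → y - (κ 2 + y) * y * p ≡ 99 ⁄ 100 * y + y * (1 ⁄ 100 - (κ 2 + y) * p)
      e = solve-∀ ring

    Σ-y : ∀ k l (g : ℕ → ℚ) → (∀ i → 0ℚ ≤ g i) → Σ< l (λ j → κ 2 * π (j ℕ.+ k) * g j) ≤ κ 2 * y k * Σ< l (λ j → r ^ j * g j)
    Σ-y k l g g≥0 = ≤-trans (Σ<-mono l {g = λ j → κ 2 * y k * (r ^ j * g j)} λ j _ → ≤-trans (*-monoˡ (g≥0 j) (*-monoʳ (κ≥0 2) (≤-trans (π≤y (j ℕ.+ k)) (≤-reflexive (y-+ j k))))) (≤-reflexive (e (r ^ j) (y k) (g j))))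
        (≤-reflexive (Σ<-* l (κ 2 * y k) (λ j → r ^ j * g j)))
      where e : ∀ x y g → κ 2 * (x * y) * g ≡ κ 2 * y * (x * g)
            e = solve-∀ ring

    variance≤ : ∀ k l → variance k l ≤ κ 2 * y k * u
    variance≤ k l = ≤-trans (≤-reflexive (Σ<-cong l (λ j _ → sym (*-identityʳ (κ 2 * π (j ℕ.+ k))))))
      (≤-trans (Σ-y k l (λ _ → 1ℚ) (λ _ → 1≥0)) (*-monoʳ (κ≥0 2 ⊗ <⇒≤ (y>0 k)) (≤-trans (≤-reflexive (Σ<-cong l (λ j _ → *-identityʳ (r ^ j)))) (Σ-geometric-≤ l))))

    moment≤ : ∀ k c l → 0ℚ ≤ c → moment k c l ≤ κ 2 * y k * (c * c * u + κ 2 * c * (u * u) + κ 2 * (u * u * u))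
    moment≤ k c l c≥0 = ≤-trans (Σ-y k l (λ j → (κ j + c) * (κ j + c)) (λ j → sq≥0 (κ j + c))) (*-monoʳ (κ≥0 2 ⊗ <⇒≤ (y>0 k)) (Σ-quadratic c l c≥0))

    -- In the a-th half-life the jumps have size at least a h₀, and the geometric weights add up to
    -- u (1 - w) ≥ u / 2 times w^a.
    window : ∀ k a → moment k 0ℚ (a ℕ.* h₀) + 99 ⁄ 100 * y k * u * (κ h₀ * κ h₀) * (κ a * κ a * (r ^ h₀) ^ a) ≤ moment k 0ℚ (suc a ℕ.* h₀)
    window k a = ≤-trans (+-monoʳ-≤ (moment k 0ℚ (a ℕ.* h₀)) bound) (≤-reflexive (sym (trans (cong (moment k 0ℚ) (ℕ.+-comm h₀ (a ℕ.* h₀))) (Σ<-split (a ℕ.* h₀) h₀ _))))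
      where
      w = r ^ h₀
      c = 99 ⁄ 50 * y k * (κ (a ℕ.* h₀) * κ (a ℕ.* h₀)) * w ^ a
      c≥0 = nonNegative⁻¹ (99 ⁄ 50) ⊗ <⇒≤ (y>0 k) ⊗ sq≥0 (κ (a ℕ.* h₀)) ⊗ ^≥0 a (^≥0 h₀ r≥0)
      pointwise : ∀ i → i ℕ.< h₀ → c * r ^ i ≤ κ 2 * π (a ℕ.* h₀ ℕ.+ i ℕ.+ k) * ((κ (a ℕ.* h₀ ℕ.+ i) + 0ℚ) * (κ (a ℕ.* h₀ ℕ.+ i) + 0ℚ))
      pointwise i _ = ≤-trans (≤-reflexive (trans (e (y k) (κ (a ℕ.* h₀) * κ (a ℕ.* h₀)) (w ^ a) (r ^ i)) (cong (λ z → κ 2 * (99 ⁄ 100 * z) * (κ (a ℕ.* h₀) * κ (a ℕ.* h₀)))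
            (trans (cong (_* y k) (trans (cong (_* r ^ i) (sym (^-* r a h₀))) (sym (^-+ r (a ℕ.* h₀) i)))) (sym (y-+ (a ℕ.* h₀ ℕ.+ i) k))))))
        (*-mono (κ≥0 2 ⊗ (nonNegative⁻¹ (99 ⁄ 100) ⊗ <⇒≤ (y>0 _))) (sq≥0 (κ (a ℕ.* h₀ ℕ.+ i) + 0ℚ)) (*-monoʳ (κ≥0 2) (π≥y (a ℕ.* h₀ ℕ.+ i ℕ.+ k)))
          (*-mono (κ≥0 (a ℕ.* h₀)) (κ≥0 (a ℕ.* h₀ ℕ.+ i) ⊕ ≤-refl) up up))
        where e : ∀ y q x z → 99 ⁄ 50 * y * q * x * z ≡ κ 2 * (99 ⁄ 100 * (x * z * y)) * q
              e = solve-∀ ring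
              up : κ (a ℕ.* h₀) ≤ κ (a ℕ.* h₀ ℕ.+ i) + 0ℚ
              up = ≤-trans (κ-mono (ℕ.m≤m+n (a ℕ.* h₀) i)) (≤-reflexive (sym (+-identityʳ _)))
      bound : 99 ⁄ 100 * y k * u * (κ h₀ * κ h₀) * (κ a * κ a * w ^ a) ≤ Σ< h₀ (λ i → κ 2 * π (a ℕ.* h₀ ℕ.+ i ℕ.+ k) * ((κ (a ℕ.* h₀ ℕ.+ i) + 0ℚ) * (κ (a ℕ.* h₀ ℕ.+ i) + 0ℚ)))
      bound = ≤-trans (by (c≥0 ⊗ u≥0 ⊗ gap half) (trans (cong (λ z → 99 ⁄ 50 * y k * (z * z) * w ^ a * (u - u * w)) (κ-* a h₀))
                         (trans (e (y k) u (κ h₀) (κ a) (w ^ a) w) (cong (λ z → 99 ⁄ 100 * y k * u * (κ h₀ * κ h₀) * (κ a * κ a * w ^ a) + 99 ⁄ 50 * y k * (z * z) * w ^ a * u * (½ - w)) (sym (κ-* a h₀))))))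
        (≤-trans (≤-reflexive (trans (cong (c *_) (sym (Σ-geometric h₀))) (sym (Σ<-* h₀ c (λ i → r ^ i))))) (Σ<-mono h₀ pointwise))
        where e : ∀ y u h a x w → 99 ⁄ 50 * y * (a * h * (a * h)) * x * (u - u * w) ≡ 99 ⁄ 100 * y * u * (h * h) * (a * a * x) + 99 ⁄ 50 * y * (a * h * (a * h)) * x * u * (½ - w)
              e = solve-∀ ring

    -- The half-lives 2, 3 and 4 suffice: with w close to 1/2, 4 w² + 9 w³ + 16 w⁴ is close to
    -- 3.125.
    moment≥ : ∀ k → κ 3 * y k * u * (κ h₀ * κ h₀) ≤ moment k 0ℚ h
    moment≥ k = ≤-trans (≤-reflexive (e″ (y k) u (κ h₀ * κ h₀))) (≤-trans (by (q≥0 ⊗ gap bulk ⊕ moment≥0 k 0ℚ (2 ℕ.* h₀)) (e (y k * u * (κ h₀ * κ h₀)) w (moment k 0ℚ (2 ℕ.* h₀))))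
      (≤-trans (+-monoˡ-≤ (t 4) (+-monoˡ-≤ (t 3) (win 2)))
      (≤-trans (+-monoˡ-≤ (t 4) (win 3))
      (≤-trans (win 4) tail))))
      where
      e″ : ∀ y u h → κ 3 * y * u * h ≡ κ 3 * (y * u * h)
      e″ = solve-∀ ring
      w = r ^ h₀
      w≥0 = ^≥0 h₀ r≥0
      Q = y k * u * (κ h₀ * κ h₀)
      q≥0 = <⇒≤ (y>0 k) ⊗ u≥0 ⊗ sq≥0 (κ h₀)
      t : ℕ → ℚ
      t a = 99 ⁄ 100 * Q * (κ a * κ a * w ^ a)
      win : ∀ a → moment k 0ℚ (a ℕ.* h₀) + t a ≤ moment k 0ℚ (suc a ℕ.* h₀)
      win a = ≤-trans (≤-reflexive (cong (moment k 0ℚ (a ℕ.* h₀) +_) (e′ (y k) u (κ h₀ * κ h₀) (κ a * κ a * w ^ a)))) (window k a)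
        where e′ : ∀ y u h x → 99 ⁄ 100 * (y * u * h) * x ≡ 99 ⁄ 100 * y * u * h * x
              e′ = solve-∀ ring
      w² : 249 ⁄ 1000 ≤ w * w
      w² = ≤-trans (toWitness {a? = 249 ⁄ 1000 ≤? 499 ⁄ 1000 * (499 ⁄ 1000)} _) (*-mono (nonNegative⁻¹ (499 ⁄ 1000)) w≥0 half⁻ half⁻)
      w³ : 124 ⁄ 1000 ≤ w * w * w
      w³ = ≤-trans (toWitness {a? = 124 ⁄ 1000 ≤? 249 ⁄ 1000 * (499 ⁄ 1000)} _) (*-mono (nonNegative⁻¹ (249 ⁄ 1000)) w≥0 w² half⁻)
      w⁴ : 61 ⁄ 1000 ≤ w * w * w * w
      w⁴ = ≤-trans (toWitness {a? = 61 ⁄ 1000 ≤? 124 ⁄ 1000 * (499 ⁄ 1000)} _) (*-mono (nonNegative⁻¹ (124 ⁄ 1000)) w≥0 w³ half⁻)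
      bulk : κ 3 ≤ 99 ⁄ 100 * (κ 4 * (w * w) + κ 9 * (w * w * w) + κ 16 * (w * w * w * w))
      bulk = ≤-trans (toWitness {a? = κ 3 ≤? 99 ⁄ 100 * (κ 4 * (249 ⁄ 1000) + κ 9 * (124 ⁄ 1000) + κ 16 * (61 ⁄ 1000))} _)
               (*-monoʳ (nonNegative⁻¹ (99 ⁄ 100)) (+-mono-≤ (+-mono-≤ (*-monoʳ (κ≥0 4) w²) (*-monoʳ (κ≥0 9) w³)) (*-monoʳ (κ≥0 16) w⁴)))
      e : ∀ q w m → m + 99 ⁄ 100 * q * (κ 2 * κ 2 * (w * (w * 1ℚ))) + 99 ⁄ 100 * q * (κ 3 * κ 3 * (w * (w * (w * 1ℚ)))) + 99 ⁄ 100 * q * (κ 4 * κ 4 * (w * (w * (w * (w * 1ℚ))))) ≡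
            κ 3 * q + (q * (99 ⁄ 100 * (κ 4 * (w * w) + κ 9 * (w * w * w) + κ 16 * (w * w * w * w)) - κ 3) + m)
      e = solve-∀ ring
      tail : moment k 0ℚ (5 ℕ.* h₀) ≤ moment k 0ℚ h
      tail = subst (λ l → moment k 0ℚ (5 ℕ.* h₀) ≤ moment k 0ℚ l) (sym (ℕ.*-distribʳ-+ h₀ 5 7))
               (by (Σ<≥0 (7 ℕ.* h₀) (λ j _ → κ≥0 2 ⊗ π≥0 (5 ℕ.* h₀ ℕ.+ j ℕ.+ k) ⊗ sq≥0 (κ (5 ℕ.* h₀ ℕ.+ j) + 0ℚ))) (Σ<-split (5 ℕ.* h₀) (7 ℕ.* h₀) _))

    R : ℚ
    R = r ^ h

    R≤ : R ≤ 1 ⁄ 4096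
    R≤ = subst (_≤ 1 ⁄ 4096) (sym (^-* r 12 h₀)) (^-monoˡ 12 (^≥0 h₀ r≥0) half)

    private
      R>0 : 0ℚ < R
      R>0 = ^>0 h r>0
        where
        r>0 : 0ℚ < r
        r>0 = ≰⇒> λ r≤0 → <-irrefl refl (<-≤-trans (positive⁻¹ 1ℚ) (by (ρ≥0 ⊗ gap r≤0) (trans (e ρ r) (cong (λ z → z + ρ * (0ℚ - r)) ρr))))
          where e : ∀ a b → 0ℚ ≡ a * b + a * (0ℚ - b)
                e = solve-∀ ring
      P : ℚ
      P = ρ ^ h
      PR : P * R ≡ 1ℚ
      PR = trans (sym (*-^ ρ r h)) (trans (cong (_^ h) ρr) (1^ h))
      Δ : ℚ
      Δ = κ 9 * (κ h₀ * κ h₀) * u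
      Δ>0 : 0ℚ < Δ
      Δ>0 = positive⁻¹ (κ 9) ⊗⁺ (h₀>0 ⊗⁺ h₀>0) ⊗⁺ u>0
      v : ℚ
      v = proj₁ (inv Δ>0)
      v≥0 = <⇒≤ (proj₁ (proj₂ (inv Δ>0)))
      Dv : Δ * v ≡ 1ℚ
      Dv = proj₂ (proj₂ (inv Δ>0))
      y₀⁻¹ : ℚ
      y₀⁻¹ = proj₁ (inv (y>0 0))
      y₀⁻¹≥0 = <⇒≤ (proj₁ (proj₂ (inv (y>0 0))))
      y₀y₀⁻¹ : y 0 * y₀⁻¹ ≡ 1ℚ
      y₀y₀⁻¹ = proj₂ (proj₂ (inv (y>0 0)))

      -- 1 / τ j is 3 s, where s = 3 y h₀² u is the guaranteed variance of the block below level j h.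
      τ : ℕ → ℚ
      τ j = v * R * y₀⁻¹ * P ^ j

      τ≥0 : ∀ j → 0ℚ ≤ τ j
      τ≥0 j = v≥0 ⊗ <⇒≤ R>0 ⊗ y₀⁻¹≥0 ⊗ ^≥0 j (^≥0 h ρ≥0)

      y-level : ∀ j → y (j ℕ.* h) ≡ R ^ j * y 0
      y-level j = trans (cong y (sym (ℕ.+-identityʳ (j ℕ.* h)))) (trans (y-+ (j ℕ.* h) 0) (cong (_* y 0) (^-* r j h)))

      τy : ∀ j → τ j * y (j ℕ.* h) ≡ v * R
      τy j = trans (cong (τ j *_) (y-level j)) (trans (e (v * R) y₀⁻¹ (P ^ j) (R ^ j) (y 0)) (trans (cong₂ (λ a b → v * R * a * b) y₀y₀⁻¹ (trans (sym (*-^ P R j)) (trans (cong (_^ j) PR) (1^ j)))) (e′ (v * R))))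
        where e : ∀ c i p q y → c * i * p * (q * y) ≡ c * (y * i) * (p * q)
              e = solve-∀ ring
              e′ : ∀ c → c * 1ℚ * 1ℚ ≡ c
              e′ = solve-∀ ring

      τ-suc : ∀ j → R * τ (suc j) ≡ τ j
      τ-suc j = trans (e v R y₀⁻¹ P (P ^ j)) (trans (cong (λ z → z * (v * R * y₀⁻¹ * P ^ j)) PR) (*-identityˡ (τ j)))
        where e : ∀ v R y P q → R * (v * R * y * (P * q)) ≡ P * R * (v * R * y * q)
              e = solve-∀ ring

      τy′ : ∀ j → τ (suc j) * y (j ℕ.* h) ≡ v
      τy′ j = *-cancelˡ-≡ (trans (e R (τ (suc j)) (y (j ℕ.* h))) (trans (cong (_* y (j ℕ.* h)) (τ-suc j)) (trans (τy j) (*-comm v R))))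
        where e : ∀ R t y → R * (t * y) ≡ R * t * y
              e = solve-∀ ring
              *-cancelˡ-≡ : ∀ {a b} → R * a ≡ R * b → a ≡ b
              *-cancelˡ-≡ eq = ≤-antisym (*-cancelˡ R>0 (≤-reflexive eq)) (*-cancelˡ R>0 (≤-reflexive (sym eq)))

      κh : κ h ≡ κ 12 * κ h₀
      κh = κ-* 12 h₀

    module _ (M : ℕ) (thick : ∀ j → j ℕ.< M → κ 1600 ≤ y (j ℕ.* h) * u) where
      open Survival π π≥0 π≤½

      private
        spread : ∀ j → j ℕ.< M → 1ℚ ≤ κ 3 * moment (j ℕ.* h) 0ℚ h * τ (suc j)
        spread j _ = ≤-trans (≤-reflexive (trans (sym Dv) (trans (cong (Δ *_) (sym (τy′ j))) (e (y (j ℕ.* h)) u (κ h₀ * κ h₀) (τ (suc j))))))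
            (*-monoˡ (τ≥0 (suc j)) (*-monoʳ (κ≥0 3) (moment≥ (j ℕ.* h))))
          where e : ∀ y u h t → κ 9 * h * u * (t * y) ≡ κ 3 * (κ 3 * y * u * h) * t
                e = solve-∀ ring

        -- Since h = 12 h₀, the left side equals 144 / (9 y u) = 16 / (y u); this is the origin of
        -- the bound 1600 for `y u`.
        fine : ∀ j → j ℕ.< M → τ (suc j) * (κ h * κ h) ≤ 1 ⁄ 100
        fine j l = subst (λ z → τ (suc j) * (z * z) ≤ 1 ⁄ 100) (sym κh)
          (by (nonNegative⁻¹ (1 ⁄ 1600) ⊗ (τ≥0 (suc j) ⊗ sq≥0 (κ 12 * κ h₀)) ⊗ gap (thick j l))
            (trans (cong (λ z → z * (1 ⁄ 100)) (sym Dv)) (trans (cong (λ z → Δ * z * (1 ⁄ 100)) (sym (τy′ j))) (e (κ h₀) u (τ (suc j)) (y (j ℕ.* h))))))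
          where e : ∀ h u t y → κ 9 * (h * h) * u * (t * y) * (1 ⁄ 100) ≡ t * (κ 12 * h * (κ 12 * h)) + 1 ⁄ 1600 * (t * (κ 12 * h * (κ 12 * h))) * (y * u - κ 1600)
                e = solve-∀ ring

        growth : ∀ j → j ℕ.< M → κ 100 * τ j ≤ τ (suc j)
        growth j _ = by (τ≥0 (suc j) ⊗ (κ≥0 100 ⊗ gap R≤ ⊕ nonNegative⁻¹ (3996 ⁄ 4096))) (trans (e R (τ (suc j))) (cong (λ z → κ 100 * z + τ (suc j) * (κ 100 * (1 ⁄ 4096 - R) + 3996 ⁄ 4096)) (τ-suc j)))
          where e : ∀ R t → t ≡ κ 100 * (R * t) + t * (κ 100 * (1 ⁄ 4096 - R) + 3996 ⁄ 4096)
                e = solve-∀ ring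

        -- This fixes the length of a block: the left side is at most 160 R, and 160 / 2^12 is below
        -- 1/25 while 160 / 2^11 is not.
        narrow : ∀ j → j ℕ.< M → κ 5 * (κ h * κ h * variance (j ℕ.* h) h) * τ j ≤ 1 ⁄ 25
        narrow j _ = ≤-trans (*-monoˡ (τ≥0 j) (*-monoʳ (κ≥0 5) (*-monoʳ (sq≥0 (κ h)) (variance≤ (j ℕ.* h) h))))
            (≤-trans (≤-reflexive (trans (cong (λ z → κ 5 * (z * z * (κ 2 * y (j ℕ.* h) * u)) * τ j) κh)
               (trans (e (κ h₀) u (τ j) (y (j ℕ.* h))) (trans (cong (λ z → κ 160 * (κ 9 * (κ h₀ * κ h₀) * u) * z) (τy j)) (trans (e′ Δ v R) (cong (λ z → κ 160 * z * R) Dv))))))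
              (≤-trans (*-monoʳ (κ≥0 160 ⊗ 1≥0) R≤) (toWitness {a? = κ 160 * 1ℚ * (1 ⁄ 4096) ≤? 1 ⁄ 25} _)))
          where e : ∀ h u t y → κ 5 * (κ 12 * h * (κ 12 * h) * (κ 2 * y * u)) * t ≡ κ 160 * (κ 9 * (h * h) * u) * (t * y)
                e = solve-∀ ring
                e′ : ∀ Δ v R → κ 160 * Δ * (v * R) ≡ κ 160 * (Δ * v) * R
                e′ = solve-∀ ring

      -- The second moments from the free levels amount to at most 84 R ≤ 1, which gives the factor
      -- 1 + 1.
      survival : ∀ l → value (l ℕ.+ M ℕ.* h) 0ℚ 0ℚ ≤ κ 2 * θ ^ M
      survival l = ≤-trans (Blocks.survive-all h M τ τ≥0 spread fine growth narrow l)
          (≤-trans (*-monoʳ (^≥0 M θ≥0) (+-monoʳ-≤ 1ℚ top)) (≤-reflexive (e (θ ^ M))))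
        where
        k = M ℕ.* h
        Y≥0 = <⇒≤ (y>0 k)
        e : ∀ t → t * (1ℚ + 1ℚ) ≡ κ 2 * t
        e = solve-∀ ring
        sizes : κ 12 * κ h₀ * (κ 12 * κ h₀) * u + κ 2 * (κ 12 * κ h₀) * (u * u) + κ 2 * (u * u * u) ≤ κ 234 * (κ h₀ * κ h₀) * u
        sizes = by (u≥0 ⊗ gap u≤3h₀ ⊗ (κ≥0 30 ⊗ κ≥0 h₀ ⊕ κ≥0 2 ⊗ u≥0)) (e′ (κ h₀) u)
          where e′ : ∀ h u → κ 234 * (h * h) * u ≡ κ 12 * h * (κ 12 * h) * u + κ 2 * (κ 12 * h) * (u * u) + κ 2 * (u * u * u) + u * (κ 3 * h - u) * (κ 30 * h + κ 2 * u)
                e′ = solve-∀ ring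
        top : τ M * (moment k (κ h) l + κ h * κ h * variance k l) ≤ 1ℚ
        top = ≤-trans (*-monoʳ (τ≥0 M) (+-mono-≤ (≤-trans (moment≤ k (κ h) l (κ≥0 h)) (≤-trans (≤-reflexive (cong (λ z → κ 2 * y k * (z * z * u + κ 2 * z * (u * u) + κ 2 * (u * u * u))) κh)) (*-monoʳ (κ≥0 2 ⊗ Y≥0) sizes)))
                  (≤-trans (*-monoʳ (sq≥0 (κ h)) (variance≤ k l)) (≤-reflexive (cong (λ z → z * z * (κ 2 * y k * u)) κh)))))
            (≤-trans (≤-reflexive (trans (e₁ (τ M) (y k) (κ h₀) u) (trans (cong (λ z → κ 84 * (κ 9 * (κ h₀ * κ h₀) * u) * z) (τy M)) (trans (e₂ Δ v R) (cong (λ z → κ 84 * z * R) Dv)))))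
              (≤-trans (*-monoʳ (κ≥0 84 ⊗ 1≥0) R≤) (toWitness {a? = κ 84 * 1ℚ * (1 ⁄ 4096) ≤? 1ℚ} _)))
          where e₁ : ∀ t y h u → t * (κ 2 * y * (κ 234 * (h * h) * u) + κ 12 * h * (κ 12 * h) * (κ 2 * y * u)) ≡ κ 84 * (κ 9 * (h * h) * u) * (t * y)
                e₁ = solve-∀ ring
                e₂ : ∀ Δ v R → κ 84 * Δ * (v * R) ≡ κ 84 * (Δ * v) * R
                e₂ = solve-∀ ring

-- Harmonic sums and powers of two as orders of magnitude.

module Magnitudes where

  open import Data.Nat as ℕ using (ℕ; zero; suc)
  import Data.Nat.Properties as ℕ
  import Data.Nat.Tactic.RingSolver as ℕ
  open import Data.Rational
  open import Data.Rational.Properties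
  open import Data.Product using (_×_; _,_; ∃)
  open import Data.Empty using (⊥-elim)
  open import Relation.Nullary using (Dec; yes; no; ¬_)
  open import Relation.Nullary.Decidable using (toWitness)
  open import Relation.Binary.PropositionalEquality using (_≡_; refl; sym; trans; cong; cong₂; subst; subst₂)
  open import Tactic.RingSolver using (solve-∀)
  open Rationals
  open CellSums
  open Riccati using (½≥0)

  κ-0<⁻¹ : ∀ {n} → 0ℚ < κ n → ∃ λ m → n ≡ suc m
  κ-0<⁻¹ {zero}  h = ⊥-elim (<-irrefl refl h)
  κ-0<⁻¹ {suc m} h = m , refl

  half-pos : ∀ {a c} → 0ℚ < a → a ≤ κ 2 * c → 0ℚ < c
  half-pos {a} {c} a>0 h with c ≤? 0ℚ
  ... | no c≰0  = ≰⇒> c≰0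
  ... | yes c≤0 = ⊥-elim (<-irrefl refl (<-≤-trans a>0 (≤-trans h (by (κ≥0 2 ⊗ gap c≤0) (e c)))))
    where e : ∀ c → 0ℚ ≡ κ 2 * c + κ 2 * (0ℚ - c)
          e = solve-∀ ring

  inverse-pos : ∀ {b u} → 0ℚ ≤ b → b * u ≡ 1ℚ → 0ℚ < u
  inverse-pos {b} {u} b≥0 bu with u ≤? 0ℚ
  ... | no u≰0  = ≰⇒> u≰0
  ... | yes u≤0 = ⊥-elim (<-irrefl refl (<-≤-trans (positive⁻¹ 1ℚ) (by (b≥0 ⊗ gap u≤0) (trans (e b u) (cong (_+ b * (0ℚ - u)) bu)))))
    where e : ∀ b u → 0ℚ ≡ b * u + b * (0ℚ - u)
          e = solve-∀ ring

  sh-at : ∀ n g m → m ℕ.≤ n → g 0 ≡ 0ℚ → sh n g m ≡ 0ℚ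
  sh-at zero    g zero    l           g0 = g0
  sh-at (suc n) g zero    l           g0 = refl
  sh-at (suc n) g (suc m) (ℕ.s≤s l) g0 = sh-at n g m l g0

  -- Replaces real roots and logarithms: a parameter is taken where an inequality holds for it but
  -- fails for its successor.
  last-true : (P : ℕ → Set) → (∀ m → Dec (P m)) → P 0 → ∀ b → ¬ P b → ∃ λ m → m ℕ.< b × P m × ¬ P (suc m)
  last-true P P? p0 zero    ¬pb = ⊥-elim (¬pb p0)
  last-true P P? p0 (suc b) ¬pb with P? b
  ... | yes pb = b , ℕ.≤-refl , pb , ¬pb
  ... | no ¬pb′ with last-true P P? p0 b ¬pb′
  ...   | m , l , pm , ¬pm = m , ℕ.m≤n⇒m≤1+n l , pm , ¬pm

  ι-antitone : ∀ {i j} → i ℕ.≤ j → ι j ≤ ι i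
  ι-antitone {i} {j} l = *-cancelˡ (κ>0 i ⊗⁺ κ>0 j) (subst₂ _≤_ (trans (trans (sym (*-identityʳ (κ (suc i)))) (cong (κ (suc i) *_) (sym (κι j)))) (sym (*-assoc (κ (suc i)) (κ (suc j)) (ι j))))
      (trans (trans (sym (*-identityʳ (κ (suc j)))) (cong (κ (suc j) *_) (sym (κι i)))) (e (κ (suc i)) (κ (suc j)) (ι i))) (κ-mono (ℕ.s≤s l)))
    where e : ∀ a b c → b * (a * c) ≡ a * b * c
          e = solve-∀ ring

  H≥0 : ∀ n → 0ℚ ≤ H n
  H≥0 n = Σ<≥0 n (λ i _ → ι≥0 i)

  H-mono : ∀ {m n} → m ℕ.≤ n → H m ≤ H n
  H-mono {m} {n} l = subst (λ k → H m ≤ H k) (ℕ.m+[n∸m]≡n l) (by (Σ<≥0 (n ℕ.∸ m) (λ i _ → ι≥0 (m ℕ.+ i))) (Σ<-split m (n ℕ.∸ m) ι))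

  H-double : ∀ m → H (suc m ℕ.+ suc m) ≤ H (suc m) + 1ℚ
  H-double m = ≤-trans (≤-reflexive (Σ<-split (suc m) (suc m) ι)) (+-monoʳ-≤ (H (suc m))
    (≤-trans (Σ<-mono (suc m) {g = λ _ → ι m * 1ℚ} (λ i _ → ≤-trans (ι-antitone (ℕ.≤-trans (ℕ.n≤1+n m) (ℕ.m≤m+n (suc m) i))) (≤-reflexive (sym (*-identityʳ (ι m))))))
      (≤-reflexive (trans (Σ<-* (suc m) (ι m) (λ _ → 1ℚ)) (trans (cong (ι m *_) (ones (suc m))) (trans (*-comm (ι m) (κ (suc m))) (κι m)))))))
    where ones : ∀ n → Σ< n (λ _ → 1ℚ) ≡ κ n
          ones zero    = refl
          ones (suc n) = trans (cong (_+ 1ℚ) (ones n)) (+-comm (κ n) 1ℚ)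

  H-pow : ∀ e → H (2 ℕ.^ e) ≤ 1ℚ + κ e
  H-pow zero    = ≤-refl
  H-pow (suc e) with 2 ℕ.^ e in eq
  ... | zero  = ⊥-elim (ℕ.<-irrefl refl (subst (0 ℕ.<_) eq (ℕ.m^n>0 2 e)))
  ... | suc m = ≤-trans (≤-reflexive (cong (λ k → H (suc m ℕ.+ k)) (ℕ.+-identityʳ (suc m)))) (≤-trans (H-double m) (≤-trans (+-monoˡ-≤ 1ℚ (subst (λ k → H k ≤ 1ℚ + κ e) eq (H-pow e))) (≤-reflexive (e′ (κ e)))))
    where e′ : ∀ k → 1ℚ + k + 1ℚ ≡ 1ℚ + (1ℚ + k)
          e′ = solve-∀ ring

  ζ≥1 : ∀ n → 1ℚ ≤ ζ (suc n)
  ζ≥1 zero    = ≤-refl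
  ζ≥1 (suc n) = ≤-trans (ζ≥1 n) (by (ι≥0 (suc n) ⊗ ι≥0 (suc n)) refl)

  ζ≤2 : ∀ n → ζ n ≤ κ 2
  ζ≤2 zero    = κ≥0 2
  ζ≤2 (suc n) = ≤-trans (sharp n) (by (ι≥0 n) (e (ι n)))
    where
    e : ∀ a → κ 2 ≡ κ 2 - a + a
    e = solve-∀ ring
    sharp : ∀ n → ζ (suc n) ≤ κ 2 - ι n
    sharp zero    = ≤-refl
    sharp (suc n) = ≤-trans (+-monoˡ-≤ (ι (suc n) * ι (suc n)) (sharp n)) (by drop (e₀ (ι n) (ι (suc n))))
      where
      a = ι n
      b = ι (suc n)
      e₀ : ∀ a b → κ 2 - b ≡ κ 2 - a + b * b + (a - b - b * b)
      e₀ = solve-∀ ring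
      -- 1/m - 1/(m+1) - 1/(m+1)² = 1/(m (m+1)²)
      drop : 0ℚ ≤ a - b - b * b
      drop = subst (0ℚ ≤_) eq (ι≥0 n ⊗ (ι≥0 (suc n) ⊗ ι≥0 (suc n)))
        where
        e₁ : ∀ k a b → a * (b * b) ≡ a * ((1ℚ + k) * b * ((1ℚ + k) * b)) - k * a * (b * ((1ℚ + k) * b)) - k * a * (b * b)
        e₁ = solve-∀ ring
        e₂ : ∀ a b → a * (1ℚ * 1ℚ) - 1ℚ * (b * 1ℚ) - 1ℚ * (b * b) ≡ a - b - b * b
        e₂ = solve-∀ ring
        eq : a * (b * b) ≡ a - b - b * b
        eq = trans (e₁ (κ (suc n)) a b) (trans (cong₂ (λ s t → a * (s * s) - t * (b * s) - t * (b * b)) (κι (suc n)) (κι n)) (e₂ a b))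

  square<pow : ∀ j → (7 ℕ.+ j) ℕ.* (7 ℕ.+ j) ℕ.≤ 2 ℕ.^ (6 ℕ.+ j)
  square<pow zero    = toWitness {a? = 49 ℕ.≤? 64} _
  square<pow (suc j) = ℕ.≤-trans (ℕ.≤-trans (ℕ.m≤m+n _ (34 ℕ.+ 12 ℕ.* j ℕ.+ j ℕ.* j)) (ℕ.≤-reflexive (e j))) (ℕ.*-monoʳ-≤ 2 (square<pow j))
    where e : ∀ j → (7 ℕ.+ suc j) ℕ.* (7 ℕ.+ suc j) ℕ.+ (34 ℕ.+ 12 ℕ.* j ℕ.+ j ℕ.* j) ≡ 2 ℕ.* ((7 ℕ.+ j) ℕ.* (7 ℕ.+ j))
          e = ℕ.solve-∀

  module Powers (k : ℕ) (k-large : 4010 ℕ.≤ k) where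

    -- Exponents are counted in units of k, so that orders of magnitude are compared by adding
    -- integers; n itself lies between 4000 and 4001 units.
    pw Pw : ℕ → ℚ
    pw a = ½ ^ (k ℕ.* a)
    Pw a = κ 2 ^ (k ℕ.* a)

    pw>0 : ∀ a → 0ℚ < pw a
    pw>0 a = ^>0 (k ℕ.* a) (positive⁻¹ ½)

    pw≥0 : ∀ a → 0ℚ ≤ pw a
    pw≥0 a = <⇒≤ (pw>0 a)

    Pw≥0 : ∀ a → 0ℚ ≤ Pw a
    Pw≥0 a = ^≥0 (k ℕ.* a) (κ≥0 2)

    pw-+ : ∀ a b → pw a * pw b ≡ pw (a ℕ.+ b)
    pw-+ a b = trans (sym (^-+ ½ (k ℕ.* a) (k ℕ.* b))) (cong (½ ^_) (sym (ℕ.*-distribˡ-+ k a b)))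

    Pw-pw : ∀ a → Pw a * pw a ≡ 1ℚ
    Pw-pw a = trans (sym (*-^ (κ 2) ½ (k ℕ.* a))) (1^ (k ℕ.* a))

    pw-≤ : ∀ {a b} → a ℕ.≤ b → pw b ≤ pw a
    pw-≤ l = ^-antimonoʳ ½≥0 (toWitness {a? = ½ ≤? 1ℚ} _) (ℕ.*-monoʳ-≤ k l)

    private
      square : suc k ℕ.* suc k ℕ.≤ 2 ℕ.^ k
      square = subst (λ m → suc m ℕ.* suc m ℕ.≤ 2 ℕ.^ m) (ℕ.m+[n∸m]≡n (ℕ.≤-trans (ℕ.m≤m+n 6 4004) k-large)) (square<pow (k ℕ.∸ 6))

    -- Both constants up to 4010 and linear functions of k with such coefficients are absorbed by one factor 2^(-k).
    linear-small : ∀ c → c ℕ.≤ 4010 → κ (c ℕ.* suc k) * pw 1 ≤ 1ℚ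
    linear-small c l = ≤-trans (*-monoˡ (pw≥0 1) (≤-trans (κ-mono (ℕ.≤-trans (ℕ.*-monoˡ-≤ (suc k) (ℕ.≤-trans l (ℕ.≤-trans k-large (ℕ.n≤1+n k)))) square))
        (≤-reflexive (trans (κ-^ 2 k) (cong (κ 2 ^_) (sym (ℕ.*-identityʳ k)))))))
      (≤-reflexive (Pw-pw 1))

    const-small : ∀ c → c ℕ.≤ 4010 → κ c * pw 1 ≤ 1ℚ
    const-small c l = ≤-trans (*-monoˡ (pw≥0 1) (κ-mono (ℕ.m≤m*n c (suc k)))) (linear-small c l)

    absorb : ∀ c a → c ℕ.≤ 4010 → κ c * pw (suc a) ≤ pw a
    absorb c a l = ≤-trans (≤-reflexive (trans (cong (κ c *_) (sym (pw-+ 1 a))) (sym (*-assoc (κ c) (pw 1) (pw a)))))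
      (≤-trans (*-monoˡ (pw≥0 a) (const-small c l)) (≤-reflexive (*-identityˡ (pw a))))

    pw≤ : ∀ c {a} → c ℕ.≤ 4010 → 1 ℕ.≤ a → κ c * pw a ≤ 1ℚ
    pw≤ c l la = ≤-trans (*-monoʳ (κ≥0 c) (pw-≤ la)) (const-small c l)

    up : ∀ {v c} a → v * pw a ≤ c → v ≤ c * Pw a
    up {v} {c} a h = ≤-trans (≤-reflexive (trans (sym (*-identityʳ v)) (trans (cong (v *_) (sym (Pw-pw a))) (e v (Pw a) (pw a))))) (*-monoˡ (Pw≥0 a) h)
      where e : ∀ v p q → v * (p * q) ≡ v * q * p
            e = solve-∀ ring

    Pw-+ : ∀ a b → Pw a * Pw b ≡ Pw (a ℕ.+ b)
    Pw-+ a b = trans (sym (^-+ (κ 2) (k ℕ.* a) (k ℕ.* b))) (cong (κ 2 ^_) (sym (ℕ.*-distribˡ-+ k a b)))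

    Pw-≤ : ∀ {a b} → a ℕ.≤ b → Pw a ≤ Pw b
    Pw-≤ l = ^-monoʳ (κ-mono (ℕ.s≤s (ℕ.z≤n {1}))) (ℕ.*-monoʳ-≤ k l)

    Pw≥1 : ∀ a → 1ℚ ≤ Pw a
    Pw≥1 a = ^≥1 (k ℕ.* a) (κ-mono (ℕ.s≤s (ℕ.z≤n {1})))

    absorb-Pw : ∀ c a → c ℕ.≤ 4010 → κ c * Pw a ≤ Pw (suc a)
    absorb-Pw c a l = ≤-trans (*-monoˡ (Pw≥0 a) (≤-trans (up {κ c} 1 (const-small c l)) (≤-reflexive (*-identityˡ (Pw 1))))) (≤-reflexive (Pw-+ 1 a))

    Pw-cancel : ∀ a b → Pw (a ℕ.+ b) * pw b ≡ Pw a
    Pw-cancel a b = trans (cong (_* pw b) (sym (Pw-+ a b))) (trans (*-assoc (Pw a) (Pw b) (pw b)) (trans (cong (Pw a *_) (Pw-pw b)) (*-identityʳ (Pw a))))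

-- The error budget at a fixed scale and the bound for the number of dominated pairs.

module Estimates where

  open import Data.Nat as ℕ using (ℕ; suc)
  import Data.Nat.Properties as ℕ
  import Data.Nat.Tactic.RingSolver as ℕ
  open import Data.Rational
  open import Data.Rational.Properties
  open import Data.Product using (_×_; _,_; ∃; proj₁; proj₂)
  open import Data.Sum using (_⊎_; inj₁; inj₂)
  open import Relation.Nullary.Decidable using (toWitness)
  open import Relation.Binary.PropositionalEquality using (_≡_; refl; sym; trans; cong; cong₂; subst; subst₂)
  open import Tactic.RingSolver using (solve-∀)
  open import Defs using (p; dominatedPairs)
  open Rationals
  open CellSums
  open Riccati
  open PartitionLists
  open Counting
  open RandomWalk
  open Comparison
  open Scaling
  open Magnitudes

  open Weights f f≥0 f-mono f-base f-step

  -- The scale is n ≈ 2^(4000 k). With f the number of partitions into parts ≤ θ′, the barriers for f₁ / f₂ near n are b and B = b + δ,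
  -- r = 1 / (1 + b) is the resulting ratio f (m - 1) / f m, and h₀ is its half-life. The error terms are x = 2^(-1020 k), the parts
  -- above θ′ start at r^θ ≈ 2^(-1030 k) (few enough for linearisation, and mostly distinct), and M = 80 k blocks of 12 h₀ values,
  -- each a factor 2^12 rarer than the one below, reach up to r^v ≈ 2^(-1990 k), still short of the top at 2^(-2000 k).
  module Core (k : ℕ) (k-large : 4010 ℕ.≤ k) (n′ θ″ G h₀ s : ℕ) (b r U : ℚ) where
    open Powers k k-large

    n θ′ : ℕ
    n  = suc n′
    θ′ = suc θ″

    Z Hn x N : ℚ
    Z  = ζ n
    Hn = H n
    x  = pw 1020
    N  = κ n

    module Analysis
      (G≡ : suc θ′ ≡ G ℕ.* h₀) (G-def : G ≡ k ℕ.* 1030) (s≡ : θ′ ≡ s ℕ.+ h₀)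
      (n-lo : 1ℚ ≤ N * pw 4000) (n-hi : N * pw 4001 ≤ 1ℚ) (H-small : Hn * pw 1 ≤ 1ℚ)
      (b>0 : 0ℚ < b) (bU : b * U ≡ 1ℚ) (r≥0 : 0ℚ ≤ r) (ρr : (1ℚ + b) * r ≡ 1ℚ)
      (b-lo : pw 2002 ≤ b) (b-hi : b ≤ pw 1999)
      (balance : N * b * b + Hn * b + x ≤ Z)
      (ν : ℚ) (ν≥0 : 0ℚ ≤ ν) (Nν : N * ν ≡ 1ℚ)
      (tight : Z ≤ N * b * b + (Hn * b + x + (κ 2 * b + ν + Hn * ν)))
      (U²-hi : U * U ≤ κ 8 * N) (U²-lo : N ≤ κ 2 * (U * U))
      (h₀≤ : κ h₀ ≤ 1ℚ + U) (h₀≥ : U ≤ κ 2 * κ h₀) (half : r ^ h₀ ≤ ½) (half⁻ : r ≤ κ 2 * r ^ h₀)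
      where

      b≥0 = <⇒≤ b>0
      x≥0 = pw≥0 1020
      Hn≥0 = H≥0 n
      N>0 : 0ℚ < N
      N>0 = κ>0 n′
      N≥0 = <⇒≤ N>0
      Z≥1 = ζ≥1 n′
      Z≤2 = ζ≤2 n
      w = r ^ h₀
      w≥0 = ^≥0 h₀ r≥0

      U≥0 : 0ℚ ≤ U
      U≥0 = <⇒≤ (inverse-pos b≥0 bU)

      ν≤ : ν ≤ pw 4000
      ν≤ = ≤-trans (≤-reflexive (sym (*-identityʳ ν))) (≤-trans (*-monoʳ ν≥0 n-lo) (≤-reflexive (trans (e N ν (pw 4000)) (trans (cong (_* pw 4000) Nν) (*-identityˡ _)))))
        where e : ∀ N ν p → ν * (N * p) ≡ N * ν * p
              e = solve-∀ ring

      tiny : ∀ c {a v} → c ℕ.≤ 4010 → 1 ℕ.≤ a → v ≤ pw a → κ c * v ≤ 1ℚ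
      tiny c lc la h = ≤-trans (*-monoʳ (κ≥0 c) h) (pw≤ c lc la)

      b-tiny : κ 1000 * b ≤ 1ℚ
      b-tiny = tiny 1000 (ℕ.m≤m+n 1000 3010) (ℕ.s≤s ℕ.z≤n) b-hi

      x-tiny : κ 1000 * x ≤ 1ℚ
      x-tiny = tiny 1000 (ℕ.m≤m+n 1000 3010) (ℕ.s≤s ℕ.z≤n) ≤-refl

      b≤1 : b ≤ 1ℚ
      b≤1 = by (gap b-tiny ⊕ κ≥0 999 ⊗ b≥0) (e b)
        where e : ∀ b → 1ℚ ≡ b + (1ℚ - κ 1000 * b + κ 999 * b)
              e = solve-∀ ring

      r≤1 : r ≤ 1ℚ
      r≤1 = by (b≥0 ⊗ r≥0) (trans (sym ρr) (e b r))
        where e : ∀ b r → (1ℚ + b) * r ≡ r + b * r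
              e = solve-∀ ring

      r≥1-b : 1ℚ - b ≤ r
      r≥1-b = by (b≥0 ⊗ gap r≤1) (trans (e b r) (trans (cong (_- b * r) ρr) (e′ b r)))
        where e : ∀ b r → r ≡ (1ℚ + b) * r - b * r
              e = solve-∀ ring
              e′ : ∀ b r → 1ℚ - b * r ≡ 1ℚ - b + b * (1ℚ - r)
              e′ = solve-∀ ring

      r≥ : 999 ⁄ 1000 ≤ r
      r≥ = ≤-trans (by (nonNegative⁻¹ (1 ⁄ 1000) ⊗ gap b-tiny) (e b)) r≥1-b
        where e : ∀ b → 1ℚ - b ≡ 999 ⁄ 1000 + 1 ⁄ 1000 * (1ℚ - κ 1000 * b)
              e = solve-∀ ring

      w≥ : 499 ⁄ 1000 ≤ w
      w≥ = by (½≥0 ⊗ (gap half⁻ ⊕ gap r≥) ⊕ nonNegative⁻¹ (1 ⁄ 2000)) (e w r)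
        where e : ∀ w r → w ≡ 499 ⁄ 1000 + (½ * (κ 2 * w - r + (r - 999 ⁄ 1000)) + 1 ⁄ 2000)
              e = solve-∀ ring

      w^G : r ^ suc θ′ ≤ pw 1030
      w^G = subst₂ _≤_ (trans (sym (^-* r G h₀)) (cong (r ^_) (sym G≡))) (cong (½ ^_) G-def) (^-monoˡ G w≥0 half)

      G-small : κ G * pw 1 ≤ 1ℚ
      G-small = ≤-trans (*-monoˡ (pw≥0 1) (κ-mono (subst (ℕ._≤ 1030 ℕ.* suc k) (sym (trans G-def (ℕ.*-comm k 1030))) (ℕ.*-monoʳ-≤ 1030 (ℕ.n≤1+n k))))) (linear-small 1030 (ℕ.m≤m+n 1030 2980))

      HG : Hn * κ G * pw 2 ≤ 1ℚ
      HG = ≤-trans (≤-reflexive (trans (cong (Hn * κ G *_) (sym (pw-+ 1 1))) (e Hn (κ G) (pw 1)))) (≤-trans (*-mono (Hn≥0 ⊗ pw≥0 1) 1≥0 H-small G-small) (≤-reflexive (*-identityˡ 1ℚ)))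
        where e : ∀ a b p → a * b * (p * p) ≡ a * p * (b * p)
              e = solve-∀ ring

      r^s : r ^ s ≤ κ 5 * pw 1030
      r^s = by (κ≥0 5 ⊗ gap w^G ⊕ ^≥0 s r≥0 ⊗ (κ≥0 5 ⊗ (gap r≥ ⊗ w≥0 ⊕ nonNegative⁻¹ (999 ⁄ 1000) ⊗ gap w≥) ⊕ nonNegative⁻¹ c)) (trans (e (r ^ s) r w (pw 1030))
            (cong (λ z → r ^ s + (κ 5 * (pw 1030 - z) + r ^ s * (κ 5 * ((r - 999 ⁄ 1000) * w + 999 ⁄ 1000 * (w - 499 ⁄ 1000)) + c))) (trans (sym (cong (r *_) (^-+ r s h₀))) (cong (λ m → r ^ suc m) (sym s≡)))))
        where c = κ 5 * (999 ⁄ 1000 * (499 ⁄ 1000)) - 1ℚ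
              e : ∀ q r w p → κ 5 * p ≡ q + (κ 5 * (p - r * (q * w)) + q * (κ 5 * ((r - 999 ⁄ 1000) * w + 999 ⁄ 1000 * (w - 499 ⁄ 1000)) + (κ 5 * (999 ⁄ 1000 * (499 ⁄ 1000)) - 1ℚ)))
              e = solve-∀ ring

      N-large : Pw 3999 ≤ N
      N-large = ≤-trans (≤-reflexive (sym (*-identityʳ (Pw 3999)))) (≤-trans (*-monoʳ (Pw≥0 3999) n-lo)
          (≤-trans (≤-reflexive (e (Pw 3999) N (pw 4000))) (≤-trans (*-monoʳ N≥0 (≤-trans (*-monoʳ (Pw≥0 3999) (pw-≤ (ℕ.n≤1+n 3999))) (≤-reflexive (Pw-pw 3999)))) (≤-reflexive (*-identityʳ N)))))
        where e : ∀ a N p → a * (N * p) ≡ N * (a * p)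
              e = solve-∀ ring

      slack : N * b + Hn ≤ N
      slack = by (N≥0 ⊗ (½≥0 ⊗ gap b-half) ⊕ gap H≤) (e N b Hn)
        where
        b-half : κ 2 * b ≤ 1ℚ
        b-half = tiny 2 (ℕ.m≤m+n 2 4008) (ℕ.s≤s ℕ.z≤n) b-hi
        H≤ : Hn ≤ ½ * N
        H≤ = *-cancelˡ (pw>0 1) (≤-trans (≤-trans (≤-reflexive (*-comm (pw 1) Hn)) H-small)
               (≤-trans n-lo (≤-trans (*-monoʳ N≥0 (≤-trans (≤-reflexive (e₁ (pw 4000))) (*-monoʳ ½≥0 (absorb 2 3999 (ℕ.m≤m+n 2 4008)))))
                  (≤-trans (*-monoʳ N≥0 (*-monoʳ ½≥0 (pw-≤ (ℕ.s≤s (ℕ.z≤n {3998}))))) (≤-reflexive (e₂ N (pw 1)))))))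
          where e₁ : ∀ p → p ≡ ½ * (κ 2 * p)
                e₁ = solve-∀ ring
                e₂ : ∀ N p → N * (½ * p) ≡ p * (½ * N)
                e₂ = solve-∀ ring
        e : ∀ N b h → N ≡ N * b + h + (N * (½ * (1ℚ - κ 2 * b)) + (½ * N - h))
        e = solve-∀ ring

      module Side (f : ℕ → ℚ) (f≥0 : ∀ m → 0ℚ ≤ f m) (f-mono : ∀ m → f m ≤ f (suc m)) where
        open Sums f f≥0 f-mono

        Decay : ℕ → Set
        Decay m = ∀ k j → j ℕ.+ k ℕ.≤ m → f₂ j ≤ r ^ k * f₂ (j ℕ.+ k)

        tail-θ tail-n : ℕ → ℚ
        tail-θ m = Hn * (κ (suc θ′) * sh θ′ f₁ m) + Z * sh θ′ f₂ m
        tail-n m = Hn * (κ (suc n) * sh n f₁ m) + Z * sh n f₂ m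

        tail-n-small : ∀ m → m ℕ.≤ n → Decay m → tail-n m ≤ x * f₂ m
        tail-n-small m l _ = ≤-trans (≤-reflexive (trans (cong₂ (λ a b → Hn * (κ (suc n) * a) + Z * b) (zero-at f₁ refl) (zero-at f₂ refl)) (e Hn (κ (suc n)) Z))) (x≥0 ⊗ f₂≥0 m)
          where
          e : ∀ h k z → h * (k * 0ℚ) + z * 0ℚ ≡ 0ℚ
          e = solve-∀ ring
          zero-at : ∀ g → g 0 ≡ 0ℚ → sh n g m ≡ 0ℚ
          zero-at g g0 = sh-at n g m l g0

        -- The tail sits at m - θ′, and θ′ + 1 is G half-lives. One of them turns h₀ f₁ into f₂, the
        -- others give decay below 5 · 2^(-1030 k), and the factor H G is absorbed between the
        -- exponents 1030 and 1020.
        tail-θ-small : ∀ m → m ℕ.≤ n → Decay m → tail-θ m ≤ x * f₂ m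
        tail-θ-small m l dec = split-case (ℕ-split m θ′)
         where
         split-case : m ℕ.< θ′ ⊎ (∃ λ m′ → m ≡ θ′ ℕ.+ m′) → tail-θ m ≤ x * f₂ m
         split-case (inj₁ m<θ) = ≤-trans (≤-reflexive (trans (cong₂ (λ a b → Hn * (κ (suc θ′) * a) + Z * b) (sh-miss θ′ f₁ m m<θ) (sh-miss θ′ f₂ m m<θ)) (e Hn (κ (suc θ′)) Z))) (x≥0 ⊗ f₂≥0 m)
          where e : ∀ h k z → h * (k * 0ℚ) + z * 0ℚ ≡ 0ℚ
                e = solve-∀ ring
         split-case (inj₂ (m′ , eq)) = ≤-trans (≤-reflexive (trans (cong₂ (λ a b → Hn * (κ (suc θ′) * a) + Z * b) (trans (cong (sh θ′ f₁) eq) (sh-hit θ′ f₁ m′)) (trans (cong (sh θ′ f₂) eq) (sh-hit θ′ f₂ m′)))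
                (trans (cong (λ z → Hn * (z * f₁ m′) + Z * f₂ m′) (trans (cong κ G≡) (κ-* G h₀))) (e₁ Hn (κ G) (κ h₀) (f₁ m′) Z (f₂ m′)))))
            (≤-trans (+-mono-≤ (*-monoʳ (Hn≥0 ⊗ κ≥0 G) first) (*-mono (≤-trans 1≥0 Z≥1) (^≥0 s r≥0 ⊗ f₂≥0 m) Z≤2 second))
              (≤-trans (by (((Hn≥0 ⊗ κ≥0 G) ⊕ κ≥0 2) ⊗ gap r^s ⊗ f₂≥0 m) (e₂ (Hn * κ G) (r ^ s) (f₂ m) (pw 1030)))
                (*-monoˡ (f₂≥0 m) final)))
          where
          e₁ : ∀ h g k a z c → h * (g * k * a) + z * c ≡ h * g * (k * a) + z * c
          e₁ = solve-∀ ring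
          e₂ : ∀ a q y p → (a + κ 2) * (κ 5 * p) * y ≡ a * (q * y) + κ 2 * (q * y) + (a + κ 2) * (κ 5 * p - q) * y
          e₂ = solve-∀ ring
          split : h₀ ℕ.+ m′ ℕ.+ s ≡ m
          split = trans (ℕ.+-comm (h₀ ℕ.+ m′) s) (trans (sym (ℕ.+-assoc s h₀ m′)) (trans (cong (ℕ._+ m′) (sym s≡)) (sym eq)))
          join : m′ ℕ.+ θ′ ≡ m
          join = trans (ℕ.+-comm m′ θ′) (sym eq)
          first : κ h₀ * f₁ m′ ≤ r ^ s * f₂ m
          first = ≤-trans (≤-trans (by (f₂≥0 m′) (+-comm (f₂ m′) (κ h₀ * f₁ m′))) (window-≥ f₁ f₁-mono h₀ m′))
                    (subst (λ i → f₂ (h₀ ℕ.+ m′) ≤ r ^ s * f₂ i) split (dec s (h₀ ℕ.+ m′) (ℕ.≤-reflexive split)))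
          second : f₂ m′ ≤ r ^ s * f₂ m
          second = ≤-trans (subst (λ i → f₂ m′ ≤ r ^ θ′ * f₂ i) join (dec θ′ m′ (ℕ.≤-reflexive join)))
                     (*-monoˡ (f₂≥0 m) (^-antimonoʳ r≥0 r≤1 (subst (s ℕ.≤_) (sym s≡) (ℕ.m≤m+n s h₀))))
          final : (Hn * κ G + κ 2) * (κ 5 * pw 1030) ≤ x
          final = ≤-trans (by (κ≥0 5 ⊗ gap HG ⊗ pw≥0 1028 ⊕ κ≥0 5 ⊗ gap (absorb 2 1028 (ℕ.m≤m+n 2 4008)) ⊕ κ≥0 10 ⊗ gap (pw-≤ (ℕ.n≤1+n 1029)))
                 (trans (e₃ (Hn * κ G) (pw 2) (pw 1028) (pw 1029) (pw 1030)) (trans (cong (λ z → (Hn * κ G + κ 2) * (κ 5 * pw 1030) + (κ 5 * (1ℚ - Hn * κ G * pw 2) * pw 1028 + κ 5 * (pw 1028 - κ 2 * pw 1029) + κ 10 * (pw 1029 - pw 1030)) + κ 5 * (Hn * κ G) * (z - pw 1030)) (pw-+ 2 1028)) (e₄ ((Hn * κ G + κ 2) * (κ 5 * pw 1030) + (κ 5 * (1ℚ - Hn * κ G * pw 2) * pw 1028 + κ 5 * (pw 1028 - κ 2 * pw 1029) + κ 10 * (pw 1029 - pw 1030))) (pw 1030) (κ 5 * (Hn * κ G))))))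
               (≤-trans (absorb 10 1027 (ℕ.m≤m+n 10 4000)) (pw-≤ (ℕ.m≤m+n 1020 7)))
            where
            e₃ : ∀ a q p p′ p″ → κ 10 * p ≡ (a + κ 2) * (κ 5 * p″) + (κ 5 * (1ℚ - a * q) * p + κ 5 * (p - κ 2 * p′) + κ 10 * (p′ - p″)) + κ 5 * a * (q * p - p″)
            e₃ = solve-∀ ring
            e₄ : ∀ a p c → a + c * (p - p) ≡ a
            e₄ = solve-∀ ring

      -- `δ` is 1 / (2 S₀), the largest slope error that a window of length S₀ tolerates. `m₁` is
      -- chosen to make ½ m₁ - Z - H equal to (H + 1)² / x + 5/2, as `barrier-step` requires.
      S₀ δ B m₁ : ℚ
      S₀ = N * x
      δ  = ½ * (Pw 1020 * ν)
      B  = b + δ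
      m₁ = κ 2 * Z + κ 2 * Hn + κ 2 * ((Hn + 1ℚ) * (Hn + 1ℚ)) * Pw 1020 + κ 5

      S₀>0 : 0ℚ < S₀
      S₀>0 = N>0 ⊗⁺ pw>0 1020

      δ≥0 : 0ℚ ≤ δ
      δ≥0 = ½≥0 ⊗ (Pw≥0 1020 ⊗ ν≥0)

      S₀δ : S₀ * δ ≤ ½
      S₀δ = ≤-reflexive (trans (e N x (Pw 1020) ν) (trans (cong₂ (λ a b → ½ * (a * b)) Nν (Pw-pw 1020)) (e′ ½)))
        where e : ∀ N x P ν → N * x * (½ * (P * ν)) ≡ ½ * (N * ν * (P * x))
              e = solve-∀ ring
              e′ : ∀ h → h * (1ℚ * 1ℚ) ≡ h
              e′ = solve-∀ ring

      δ≤ : δ ≤ pw 2980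
      δ≤ = ≤-trans (*-monoʳ ½≥0 (*-monoʳ (Pw≥0 1020) ν≤)) (≤-trans (≤-reflexive (trans (cong (λ z → ½ * (Pw 1020 * z)) (sym (pw-+ 1020 2980))) (trans (e (Pw 1020) (pw 1020) (pw 2980)) (cong (λ z → ½ * (z * pw 2980)) (Pw-pw 1020)))))
             (by (½≥0 ⊗ pw≥0 2980) (e′ (pw 2980))))
        where e : ∀ P p q → ½ * (P * (p * q)) ≡ ½ * (P * p * q)
              e = solve-∀ ring
              e′ : ∀ q → q ≡ ½ * (1ℚ * q) + ½ * q
              e′ = solve-∀ ring

      δ≤1 : δ ≤ 1ℚ
      δ≤1 = ≤-trans (≤-reflexive (sym (*-identityˡ δ))) (tiny 1 (ℕ.m≤m+n 1 4009) (ℕ.s≤s ℕ.z≤n) δ≤)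

      Hv : ∀ v a → v ≤ pw (2 ℕ.+ a) → κ 8 * (Hn * v) ≤ 1ℚ
      Hv v a h = ≤-trans (*-monoʳ (κ≥0 8) (≤-trans (*-monoʳ Hn≥0 h) (≤-trans (≤-reflexive (trans (cong (Hn *_) (sym (pw-+ 1 (1 ℕ.+ a)))) (sym (*-assoc Hn (pw 1) (pw (1 ℕ.+ a))))))
          (≤-trans (*-monoˡ (pw≥0 (1 ℕ.+ a)) H-small) (≤-reflexive (*-identityˡ (pw (1 ℕ.+ a)))))))) (tiny 8 (ℕ.m≤m+n 8 4002) (ℕ.s≤s ℕ.z≤n) ≤-refl)

      HB : Hn * B + x ≤ ½
      HB = by (nonNegative⁻¹ (1 ⁄ 8) ⊗ (gap (Hv b 1997 b-hi) ⊕ gap (Hv δ 2978 δ≤)) ⊕ nonNegative⁻¹ (1 ⁄ 1000) ⊗ gap x-tiny ⊕ nonNegative⁻¹ (249 ⁄ 1000)) (e Hn b δ x)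
        where e : ∀ h b d x → ½ ≡ h * (b + d) + x + (1 ⁄ 8 * (1ℚ - κ 8 * (h * b) + (1ℚ - κ 8 * (h * d))) + 1 ⁄ 1000 * (1ℚ - κ 1000 * x) + 249 ⁄ 1000)
              e = solve-∀ ring

      m₁≥ : κ 5 + κ 2 * Hn ≤ m₁
      m₁≥ = by (κ≥0 2 ⊗ ≤-trans 1≥0 Z≥1 ⊕ κ≥0 2 ⊗ sq≥0 (Hn + 1ℚ) ⊗ Pw≥0 1020) (e Z Hn (κ 2 * ((Hn + 1ℚ) * (Hn + 1ℚ)) * Pw 1020))
        where e : ∀ z h a → κ 2 * z + κ 2 * h + a + κ 5 ≡ κ 5 + κ 2 * h + (κ 2 * z + a)
              e = solve-∀ ring

      m₁-balance : (Hn + ½) * (Hn + ½) * (Z + x) ≤ κ 4 * (x * (½ * m₁ - Z - Hn))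
      m₁-balance = ≤-trans (*-monoʳ (sq≥0 (Hn + ½)) (+-mono-≤ Z≤2 x≤1))
          (by (κ≥0 10 ⊗ x≥0 ⊕ (Hn≥0 ⊗ Hn≥0 ⊕ κ≥0 5 ⊗ Hn≥0 ⊕ nonNegative⁻¹ (13 ⁄ 4))) (trans (e x Z Hn (Pw 1020)) (trans (cong (λ z → κ 4 * ((Hn + 1ℚ) * (Hn + 1ℚ)) * z + κ 10 * x) (Pw-pw 1020)) (e′ Hn x))))
        where
        x≤1 : x ≤ 1ℚ
        x≤1 = ≤-trans (≤-reflexive (sym (*-identityˡ x))) (pw≤ 1 (ℕ.m≤m+n 1 4009) (ℕ.s≤s ℕ.z≤n))
        e : ∀ x z h P → κ 4 * (x * (½ * (κ 2 * z + κ 2 * h + κ 2 * ((h + 1ℚ) * (h + 1ℚ)) * P + κ 5) - z - h)) ≡ κ 4 * ((h + 1ℚ) * (h + 1ℚ)) * (P * x) + κ 10 * x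
        e = solve-∀ ring
        e′ : ∀ h x → κ 4 * ((h + 1ℚ) * (h + 1ℚ)) * 1ℚ + κ 10 * x ≡ (h + ½) * (h + ½) * (κ 2 + 1ℚ) + (κ 10 * x + (h * h + κ 5 * h + 13 ⁄ 4))
        e′ = solve-∀ ring

      Hn≤ : Hn ≤ Pw 1
      Hn≤ = ≤-trans (up 1 H-small) (≤-reflexive (*-identityˡ (Pw 1)))

      m₁≤S₀ : m₁ ≤ S₀
      m₁≤S₀ = ≤-trans bound (≤-trans (absorb-Pw 19 1022 (ℕ.m≤m+n 19 3991))
          (≤-trans (Pw-≤ (ℕ.m≤m+n 1023 1956)) (≤-trans (≤-reflexive (sym (Pw-cancel 2979 1020))) (*-monoˡ x≥0 N-large))))
        where
        Y = Pw 1
        Q = Pw 1020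
        e : ∀ z h Y Q → κ 19 * (Y * Y * Q) ≡ κ 2 * z + κ 2 * h + κ 2 * ((h + 1ℚ) * (h + 1ℚ)) * Q + κ 5
              + (κ 2 * (κ 2 - z) + κ 2 * (Y - h) + κ 2 * (Y - h) * (Y + h + κ 2) * Q + κ 2 * (Y - 1ℚ) * (κ 3 * Y + 1ℚ) * Q
                + κ 2 * Y * (Q - 1ℚ) + κ 2 * (Y - 1ℚ) * Y * Q + κ 9 * (Q - 1ℚ) + κ 9 * (Y - 1ℚ) * (Y + 1ℚ) * Q)
        e = solve-∀ ring
        bound : m₁ ≤ κ 19 * Pw 1022
        bound = subst (λ z → m₁ ≤ κ 19 * z) (trans (cong (_* Q) (Pw-+ 1 1)) (Pw-+ 2 1020))
          (by (κ≥0 2 ⊗ gap Z≤2 ⊕ κ≥0 2 ⊗ gap Hn≤ ⊕ κ≥0 2 ⊗ gap Hn≤ ⊗ (Pw≥0 1 ⊕ Hn≥0 ⊕ κ≥0 2) ⊗ Pw≥0 1020 ⊕ κ≥0 2 ⊗ gap (Pw≥1 1) ⊗ (κ≥0 3 ⊗ Pw≥0 1 ⊕ 1≥0) ⊗ Pw≥0 1020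
               ⊕ κ≥0 2 ⊗ Pw≥0 1 ⊗ gap (Pw≥1 1020) ⊕ κ≥0 2 ⊗ gap (Pw≥1 1) ⊗ Pw≥0 1 ⊗ Pw≥0 1020 ⊕ κ≥0 9 ⊗ gap (Pw≥1 1020) ⊕ κ≥0 9 ⊗ gap (Pw≥1 1) ⊗ (Pw≥0 1 ⊕ 1≥0) ⊗ Pw≥0 1020)
            (e Z Hn Y Q))

      B≥0 : 0ℚ ≤ B
      B≥0 = b≥0 ⊕ δ≥0

      room : 0ℚ < N - S₀ - m₁
      room = <-≤-trans (N>0 ⊗⁺ positive⁻¹ ½) (by (N≥0 ⊗ (κ≥0 2 ⊗ (nonNegative⁻¹ (1 ⁄ 1000) ⊗ gap x-tiny) ⊕ nonNegative⁻¹ (498 ⁄ 1000)) ⊕ gap m₁≤S₀) (e N x m₁))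
        where
        e : ∀ N x m → N - N * x - m ≡ N * ½ + (N * (κ 2 * (1 ⁄ 1000 * (1ℚ - κ 1000 * x)) + 498 ⁄ 1000) + (N * x - m))
        e = solve-∀ ring

      -- Raising b by δ increases N b² by at least b 2^(1020 k), which is at least 2^(-982 k) and so
      -- beats every error of order `x`. This is where the exponent of `x` has to exceed half of
      -- 2000. The 10 x is reserve for shortening N to N - S₀ - m₁.
      NB² : Z + κ 10 * x ≤ N * (B * B)
      NB² = by (gap tight ⊕ gap cost ⊕ N≥0 ⊗ (δ≥0 ⊗ δ≥0))
          (trans (e N b δ) (trans (cong (λ z → N * b * b + κ 2 * b * z + N * (δ * δ)) Nδ) (trans (cong (λ z → N * b * b + z + N * (δ * δ)) (e₁′ b (Pw 1020)))
            (e₁″ (N * b * b) (b * Pw 1020) (Hn * b + x + (κ 2 * b + ν + Hn * ν)) x (N * (δ * δ)) Z))))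
        where
        Nδ : N * δ ≡ ½ * Pw 1020
        Nδ = trans (e₂ N (Pw 1020) ν) (trans (cong (λ z → ½ * (Pw 1020 * z)) Nν) (cong (½ *_) (*-identityʳ (Pw 1020))))
          where e₂ : ∀ N P ν → N * (½ * (P * ν)) ≡ ½ * (P * (N * ν))
                e₂ = solve-∀ ring
        half-Pw : Hn + κ 2 ≤ ½ * Pw 1020
        half-Pw = ≤-trans (by (gap Hn≤ ⊕ κ≥0 2 ⊗ gap (Pw≥1 1)) (e₂ Hn (Pw 1))) (≤-trans (≤-reflexive (e₃ (Pw 1))) (*-monoʳ ½≥0 (≤-trans (absorb-Pw 6 1 (ℕ.m≤m+n 6 4004)) (Pw-≤ (ℕ.m≤m+n 2 1018)))))
          where e₂ : ∀ h P → κ 3 * P ≡ h + κ 2 + (P - h + κ 2 * (P - 1ℚ))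
                e₂ = solve-∀ ring
                e₃ : ∀ P → κ 3 * P ≡ ½ * (κ 6 * P)
                e₃ = solve-∀ ring
        Hν : Hn * ν ≤ x
        Hν = ≤-trans (*-monoʳ Hn≥0 ν≤) (≤-trans (≤-reflexive (trans (cong (Hn *_) (sym (pw-+ 1 3999))) (sym (*-assoc Hn (pw 1) (pw 3999)))))
               (≤-trans (*-monoˡ (pw≥0 3999) H-small) (≤-trans (≤-reflexive (*-identityˡ (pw 3999))) (pw-≤ (ℕ.m≤m+n 1020 2979)))))
        left : κ 11 * x + ν + Hn * ν ≤ Pw 1020 * ½ * pw 2002
        left = ≤-trans (by (gap (≤-trans ν≤ (pw-≤ (ℕ.m≤m+n 1020 2980))) ⊕ gap Hν) (e₂ x ν (Hn * ν)))
            (≤-trans (≤-trans (≤-reflexive (e₃ x)) (*-monoʳ ½≥0 (≤-trans (absorb 26 1019 (ℕ.m≤m+n 26 3984)) (pw-≤ (ℕ.m≤m+n 982 37)))))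
              (≤-reflexive (trans (trans (cong (½ *_) (trans (sym (*-identityˡ (pw 982))) (cong (_* pw 982) (sym (Pw-pw 1020))))) (e₄ (Pw 1020) (pw 1020) (pw 982))) (cong (Pw 1020 * ½ *_) (pw-+ 1020 982)))))
          where e₂ : ∀ x n h → κ 13 * x ≡ κ 11 * x + n + h + (x - n + (x - h))
                e₂ = solve-∀ ring
                e₃ : ∀ x → κ 13 * x ≡ ½ * (κ 26 * x)
                e₃ = solve-∀ ring
                e₄ : ∀ P p q → ½ * (P * p * q) ≡ P * ½ * (p * q)
                e₄ = solve-∀ ring
        e : ∀ N b d → N * ((b + d) * (b + d)) ≡ N * b * b + κ 2 * b * (N * d) + N * (d * d)
        e = solve-∀ ring
        e₁′ : ∀ b P → κ 2 * b * (½ * P) ≡ b * P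
        e₁′ = solve-∀ ring
        e₁″ : ∀ T c L x d z → T + c + d ≡ z + κ 10 * x + (T + L - z + (c - (L + κ 10 * x)) + d)
        e₁″ = solve-∀ ring
        cost : Hn * b + x + (κ 2 * b + ν + Hn * ν) + κ 10 * x ≤ b * Pw 1020
        cost = ≤-trans (≤-reflexive (e₂ Hn b x ν (Hn * ν))) (≤-trans (+-mono-≤ (*-monoˡ b≥0 half-Pw) (≤-trans left (*-monoʳ (Pw≥0 1020 ⊗ ½≥0) b-lo))) (≤-reflexive (e₃ (Pw 1020) b)))
          where e₂ : ∀ h b x ν t → h * b + x + (κ 2 * b + ν + t) + κ 10 * x ≡ (h + κ 2) * b + (κ 11 * x + ν + t)
                e₂ = solve-∀ ring
                e₃ : ∀ P b → ½ * P * b + P * ½ * b ≡ b * P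
                e₃ = solve-∀ ring

      barrier-B : Z + x ≤ B * B * (N - S₀ - m₁)
      barrier-B = by (gap NB² ⊗ small ⊕ x≥0 ⊗ (κ≥0 2 ⊗ gap Z≤2 ⊕ κ≥0 20 ⊗ (nonNegative⁻¹ (1 ⁄ 1000) ⊗ gap x-tiny) ⊕ nonNegative⁻¹ (249 ⁄ 50)) ⊕ sq≥0 B ⊗ gap m₁≤S₀) (e N B x m₁ Z)
        where
        small : 0ℚ ≤ 1ℚ - κ 2 * x
        small = ≤-trans (κ≥0 2 ⊗ (nonNegative⁻¹ (1 ⁄ 1000) ⊗ gap x-tiny) ⊕ nonNegative⁻¹ (499 ⁄ 500)) (≤-reflexive (e₁ x))
          where e₁ : ∀ x → κ 2 * (1 ⁄ 1000 * (1ℚ - κ 1000 * x)) + 499 ⁄ 500 ≡ 1ℚ - κ 2 * x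
                e₁ = solve-∀ ring
        e : ∀ N B x m z → B * B * (N - N * x - m) ≡ z + x + ((N * (B * B) - (z + κ 10 * x)) * (1ℚ - κ 2 * x)
              + x * (κ 2 * (κ 2 - z) + κ 20 * (1 ⁄ 1000 * (1ℚ - κ 1000 * x)) + 249 ⁄ 50) + B * B * (N * x - m))
        e = solve-∀ ring

      h₀>0 : 0ℚ < κ h₀
      h₀>0 = half-pos (inverse-pos b≥0 bU) h₀≥

      n≤8h₀² : N ≤ κ 8 * (κ h₀ * κ h₀)
      n≤8h₀² = ≤-trans U²-lo (≤-trans (*-monoʳ (κ≥0 2) (*-mono U≥0 (κ≥0 2 ⊗ κ≥0 h₀) h₀≥ h₀≥)) (≤-reflexive (e (κ h₀))))
        where e : ∀ h → κ 2 * (κ 2 * h * (κ 2 * h)) ≡ κ 8 * (h * h)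
              e = solve-∀ ring

      1≤4w : 1ℚ ≤ κ 4 * w
      1≤4w = ≤-trans (toWitness {a? = 1ℚ ≤? κ 4 * (499 ⁄ 1000)} _) (*-monoʳ (κ≥0 4) w≥)

      -- Stated for a general f because it serves twice: for parts ≤ θ′, to compare with the walk,
      -- and for all partitions, to bound the repetitions. The same b works for both; they differ in
      -- the tail, which vanishes in the second case.
      module Regular (f : ℕ → ℚ) (f≥0 : ∀ m → 0ℚ ≤ f m) (f-mono : ∀ m → f m ≤ f (suc m)) (f0>0 : 0ℚ < f 0)
        (upper : ∀ m → m ℕ.≤ n → κ m * f m ≤ Z * Σ< m (λ j → Σ< j f) + Hn * Σ< m f)
        (tail : ℕ → ℚ)
        (lower : ∀ m → m ℕ.≤ n → Z * Σ< m (λ j → Σ< j f) ≤ κ m * f m + Hn * Σ< m f + tail m)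
        (tail-small : ∀ m → m ℕ.≤ n → Side.Decay f f≥0 f-mono m → tail m ≤ x * Σ< m (λ j → Σ< j f)) where

        open Barriers f f≥0 f-mono f0>0 n Z Hn Z≥1 Z≤2 Hn≥0 upper
        open Upper m₁ x (pw>0 1020) m₁≥ m₁-balance
        open Lower b r x b>0 x≥0 r≥0 ρr N>0 slack balance tail lower tail-small

        w-upper : ∀ m → m ℕ.≤ n → N - S₀ ≤ κ m → f₁ m ≤ B * f₂ m
        w-upper = slope-upper B S₀ B≥0 room barrier-B

        f₂n : f₂ n ≤ κ 2 * (N * f n)
        f₂n = second-upper B HB n ℕ.≤-refl (w-upper n ℕ.≤-refl (by (<⇒≤ S₀>0) (e N S₀)))
          where e : ∀ n s → n ≡ n - s + s
                e = solve-∀ ring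

        open Window h₀ (κ 8) (κ-mono (ℕ.s≤s (ℕ.z≤n {7}))) r≤1 h₀>0 1≤4w n≤8h₀² f₂n public
        open Flat B δ S₀ δ≥0 δ≤1 ≤-refl S₀>0 S₀δ HB w-upper public

      M T : ℕ
      M = k ℕ.* 80
      T = k ℕ.* 1990

      ρ u : ℚ
      ρ = 1ℚ + b
      u = 1ℚ + U

      ρ≥0 : 0ℚ ≤ ρ
      ρ≥0 = 1≥0 ⊕ b≥0

      u>0 : 0ℚ < u
      u>0 = +-mono-<-≤ (positive⁻¹ 1ℚ) U≥0

      ur : u * r ≡ u - 1ℚ
      ur = trans (cong (λ z → (z + U) * r) (sym bU)) (trans (e b U r) (trans (cong (U *_) ρr) (e′ U)))
        where e : ∀ b U r → (b * U + U) * r ≡ U * ((1ℚ + b) * r)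
              e = solve-∀ ring
              e′ : ∀ U → U * 1ℚ ≡ 1ℚ + U - 1ℚ
              e′ = solve-∀ ring

      1≤h₀ : 1ℚ ≤ κ h₀
      1≤h₀ = κ-mono {1} (ℕ.>-nonZero⁻¹ h₀ {{h₀-nonZero}})
        where h₀-nonZero : ℕ.NonZero h₀
              h₀-nonZero = subst ℕ.NonZero (sym (proj₂ (κ-0<⁻¹ h₀>0))) _

      u≤3h₀ : u ≤ κ 3 * κ h₀
      u≤3h₀ = by (gap 1≤h₀ ⊕ gap h₀≥) (e U (κ h₀))
        where e : ∀ U h → κ 3 * h ≡ 1ℚ + U + (h - 1ℚ + (κ 2 * h - U))
              e = solve-∀ ring

      U-lo : Pw 1999 ≤ U
      U-lo = ≤-trans (≤-reflexive (sym (*-identityʳ (Pw 1999)))) (≤-trans (≤-reflexive (cong (Pw 1999 *_) (sym bU))) (≤-trans (≤-reflexive (e (Pw 1999) b U))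
               (≤-trans (*-monoˡ U≥0 (*-monoʳ (Pw≥0 1999) b-hi)) (≤-reflexive (trans (cong (_* U) (Pw-pw 1999)) (*-identityˡ U))))))
        where e : ∀ P b U → P * (b * U) ≡ P * b * U
              e = solve-∀ ring

      U-hi : U ≤ Pw 2002
      U-hi = ≤-trans (≤-reflexive (trans (sym (*-identityˡ U)) (cong (_* U) (sym (Pw-pw 2002))))) (≤-trans (*-monoˡ U≥0 (*-monoʳ (Pw≥0 2002) b-lo))
               (≤-reflexive (trans (*-assoc (Pw 2002) b U) (trans (cong (Pw 2002 *_) bU) (*-identityʳ (Pw 2002))))))

      u-hi : u ≤ Pw 2003
      u-hi = ≤-trans (by (gap (Pw≥1 2002) ⊕ gap U-hi) (e (Pw 2002) U)) (absorb-Pw 2 2002 (ℕ.m≤m+n 2 4008))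
        where e : ∀ P U → κ 2 * P ≡ 1ℚ + U + (P - 1ℚ + (P - U))
              e = solve-∀ ring

      T-small : κ T * pw 1 ≤ 1ℚ
      T-small = ≤-trans (*-monoˡ (pw≥0 1) (κ-mono (subst (ℕ._≤ 1990 ℕ.* suc k) (ℕ.*-comm 1990 k) (ℕ.*-monoʳ-≤ 1990 (ℕ.n≤1+n k))))) (linear-small 1990 (ℕ.m≤m+n 1990 2020))

      levels : suc θ′ ℕ.+ M ℕ.* (12 ℕ.* h₀) ≡ T ℕ.* h₀
      levels = trans (cong (ℕ._+ M ℕ.* (12 ℕ.* h₀)) (trans G≡ (cong (ℕ._* h₀) G-def))) (e k 1030 80 12 h₀)
        where e : ∀ k a b c h → k ℕ.* a ℕ.* h ℕ.+ k ℕ.* b ℕ.* (c ℕ.* h) ≡ k ℕ.* (a ℕ.+ b ℕ.* c) ℕ.* h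
              e = ℕ.solve-∀

      levels≤n : suc θ′ ℕ.+ M ℕ.* (12 ℕ.* h₀) ℕ.≤ n
      levels≤n = κ-cancel-≤ (subst (_≤ N) (sym (trans (cong κ levels) (κ-* T h₀)))
        (≤-trans (*-mono (κ≥0 T) (≤-trans (κ≥0 h₀) h₀≤) (≤-trans (up {κ T} 1 T-small) (≤-reflexive (*-identityˡ (Pw 1)))) h₀≤)
          (≤-trans (*-monoʳ (Pw≥0 1) u-hi) (≤-trans (≤-reflexive (Pw-+ 1 2003)) (≤-trans (Pw-≤ (ℕ.m≤m+n 2004 1995)) N-large)))))

      θ′≤n : θ′ ℕ.≤ n
      θ′≤n = ℕ.≤-trans (ℕ.n≤1+n θ′) (ℕ.≤-trans (ℕ.m≤m+n (suc θ′) (M ℕ.* (12 ℕ.* h₀))) levels≤n)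

      f-pos : ∀ N → 0ℚ < f N 0
      f-pos N = subst (0ℚ <_) (sym (f-zero N)) (positive⁻¹ 1ℚ)

      module Bulk = Regular (f θ′) (f≥0 θ′) (f-mono θ″) (f-pos θ′) (λ m l → Level.cells-upper θ″ n m l θ′≤n)
        (Side.tail-θ (f θ′) (f≥0 θ′) (f-mono θ″)) (λ m l → Level.cells-lower θ″ n m l θ′≤n) (Side.tail-θ-small (f θ′) (f≥0 θ′) (f-mono θ″))

      module Whole = Regular (f n) (f≥0 n) (f-mono n′) (f-pos n) (λ m l → Level.cells-upper n′ n m l ℕ.≤-refl)
        (Side.tail-n (f n) (f≥0 n) (f-mono n′)) (λ m l → Level.cells-lower n′ n m l ℕ.≤-refl) (Side.tail-n-small (f n) (f≥0 n) (f-mono n′))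

      open Distinct θ′

      y : ℕ → ℚ
      y i = r ^ part i

      r>0 : 0ℚ < r
      r>0 = <-≤-trans (positive⁻¹ (999 ⁄ 1000)) r≥

      y>0 : ∀ i → 0ℚ < y i
      y>0 i = ^>0 (part i) r>0

      y≥0 : ∀ i → 0ℚ ≤ y i
      y≥0 i = <⇒≤ (y>0 i)

      y-+ : ∀ i j → y (i ℕ.+ j) ≡ r ^ i * y j
      y-+ i j = trans (cong (r ^_) (trans (cong suc (ℕ.+-assoc i j θ′)) (sym (ℕ.+-suc i (j ℕ.+ θ′))))) (^-+ r i (part j))

      y≤ : ∀ i → y i ≤ pw 1030
      y≤ i = ≤-trans (^-antimonoʳ r≥0 r≤1 (ℕ.s≤s (ℕ.m≤n+m θ′ i))) w^G

      y-small : ∀ i → y i ≤ 1 ⁄ 300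
      y-small i = *-cancelˡ (positive⁻¹ (κ 300)) (≤-trans (*-monoʳ (κ≥0 300) (y≤ i)) (pw≤ 300 (ℕ.m≤m+n 300 3710) (ℕ.s≤s ℕ.z≤n)))

      -- The law of the difference of two independent bits with odds y : 1.
      weight : ∀ v → 0ℚ ≤ v → ∃ λ π → 0ℚ ≤ π × κ 2 * π ≤ 1ℚ × (1ℚ + v) * (1ℚ + v) * π ≡ v
      weight v v≥0 = v * (c * c) , v≥0 ⊗ (c≥0 ⊗ c≥0) , by ((1≥0 ⊕ v≥0 ⊗ v≥0) ⊗ (c≥0 ⊗ c≥0)) (trans (sym one) (e v c)) , trans (e′ v c) (trans (cong (v *_) one) (*-identityʳ v))
        where
        i = inv (+-mono-<-≤ (positive⁻¹ 1ℚ) v≥0)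
        c = proj₁ i
        c≥0 = <⇒≤ (proj₁ (proj₂ i))
        one : (1ℚ + v) * c * ((1ℚ + v) * c) ≡ 1ℚ
        one = trans (cong₂ _*_ (proj₂ (proj₂ i)) (proj₂ (proj₂ i))) (*-identityˡ 1ℚ)
        e : ∀ v c → (1ℚ + v) * c * ((1ℚ + v) * c) ≡ κ 2 * (v * (c * c)) + (1ℚ + v * v) * (c * c)
        e = solve-∀ ring
        e′ : ∀ v c → (1ℚ + v) * (1ℚ + v) * (v * (c * c)) ≡ v * ((1ℚ + v) * c * ((1ℚ + v) * c))
        e′ = solve-∀ ring

      π : ℕ → ℚ
      π i = proj₁ (weight (y i) (y≥0 i))
      π≥0 : ∀ i → 0ℚ ≤ π i
      π≥0 i = proj₁ (proj₂ (weight (y i) (y≥0 i)))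
      π≤½ : ∀ i → κ 2 * π i ≤ 1ℚ
      π≤½ i = proj₁ (proj₂ (proj₂ (weight (y i) (y≥0 i))))
      π-def : ∀ i → (1ℚ + y i) * (1ℚ + y i) * π i ≡ y i
      π-def i = proj₂ (proj₂ (proj₂ (weight (y i) (y≥0 i))))

      module S = Scales r ρ u r≥0 r≤1 ρ≥0 ρr u>0 ur h₀ h₀>0 u≤3h₀ half w≥ y y>0 y-+ y-small π π≥0 π≤½ π-def

      -- Rounding h₀ up costs a factor r in each half-life, so w ≥ r / 2. Over the T half-lives up
      -- to the top block this loses only r^T ≥ 1 - T b ≥ 1/2.
      thick : ∀ j → j ℕ.< M → κ 1600 ≤ y (j ℕ.* (12 ℕ.* h₀)) * u
      thick j l = ≤-trans large (*-mono (½≥0 ⊗ pw≥0 1990) (<⇒≤ u>0) low (≤-trans U-lo (by 1≥0 (+-comm 1ℚ U))))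
        where
        Tb : κ T * b ≤ ½
        Tb = ≤-trans (*-monoʳ (κ≥0 T) b-hi) (≤-trans (≤-reflexive (trans (cong (κ T *_) (sym (pw-+ 1 1998))) (sym (*-assoc (κ T) (pw 1) (pw 1998)))))
              (≤-trans (*-monoˡ (pw≥0 1998) T-small) (≤-trans (≤-reflexive (e (pw 1998))) (≤-trans (*-monoʳ ½≥0 (pw≤ 2 (ℕ.m≤m+n 2 4008) (ℕ.s≤s ℕ.z≤n))) (≤-reflexive (*-identityʳ ½))))))
          where e : ∀ p → 1ℚ * p ≡ ½ * (κ 2 * p)
                e = solve-∀ ring
        r^T : ½ ≤ r ^ T
        r^T = ≤-trans (by (gap Tb) (e (κ T * b))) (≤-trans (bernoulli⁻ b T b≥0 b≤1) (^-monoˡ T (gap b≤1) r≥1-b))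
          where e : ∀ a → 1ℚ - a ≡ ½ + (½ - a)
                e = solve-∀ ring
        half-r : ½ * r ≤ w
        half-r = by (½≥0 ⊗ gap half⁻) (e r w)
          where e : ∀ r w → w ≡ ½ * r + ½ * (κ 2 * w - r)
                e = solve-∀ ring
        low : ½ * pw 1990 ≤ y (j ℕ.* (12 ℕ.* h₀))
        low = ≤-trans (*-monoˡ (pw≥0 1990) r^T) (≤-trans (≤-reflexive (trans (*-comm (r ^ T) (pw 1990)) (sym (*-^ ½ r T)))) (≤-trans (^-monoˡ T (½≥0 ⊗ r≥0) half-r)
                (≤-trans (≤-reflexive (trans (sym (^-* r T h₀)) (cong (r ^_) (sym levels))))
                  (^-antimonoʳ r≥0 r≤1 (ℕ.s≤s (ℕ.≤-trans (ℕ.≤-reflexive (ℕ.+-comm (j ℕ.* (12 ℕ.* h₀)) θ′)) (ℕ.+-monoʳ-≤ θ′ (ℕ.*-monoˡ-≤ (12 ℕ.* h₀) (ℕ.<⇒≤ l)))))))))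
        large : κ 1600 ≤ ½ * pw 1990 * Pw 1999
        large = ≤-trans (≤-trans (≤-reflexive (trans (e (κ 1600)) (cong (λ z → ½ * z) (sym (κ-* 2 1600))))) (*-monoʳ ½≥0 (≤-trans (up {κ 3200} 1 (const-small 3200 (ℕ.m≤m+n 3200 810))) (≤-trans (≤-reflexive (*-identityˡ (Pw 1))) (Pw-≤ (ℕ.m≤m+n 1 8))))))
                  (≤-reflexive (trans (cong (½ *_) (sym (Pw-cancel 9 1990))) (e₁ (Pw 1999) (pw 1990))))
          where e : ∀ c → c ≡ ½ * (κ 2 * c)
                e = solve-∀ ring
                e₁ : ∀ P p → ½ * (P * p) ≡ ½ * p * P
                e₁ = solve-∀ ring

      K l₀ : ℕ
      K  = n ℕ.∸ θ′
      l₀ = K ℕ.∸ M ℕ.* (12 ℕ.* h₀)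

      n≡ : n ≡ K ℕ.+ θ′
      n≡ = sym (ℕ.m∸n+n≡m θ′≤n)

      K≡ : K ≡ l₀ ℕ.+ M ℕ.* (12 ℕ.* h₀)
      K≡ = sym (ℕ.m∸n+n≡m (ℕ.≤-trans (ℕ.≤-reflexive (sym (ℕ.m+n∸m≡n θ′ _))) (ℕ.∸-monoˡ-≤ θ′ (ℕ.≤-trans (ℕ.n≤1+n _) levels≤n))))

      survival : Walk.value π π≥0 π≤½ K 0ℚ 0ℚ ≤ κ 2 * θ ^ M
      survival = subst (λ i → Walk.value π π≥0 π≤½ i 0ℚ 0ℚ ≤ κ 2 * θ ^ M) (sym K≡) (S.survival M thick l₀)

      q : ℚ
      q = f θ′ n

      q≥0 : 0ℚ ≤ q
      q≥0 = f≥0 θ′ n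

      module Mθ = Mass θ′ y y≥0

      wt : ℕ → ℚ
      wt m = κ 32 * κ 8 * q * r ^ (n ℕ.∸ m)

      drop : ∀ i m → part i ℕ.+ m ℕ.≤ n → n ℕ.∸ m ℕ.∸ (n ℕ.∸ (part i ℕ.+ m)) ≡ part i
      drop i m l = trans (cong (ℕ._∸ (n ℕ.∸ (part i ℕ.+ m))) (trans (cong (ℕ._∸ m) (sym (ℕ.m∸n+n≡m l))) (trans (ℕ.+-∸-assoc (n ℕ.∸ (part i ℕ.+ m)) {part i ℕ.+ m} (ℕ.m≤n+m m (part i))) (cong (n ℕ.∸ (part i ℕ.+ m) ℕ.+_) (ℕ.m+n∸n≡m (part i) m))))) (ℕ.m+n∸m≡n (n ℕ.∸ (part i ℕ.+ m)) (part i))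

      module Upper = Mθ.UpperMass n wt (λ m → κ≥0 32 ⊗ κ≥0 8 ⊗ q≥0 ⊗ ^≥0 (n ℕ.∸ m) r≥0)
        (λ i m l → ≤-reflexive (trans (cong (κ 32 * κ 8 * q *_) (trans (cong (r ^_) (sym (ℕ.m+[n∸m]≡n {n ℕ.∸ (part i ℕ.+ m)} {n ℕ.∸ m} (ℕ.∸-monoʳ-≤ n (ℕ.m≤n+m m (part i)))))) (trans (^-+ r (n ℕ.∸ (part i ℕ.+ m)) _) (cong (λ z → r ^ (n ℕ.∸ (part i ℕ.+ m)) * r ^ z) (drop i m l)))))
                    (sym (*-assoc (κ 32 * κ 8 * q) (r ^ (n ℕ.∸ (part i ℕ.+ m))) (y i)))))
        (λ m l → Bulk.f-decay m (n ℕ.∸ m) (ℕ.m+[n∸m]≡n l))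
        π π≥0 π≤½ π-def

      module Gr = Geometric r u r≥0 (<⇒≤ u>0) ur

      y-base : ∀ i → y i ≡ r ^ i * r ^ suc θ′
      y-base i = trans (cong (r ^_) (sym (ℕ.+-suc i θ′))) (^-+ r i (suc θ′))

      θ≤ : κ (suc θ′) ≤ Pw 1 * u
      θ≤ = ≤-trans (≤-reflexive (trans (cong κ G≡) (κ-* G h₀))) (*-mono (κ≥0 G) (<⇒≤ u>0) (≤-trans (up {κ G} 1 G-small) (≤-reflexive (*-identityˡ (Pw 1)))) h₀≤)

      u²≤ : u * u ≤ κ 32 * N
      u²≤ = ≤-trans (*-mono (<⇒≤ u>0) (κ≥0 2 ⊗ U≥0) double double) (by (κ≥0 4 ⊗ gap U²-hi) (e U N))
        where
        double : u ≤ κ 2 * U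
        double = by (gap (≤-trans (Pw≥1 1999) U-lo)) (e₁ U)
          where e₁ : ∀ U → κ 2 * U ≡ 1ℚ + U + (U - 1ℚ)
                e₁ = solve-∀ ring
        e : ∀ U N → κ 32 * N ≡ κ 2 * U * (κ 2 * U) + κ 4 * (κ 8 * N - U * U)
        e = solve-∀ ring

      -- Up to constants the mean is r^θ′ (θ′ u + u²), hence of order 2^(-1030 k) N times
      -- logarithmic factors. The room between 1030 and 1020 puts it inside half of the window.
      mean : Mθ.μ K ≤ ½ * S₀
      mean = ≤-trans (≤-reflexive (trans (Σ<-cong K (λ i _ → trans (cong₂ _*_ (trans (cong κ (sym (ℕ.+-suc i θ′))) (κ-+ i (suc θ′))) (y-base i)) (e (κ i) (κ (suc θ′)) (r ^ i) (r ^ suc θ′)))) (Σ<-* K (r ^ suc θ′) (λ i → r ^ i * (κ i + κ (suc θ′))))))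
        (≤-trans (*-mono (^≥0 (suc θ′) r≥0) (≤-trans (κ≥0 (suc θ′) ⊗ <⇒≤ u>0 ⊕ <⇒≤ u>0 ⊗ <⇒≤ u>0) bound) w^G (≤-trans (Gr.Σ-linear (κ (suc θ′)) K (κ≥0 (suc θ′))) bound)) final)
        where
        e : ∀ i t x y → (i + t) * (x * y) ≡ y * (x * (i + t))
        e = solve-∀ ring
        bound : κ (suc θ′) * u + u * u ≤ κ 64 * (Pw 1 * N)
        bound = ≤-trans (by (gap θ≤ ⊗ <⇒≤ u>0 ⊕ gap (Pw≥1 1) ⊗ (<⇒≤ u>0 ⊗ <⇒≤ u>0)) (e₁ (κ (suc θ′)) u (Pw 1)))
                  (≤-trans (*-monoʳ (κ≥0 2 ⊗ Pw≥0 1) u²≤) (≤-reflexive (e₂ (Pw 1) N)))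
          where e₁ : ∀ t u P → κ 2 * P * (u * u) ≡ t * u + u * u + ((P * u - t) * u + (P - 1ℚ) * (u * u))
                e₁ = solve-∀ ring
                e₂ : ∀ P N → κ 2 * P * (κ 32 * N) ≡ κ 64 * (P * N)
                e₂ = solve-∀ ring
        final : pw 1030 * (κ 64 * (Pw 1 * N)) ≤ ½ * S₀
        final = ≤-trans (≤-reflexive (trans (cong (_* (κ 64 * (Pw 1 * N))) (sym (pw-+ 1 1029))) (trans (e₃ (pw 1) (pw 1029) (Pw 1) N) (cong (λ z → ½ * (N * (z * (κ 128 * pw 1029)))) (Pw-pw 1)))))
                  (*-monoʳ ½≥0 (*-monoʳ N≥0 (≤-trans (≤-reflexive (*-identityˡ (κ 128 * pw 1029))) (≤-trans (absorb 128 1028 (ℕ.m≤m+n 128 3882)) (pw-≤ (ℕ.m≤m+n 1020 8))))))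
          where e₃ : ∀ p q P N → p * q * (κ 64 * (P * N)) ≡ ½ * (N * (P * p * (κ 128 * q)))
                e₃ = solve-∀ ring

      S₀≤N : S₀ ≤ N
      S₀≤N = ≤-trans (*-monoʳ N≥0 (≤-trans (≤-reflexive (sym (*-identityˡ x))) (pw≤ 1 (ℕ.m≤m+n 1 4009) (ℕ.s≤s ℕ.z≤n)))) (≤-reflexive (*-identityʳ N))

      module Low = Mθ.LowerMass n r q (κ 12 * S₀) S₀ q≥0 r≥0 (κ≥0 12 ⊗ <⇒≤ S₀>0) S₀≤N (λ _ → refl)
        (λ m i mi → ≤-trans (Bulk.f-flat m i mi) (≤-reflexive (sym (*-assoc (κ 12) S₀ (f θ′ m)))))

      pn : ℚ
      pn = κ (p n)

      pn≥0 : 0ℚ ≤ pn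
      pn≥0 = κ≥0 (p n)

      total-lower : q * Mθ.Z K ≤ κ 24 * g K n
      total-lower = *-cancelˡ S₀>0 (≤-trans (by (κ≥0 2 ⊗ (q≥0 ⊗ Mθ.Z≥0 K) ⊗ gap mean) (e q (Mθ.Z K) S₀ (Mθ.μ K)))
          (≤-trans (*-monoʳ (κ≥0 2) (Low.mass-lower K n 0 (ℕ.+-identityʳ n))) (≤-reflexive (e₁ S₀ (g K n)))))
        where e : ∀ q z S m → κ 2 * (q * 1ℚ * z * (S - 0ℚ - m)) ≡ S * (q * z) + κ 2 * (q * z) * (½ * S - m)
              e = solve-∀ ring
              e₁ : ∀ S g → κ 2 * (κ 12 * S * g) ≡ S * (κ 24 * g)
              e₁ = solve-∀ ring

      module Pn = Pairs n

      g≤p : g K n ≤ pn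
      g≤p = Pn.distinct≤p θ′ K n≡

      -- Removing two copies of v costs r^(2 v) ≤ r^i 2^(-2060 k), with i the index of v. The
      -- geometric series contributes at most u ≤ 2^(2003 k), leaving 2^(-57 k).
      repeats : pn - g K n ≤ κ 32 * κ 8 * pn * pw 57
      repeats = ≤-trans (by (gap (subst (λ a → f a n ≤ g K n + Σ< K (λ i → sh (part i ℕ.+ part i) (f a) n)) (sym n≡) (repeated K n))) (trans (e pn (g K n) (Σ< K (λ i → sh (part i ℕ.+ part i) (f n) n))) (cong (λ z → pn - g K n + (g K n + Σ< K (λ i → sh (part i ℕ.+ part i) (f n) n) - z)) Pn.p≡f)))
        (≤-trans (Σ<-mono K {g = λ i → κ 32 * κ 8 * pn * pw 2060 * r ^ i} (λ i _ → term i (ℕ-split n (part i ℕ.+ part i))))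
        (≤-trans (≤-reflexive (Σ<-* K (κ 32 * κ 8 * pn * pw 2060) (λ i → r ^ i)))
        (≤-trans (*-monoʳ (κ≥0 32 ⊗ κ≥0 8 ⊗ pn≥0 ⊗ pw≥0 2060) (≤-trans (Gr.Σ-geometric-≤ K) u-hi))
          (≤-reflexive (trans (cong (λ z → κ 32 * κ 8 * pn * z * Pw 2003) (sym (pw-+ 57 2003))) (trans (e₁ (κ 32 * κ 8 * pn) (pw 57) (pw 2003) (Pw 2003)) (trans (cong (λ z → κ 32 * κ 8 * pn * pw 57 * z) (Pw-pw 2003)) (*-identityʳ _))))))))
        where
        e : ∀ p g s → s ≡ p - g + (g + s - p)
        e = solve-∀ ring
        e₁ : ∀ c a b P → c * (a * b) * P ≡ c * a * (P * b)
        e₁ = solve-∀ ring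
        c≥0 = κ≥0 32 ⊗ κ≥0 8 ⊗ pn≥0
        term : ∀ i → n ℕ.< part i ℕ.+ part i ⊎ (∃ λ m → n ≡ part i ℕ.+ part i ℕ.+ m) → sh (part i ℕ.+ part i) (f n) n ≤ κ 32 * κ 8 * pn * pw 2060 * r ^ i
        term i (inj₁ l) = ≤-trans (≤-reflexive (sh-miss (part i ℕ.+ part i) (f n) n l)) (c≥0 ⊗ pw≥0 2060 ⊗ ^≥0 i r≥0)
        term i (inj₂ (m , eq)) = ≤-trans (≤-reflexive (trans (cong (sh (part i ℕ.+ part i) (f n)) eq) (sh-hit (part i ℕ.+ part i) (f n) m)))
          (≤-trans (Whole.f-decay m (part i ℕ.+ part i) (trans (ℕ.+-comm m (part i ℕ.+ part i)) (sym eq)))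
          (≤-trans (≤-reflexive (trans (cong₂ (λ a b → κ 32 * κ 8 * a * b) (sym Pn.p≡f) (trans (^-+ r (part i) (part i)) (cong (_* y i) (y-base i)))) (e₂ (κ 32 * κ 8 * pn) (r ^ i) (r ^ suc θ′) (y i))))
          (≤-trans (*-monoʳ (c≥0 ⊗ ^≥0 i r≥0) (*-mono (^≥0 (suc θ′) r≥0) (pw≥0 1030) w^G (y≤ i)))
            (≤-reflexive (trans (cong (λ z → κ 32 * κ 8 * pn * r ^ i * z) (pw-+ 1030 1030)) (e₃ (κ 32 * κ 8 * pn) (r ^ i) (pw 2060)))))))
          where e₂ : ∀ c a b d → c * (a * b * d) ≡ c * a * (b * d)
                e₂ = solve-∀ ring
                e₃ : ∀ c a b → c * a * b ≡ c * b * a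
                e₃ = solve-∀ ring

      θ^M≥ : pw 56 ≤ θ ^ M
      θ^M≥ = ≤-trans (pw-≤ (ℕ.m≤m+n 40 16)) (≤-trans (^-monoˡ (k ℕ.* 40) ½≥0 (toWitness {a? = ½ ≤? θ ^ 2} _)) (≤-reflexive (trans (sym (^-* θ (k ℕ.* 40) 2)) (cong (θ ^_) (ℕ.*-assoc k 40 2)))))

      -- The unknown normalisation cancels: the upper bound contains (q Z)², and the lower bound for
      -- the number of partitions with distinct large parts gives q Z ≤ 24 p. The summand 1 in the
      -- constant pays for the repetitions.
      pairs-upper : κ (dominatedPairs n) ≤ (κ 2 * (κ 32 * κ 8 * κ 24 * (κ 32 * κ 8 * κ 24)) + 1ℚ) * (pn * pn) * θ ^ M
      pairs-upper = ≤-trans (Pn.dominated-split θ′ K n≡)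
        (≤-trans (+-mono-≤ (≤-trans (Upper.mass-upper K n n 0ℚ 0ℚ ℕ.≤-refl ℕ.≤-refl (Upper.ind-compatible K))
                       (≤-trans (*-monoʳ (wt-nn ⊗ (Mθ.Z≥0 K ⊗ Mθ.Z≥0 K)) survival) main))
                   rep)
          (≤-reflexive (e (κ 32 * κ 8 * κ 24) pn (θ ^ M))))
        where
        t≥0 = ^≥0 M θ≥0
        wt-n : wt n ≡ κ 32 * κ 8 * q
        wt-n = trans (cong (λ z → κ 32 * κ 8 * q * r ^ z) (ℕ.n∸n≡0 n)) (*-identityʳ (κ 32 * κ 8 * q))
        wt-nn : 0ℚ ≤ wt n * wt n
        wt-nn = sq≥0 (wt n)
        qZ : q * Mθ.Z K ≤ κ 24 * pn
        qZ = ≤-trans total-lower (*-monoʳ (κ≥0 24) g≤p)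
        main : wt n * wt n * (Mθ.Z K * Mθ.Z K) * (κ 2 * θ ^ M) ≤ (κ 32 * κ 8 * κ 24 * pn) * (κ 32 * κ 8 * κ 24 * pn) * (κ 2 * θ ^ M)
        main = *-monoˡ (κ≥0 2 ⊗ t≥0) (≤-trans (≤-reflexive (trans (cong (λ z → z * z * (Mθ.Z K * Mθ.Z K)) wt-n) (e₁ (κ 32 * κ 8) q (Mθ.Z K))))
                 (≤-trans (*-mono (κ≥0 32 ⊗ κ≥0 8 ⊗ (q≥0 ⊗ Mθ.Z≥0 K)) (κ≥0 32 ⊗ κ≥0 8 ⊗ (κ≥0 24 ⊗ pn≥0)) (*-monoʳ (κ≥0 32 ⊗ κ≥0 8) qZ) (*-monoʳ (κ≥0 32 ⊗ κ≥0 8) qZ))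
                   (≤-reflexive (cong (λ z → z * z) (sym (*-assoc (κ 32 * κ 8) (κ 24) pn))))))
          where e₁ : ∀ c q z → c * q * (c * q) * (z * z) ≡ c * (q * z) * (c * (q * z))
                e₁ = solve-∀ ring
        rep : κ 2 * pn * (pn - g K n) ≤ pn * pn * θ ^ M
        rep = ≤-trans (*-monoʳ (κ≥0 2 ⊗ pn≥0) repeats) (≤-trans (≤-reflexive (e₂ pn (pw 57)))
                (*-monoʳ (pn≥0 ⊗ pn≥0) (≤-trans (absorb 512 56 (ℕ.m≤m+n 512 3498)) θ^M≥)))
          where e₂ : ∀ p a → κ 2 * p * (κ 32 * κ 8 * p * a) ≡ p * p * (κ 512 * a)
                e₂ = solve-∀ ring
        e : ∀ c a t → c * a * (c * a) * (κ 2 * t) + a * a * t ≡ (κ 2 * (c * c) + 1ℚ) * (a * a) * t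
        e = solve-∀ ring

-- Choosing the slope and the half-life by integer search.

module Parameters where

  open import Data.Nat as ℕ using (ℕ; suc)
  import Data.Nat.Properties as ℕ
  import Data.Nat.Tactic.RingSolver as ℕ
  open import Data.Rational
  open import Data.Rational.Properties
  open import Data.Product using (_×_; _,_; ∃; proj₁; proj₂)
  open import Relation.Nullary using (¬_)
  open import Relation.Nullary.Decidable using (toWitness)
  open import Relation.Binary.PropositionalEquality using (_≡_; refl; sym; trans; cong; cong₂; subst; subst₂)
  open import Tactic.RingSolver using (solve-∀)
  open import Defs using (p; dominatedPairs)
  open Rationals
  open CellSums using (ζ; H)
  open Riccati using (½≥0)
  open Comparison using (θ)
  open Magnitudes

  constant : ℚ
  constant = κ 2 * (κ 32 * κ 8 * κ 24 * (κ 32 * κ 8 * κ 24)) + 1ℚ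

  Bound : ℕ → ℕ → Set
  Bound k n = κ (dominatedPairs n) ≤ constant * (κ (p n) * κ (p n)) * θ ^ (k ℕ.* 80)

  module Choice (k : ℕ) (k-large : 4010 ℕ.≤ k) (n′ : ℕ) (lo : 2 ℕ.^ (k ℕ.* 4000) ℕ.≤ suc n′) (hi : suc n′ ℕ.≤ 2 ℕ.^ (k ℕ.* 4001)) where
    open Powers k k-large

    n : ℕ
    n = suc n′
    N Z Hn x : ℚ
    N  = κ n
    Z  = ζ n
    Hn = H n
    x  = pw 1020

    N≥ : Pw 4000 ≤ N
    N≥ = subst (_≤ N) (κ-^ 2 (k ℕ.* 4000)) (κ-mono lo)

    N≤ : N ≤ Pw 4001
    N≤ = subst (N ≤_) (κ-^ 2 (k ℕ.* 4001)) (κ-mono hi)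

    N>0 : 0ℚ < N
    N>0 = κ>0 n′

    N≥0 : 0ℚ ≤ N
    N≥0 = κ≥0 n

    n-lo : 1ℚ ≤ N * pw 4000
    n-lo = ≤-trans (≤-reflexive (sym (Pw-pw 4000))) (*-monoˡ (pw≥0 4000) N≥)

    n-hi : N * pw 4001 ≤ 1ℚ
    n-hi = ≤-trans (*-monoˡ (pw≥0 4001) N≤) (≤-reflexive (Pw-pw 4001))

    Hn≥0 : 0ℚ ≤ Hn
    Hn≥0 = H≥0 n

    H-small : Hn * pw 1 ≤ 1ℚ
    H-small = ≤-trans (*-monoˡ (pw≥0 1) (≤-trans (H-mono hi) (≤-trans (H-pow (k ℕ.* 4001)) (κ-mono (linear 4001 4010 (ℕ.s≤s ℕ.z≤n) (ℕ.m≤m+n 4001 9))))))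
               (linear-small 4010 ℕ.≤-refl)
      where
      linear : ∀ a c → 1 ℕ.≤ c → a ℕ.≤ c → suc (k ℕ.* a) ℕ.≤ c ℕ.* suc k
      linear a c 1≤c a≤c = ℕ.≤-trans (ℕ.+-mono-≤ 1≤c (ℕ.*-monoʳ-≤ k a≤c)) (ℕ.≤-reflexive (ℕ.*-comm (suc k) c))

    Hn≤ : Hn ≤ Pw 1
    Hn≤ = ≤-trans (up 1 H-small) (≤-reflexive (*-identityˡ (Pw 1)))

    x≥0 : 0ℚ ≤ x
    x≥0 = pw≥0 1020

    x-small : κ 16 * x ≤ 1ℚ
    x-small = pw≤ 16 (ℕ.m≤m+n 16 3994) (ℕ.s≤s ℕ.z≤n)

    Z≥1 = ζ≥1 n′
    Z≤2 = ζ≤2 n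

    N-big : ∀ c a → c ℕ.≤ 4010 → a ℕ.≤ 3999 → κ c * Pw a ≤ N
    N-big c a lc la = ≤-trans (absorb-Pw c a lc) (≤-trans (Pw-≤ (ℕ.s≤s la)) N≥)

    -- Divided by N, with b = m / N, this is the balance N b² + H b + x ≤ Z. The root of the
    -- quadratic is thus rounded down to a multiple of 1 / N, and failure at the successor yields
    -- `tight`.
    Fits : ℕ → Set
    Fits m = κ m * κ m + Hn * κ m + x * N ≤ Z * N

    fits-0 : Fits 0
    fits-0 = by (gap Z≥1 ⊗ N≥0 ⊕ (nonNegative⁻¹ (1 ⁄ 16) ⊗ gap x-small ⊕ nonNegative⁻¹ (15 ⁄ 16)) ⊗ N≥0) (e Hn x N Z)
      where e : ∀ h x N Z → Z * N ≡ 0ℚ * 0ℚ + h * 0ℚ + x * N + ((Z - 1ℚ) * N + (1 ⁄ 16 * (1ℚ - κ 16 * x) + 15 ⁄ 16) * N)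
            e = solve-∀ ring

    N≥4 : κ 4 ≤ N
    N≥4 = ≤-trans (≤-trans (≤-reflexive (sym (*-identityʳ (κ 4)))) (*-monoʳ (κ≥0 4) (Pw≥1 1))) (N-big 4 1 (ℕ.m≤m+n 4 4006) (ℕ.s≤s ℕ.z≤n))

    ¬fits-n : ¬ Fits n
    ¬fits-n h = <-irrefl refl (<-≤-trans (N>0 ⊗⁺ positive⁻¹ (κ 2)) (by (gap h ⊕ gap Z≤2 ⊗ N≥0 ⊕ Hn≥0 ⊗ N≥0 ⊕ x≥0 ⊗ N≥0 ⊕ gap N≥4 ⊗ N≥0) (e Hn x N Z)))
      where e : ∀ h x N Z → 0ℚ ≡ N * κ 2 + (Z * N - (N * N + h * N + x * N) + (κ 2 - Z) * N + h * N + x * N + (N - κ 4) * N)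
            e = solve-∀ ring

    found : ∃ λ m → m ℕ.< n × Fits m × ¬ Fits (suc m)
    found = last-true Fits (λ m → κ m * κ m + Hn * κ m + x * N ≤? Z * N) fits-0 n ¬fits-n

    module WithSlope (β : ℕ) (fits : Fits β) (¬fits : ¬ Fits (suc β)) where

      over : Z * N ≤ (κ β + 1ℚ) * (κ β + 1ℚ) + Hn * (κ β + 1ℚ) + x * N
      over = subst (λ z → Z * N ≤ z * z + Hn * z + x * N) (+-comm 1ℚ (κ β)) (<⇒≤ (≰⇒> ¬fits))

      -- Failure at β + 1 bounds (β + 1)² + H (β + 1) from below by (Z - x) N; as H² is far smaller
      -- than N, a quarter of N remains for β².
      N≤4β² : N ≤ κ 4 * (κ β * κ β)
      N≤4β² = by (κ≥0 4 ⊗ (nonNegative⁻¹ (1 ⁄ 3) ⊗ (gap over ⊕ gap Z≥1 ⊗ N≥0 ⊕ ½≥0 ⊗ sq≥0 (κ β + 1ℚ - Hn) ⊕ nonNegative⁻¹ (3 ⁄ 2) ⊗ sq≥0 (κ β - 1ℚ) ⊕ nonNegative⁻¹ (1 ⁄ 16) ⊗ gap x-small ⊗ N≥0 ⊕ gap small ⊕ nonNegative⁻¹ (1 ⁄ 16) ⊗ N≥0)))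
          (e (κ β) Hn x N Z)
        where
        small : κ 3 + ½ * (Hn * Hn) ≤ 1 ⁄ 8 * N
        small = ≤-trans (≤-trans (by (κ≥0 3 ⊗ gap (Pw≥1 2) ⊕ ½≥0 ⊗ gap HH) (e₁ (Pw 2) (Hn * Hn))) (≤-reflexive (e₂ (Pw 2)))) (*-monoʳ (nonNegative⁻¹ (1 ⁄ 8)) (N-big 28 2 (ℕ.m≤m+n 28 3982) (ℕ.m≤m+n 2 3997)))
          where HH : Hn * Hn ≤ Pw 2
                HH = ≤-trans (*-mono Hn≥0 (Pw≥0 1) Hn≤ Hn≤) (≤-reflexive (Pw-+ 1 1))
                e₁ : ∀ P h → 7 ⁄ 2 * P ≡ κ 3 + ½ * h + (κ 3 * (P - 1ℚ) + ½ * (P - h))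
                e₁ = solve-∀ ring
                e₂ : ∀ P → 7 ⁄ 2 * P ≡ 1 ⁄ 8 * (κ 28 * P)
                e₂ = solve-∀ ring
        e : ∀ b h x N Z → κ 4 * (b * b) ≡ N + κ 4 * (1 ⁄ 3 * (((b + 1ℚ) * (b + 1ℚ) + h * (b + 1ℚ) + x * N - Z * N) + (Z - 1ℚ) * N + ½ * ((b + 1ℚ - h) * (b + 1ℚ - h)) + 3 ⁄ 2 * ((b - 1ℚ) * (b - 1ℚ)) + 1 ⁄ 16 * (1ℚ - κ 16 * x) * N + (1 ⁄ 8 * N - (κ 3 + ½ * (h * h))) + 1 ⁄ 16 * N))
        e = solve-∀ ring

      β>0 : 0ℚ < κ β
      β>0 = positive-of-square (κ≥0 β) (<-≤-trans N>0 N≤4β²)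
        where
        positive-of-square : ∀ {a} → 0ℚ ≤ a → 0ℚ < κ 4 * (a * a) → 0ℚ < a
        positive-of-square {a} a≥0 h = ≰⇒> λ a≤0 → <-irrefl refl (<-≤-trans h (by (κ≥0 4 ⊗ a≥0 ⊗ gap a≤0) (e₀ a)))
          where e₀ : ∀ a → 0ℚ ≡ κ 4 * (a * a) + κ 4 * a * (0ℚ - a)
                e₀ = solve-∀ ring

      ν i b U : ℚ
      ν = proj₁ (inv N>0)
      i = proj₁ (inv β>0)
      b = κ β * ν
      U = N * i

      ν≥0 : 0ℚ ≤ ν
      ν≥0 = <⇒≤ (proj₁ (proj₂ (inv N>0)))
      i≥0 : 0ℚ ≤ i
      i≥0 = <⇒≤ (proj₁ (proj₂ (inv β>0)))
      Nν : N * ν ≡ 1ℚ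
      Nν = proj₂ (proj₂ (inv N>0))
      βi : κ β * i ≡ 1ℚ
      βi = proj₂ (proj₂ (inv β>0))

      b>0 : 0ℚ < b
      b>0 = β>0 ⊗⁺ proj₁ (proj₂ (inv N>0))

      b≥0 : 0ℚ ≤ b
      b≥0 = <⇒≤ b>0

      bU : b * U ≡ 1ℚ
      bU = trans (e (κ β) ν N i) (trans (cong₂ _*_ βi Nν) (*-identityˡ 1ℚ))
        where e : ∀ β ν N i → β * ν * (N * i) ≡ β * i * (N * ν)
              e = solve-∀ ring

      Nb : N * b ≡ κ β
      Nb = trans (e N (κ β) ν) (trans (cong (_* κ β) Nν) (*-identityˡ (κ β)))
        where e : ∀ N β ν → N * (β * ν) ≡ N * ν * β
              e = solve-∀ ring

      β²≤2N : κ β * κ β ≤ κ 2 * N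
      β²≤2N = by (gap fits ⊕ Hn≥0 ⊗ κ≥0 β ⊕ x≥0 ⊗ N≥0 ⊕ gap Z≤2 ⊗ N≥0) (e (κ β) Hn x N Z)
        where e : ∀ b h x N Z → κ 2 * N ≡ b * b + (Z * N - (b * b + h * b + x * N) + h * b + x * N + (κ 2 - Z) * N)
              e = solve-∀ ring

      balance : N * b * b + Hn * b + x ≤ Z
      balance = subst₂ _≤_ (trans (e (κ β) Hn x N ν) (trans (cong₂ (λ s t → s * b + Hn * b + x * t) (sym Nb) Nν) (e₁ (N * b * b + Hn * b) x))) (trans (*-assoc Z N ν) (trans (cong (Z *_) Nν) (*-identityʳ Z))) (*-monoˡ ν≥0 fits)
        where e : ∀ β h x N ν → (β * β + h * β + x * N) * ν ≡ β * (β * ν) + h * (β * ν) + x * (N * ν)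
              e = solve-∀ ring
              e₁ : ∀ a x → a + x * 1ℚ ≡ a + x
              e₁ = solve-∀ ring

      tight : Z ≤ N * b * b + (Hn * b + x + (κ 2 * b + ν + Hn * ν))
      tight = subst₂ _≤_ (trans (*-assoc Z N ν) (trans (cong (Z *_) Nν) (*-identityʳ Z)))
          (trans (e (κ β) Hn x N ν) (trans (cong₂ (λ s t → s * b + (Hn * b + x * t + (κ 2 * b + ν + Hn * ν))) (sym Nb) Nν) (cong (λ t → N * b * b + (Hn * b + t + (κ 2 * b + ν + Hn * ν))) (*-identityʳ x)))) (*-monoˡ ν≥0 over)
        where e : ∀ β h x N ν → ((β + 1ℚ) * (β + 1ℚ) + h * (β + 1ℚ) + x * N) * ν ≡ β * (β * ν) + (h * (β * ν) + x * (N * ν) + (κ 2 * (β * ν) + ν + h * ν))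
              e = solve-∀ ring

      U²-hi : U * U ≤ κ 8 * N
      U²-hi = by (N≥0 ⊗ (i≥0 ⊗ i≥0) ⊗ gap N≤4β² ⊕ κ≥0 4 ⊗ N≥0) (trans (e N) (trans (cong (λ z → N * z * z * κ 4 + κ 4 * N) (sym βi)) (e₁ N i (κ β))))
        where e : ∀ N → κ 8 * N ≡ N * 1ℚ * 1ℚ * κ 4 + κ 4 * N
              e = solve-∀ ring
              e₁ : ∀ N i β → N * (β * i) * (β * i) * κ 4 + κ 4 * N ≡ N * i * (N * i) + (N * (i * i) * (κ 4 * (β * β) - N) + κ 4 * N)
              e₁ = solve-∀ ring

      U²-lo : N ≤ κ 2 * (U * U)
      U²-lo = by (N≥0 ⊗ (i≥0 ⊗ i≥0) ⊗ gap β²≤2N) (trans (e₁ N i (κ β)) (trans (cong (λ z → N * z * z + N * (i * i) * (κ 2 * N - κ β * κ β)) βi) (e N (N * (i * i) * (κ 2 * N - κ β * κ β)))))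
        where e : ∀ N a → N * 1ℚ * 1ℚ + a ≡ N + a
              e = solve-∀ ring
              e₁ : ∀ N i β → κ 2 * (N * i * (N * i)) ≡ N * (β * i) * (β * i) + N * (i * i) * (κ 2 * N - β * β)
              e₁ = solve-∀ ring

      ν-hi : ν ≤ pw 4000
      ν-hi = ≤-trans (≤-reflexive (sym (*-identityʳ ν))) (≤-trans (*-monoʳ ν≥0 n-lo) (≤-reflexive (trans (e ν N (pw 4000)) (trans (cong (_* pw 4000) Nν) (*-identityˡ (pw 4000))))))
        where e : ∀ ν N p → ν * (N * p) ≡ N * ν * p
              e = solve-∀ ring

      ν-lo : pw 4001 ≤ ν
      ν-lo = ≤-trans (≤-reflexive (trans (sym (*-identityˡ (pw 4001))) (trans (cong (_* pw 4001) (sym Nν)) (e ν N (pw 4001))))) (≤-trans (*-monoʳ ν≥0 n-hi) (≤-reflexive (*-identityʳ ν)))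
        where e : ∀ ν N p → N * ν * p ≡ ν * (N * p)
              e = solve-∀ ring

      b-hi : b ≤ pw 1999
      b-hi = sq-cancel-≤ (pw≥0 1999) (≤-trans (by (ν≥0 ⊗ ν≥0 ⊗ gap β²≤2N) (trans (cong (λ z → κ 2 * (ν * z)) (sym Nν)) (e (κ β) ν N)))
          (≤-trans (≤-reflexive (cong (κ 2 *_) (*-identityʳ ν))) (≤-trans (*-monoʳ (κ≥0 2) ν-hi) (≤-trans (absorb 2 3999 (ℕ.m≤m+n 2 4008)) (≤-trans (pw-≤ (ℕ.n≤1+n 3998)) (≤-reflexive (sym (pw-+ 1999 1999))))))))
        where e : ∀ β ν N → κ 2 * (ν * (N * ν)) ≡ β * ν * (β * ν) + ν * ν * (κ 2 * N - β * β)
              e = solve-∀ ring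

      b-lo : pw 2002 ≤ b
      b-lo = sq-cancel-≤ b≥0 (≤-trans (≤-reflexive (pw-+ 2002 2002)) (≤-trans (pw-≤ (ℕ.m≤m+n 4002 2)) (≤-trans quarter
          (by (nonNegative⁻¹ (1 ⁄ 4) ⊗ (ν≥0 ⊗ ν≥0 ⊗ gap N≤4β²)) (trans (e (κ β) ν N) (cong (λ z → 1 ⁄ 4 * (ν * z) + 1 ⁄ 4 * (ν * ν * (κ 4 * (κ β * κ β) - N))) Nν))))))
        where e : ∀ β ν N → β * ν * (β * ν) ≡ 1 ⁄ 4 * (ν * (N * ν)) + 1 ⁄ 4 * (ν * ν * (κ 4 * (β * β) - N))
              e = solve-∀ ring
              e₁ : ∀ p → p ≡ 1 ⁄ 4 * (κ 4 * p)
              e₁ = solve-∀ ring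
              quarter : pw 4002 ≤ 1 ⁄ 4 * (ν * 1ℚ)
              quarter = ≤-trans (≤-reflexive (e₁ (pw 4002))) (*-monoʳ (nonNegative⁻¹ (1 ⁄ 4)) (≤-trans (absorb 4 4001 (ℕ.m≤m+n 4 4006)) (≤-trans ν-lo (≤-reflexive (sym (*-identityʳ ν))))))

      b≤1 : b ≤ 1ℚ
      b≤1 = ≤-trans b-hi (≤-trans (≤-reflexive (sym (*-identityˡ (pw 1999)))) (pw≤ 1 (ℕ.m≤m+n 1 4009) (ℕ.s≤s ℕ.z≤n)))

      ρ>0 : 0ℚ < 1ℚ + b
      ρ>0 = +-mono-<-≤ (positive⁻¹ 1ℚ) b≥0

      r : ℚ
      r = proj₁ (inv ρ>0)

      r≥0 : 0ℚ ≤ r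
      r≥0 = <⇒≤ (proj₁ (proj₂ (inv ρ>0)))

      ρr : (1ℚ + b) * r ≡ 1ℚ
      ρr = proj₂ (proj₂ (inv ρ>0))

      -- The first power of 1 + b to reach 2 gives the half-life h₀, so r^h₀ is at most 1/2 and
      -- undershoots it by at most one factor r.
      Under : ℕ → Set
      Under m = (1ℚ + b) ^ m < κ 2

      under-0 : Under 0
      under-0 = toWitness {a? = 1ℚ <? κ 2} _

      1≤β : 1ℚ ≤ κ β
      1≤β = from-pos (κ-0<⁻¹ β>0)
        where from-pos : (∃ λ m → β ≡ suc m) → 1ℚ ≤ κ β
              from-pos (m , eq) = subst (λ z → 1ℚ ≤ κ z) (sym eq) (κ-mono {1} {suc m} (ℕ.s≤s ℕ.z≤n))

      ¬under-n : ¬ Under n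
      ¬under-n h = <-irrefl refl (<-≤-trans h (≤-trans (by (gap 1≤β) (e (κ β))) (≤-trans (≤-reflexive (cong (1ℚ +_) (sym Nb))) (bernoulli b n b≥0))))
        where e : ∀ β → 1ℚ + β ≡ κ 2 + (β - 1ℚ)
              e = solve-∀ ring

      found-h : ∃ λ m → m ℕ.< n × Under m × ¬ Under (suc m)
      found-h = last-true Under (λ m → (1ℚ + b) ^ m <? κ 2) under-0 n ¬under-n

      module WithScale (m g : ℕ) (under : Under m) (¬under : ¬ Under (suc m)) (G-eq : suc (suc g) ≡ k ℕ.* 1030) where

        h₀ : ℕ
        h₀ = suc m

        ρ^h₀ : κ 2 ≤ (1ℚ + b) ^ h₀
        ρ^h₀ = ≮⇒≥ ¬under

        inverse^ : ∀ j → (1ℚ + b) ^ j * r ^ j ≡ 1ℚ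
        inverse^ j = trans (sym (*-^ (1ℚ + b) r j)) (trans (cong (_^ j) ρr) (1^ j))

        half : r ^ h₀ ≤ ½
        half = by (½≥0 ⊗ gap ρ^h₀ ⊗ ^≥0 h₀ r≥0) (trans (cong (½ *_) (sym (inverse^ h₀))) (e ((1ℚ + b) ^ h₀) (r ^ h₀)))
          where e : ∀ P w → ½ * (P * w) ≡ w + ½ * (P - κ 2) * w
                e = solve-∀ ring

        half⁻ : r ≤ κ 2 * r ^ h₀
        half⁻ = by (r≥0 ⊗ (gap (<⇒≤ under) ⊗ ^≥0 m r≥0)) (trans (e r ((1ℚ + b) ^ m) (r ^ m)) (trans (cong (λ z → r * z + r * ((κ 2 - (1ℚ + b) ^ m) * r ^ m)) (inverse^ m)) (cong (_+ r * ((κ 2 - (1ℚ + b) ^ m) * r ^ m)) (*-identityʳ r))))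
          where e : ∀ r P w → κ 2 * (r * w) ≡ r * (P * w) + r * ((κ 2 - P) * w)
                e = solve-∀ ring

        h₀≤ : κ h₀ ≤ 1ℚ + U
        h₀≤ = +-monoʳ-≤ 1ℚ (*-cancelˡ b>0 (≤-trans (≤-trans (≤-reflexive (*-comm b (κ m))) (by (gap (<⇒≤ under) ⊕ gap (bernoulli b m b≥0)) (e (κ m * b) ((1ℚ + b) ^ m)))) (≤-reflexive (sym bU))))
          where e : ∀ a P → 1ℚ ≡ a + (κ 2 - P + (P - (1ℚ + a)))
                e = solve-∀ ring

        h₀≥ : U ≤ κ 2 * κ h₀
        h₀≥ = *-cancelˡ b>0 (≤-trans (≤-reflexive bU) (by (κ≥0 2 ⊗ gap (bernoulli⁻ b h₀ b≥0 b≤1) ⊕ gap ρ^h₀ ⊗ ^≥0 h₀ (gap b≤1) ⊕ gap prod) (e b (κ h₀) ((1ℚ + b) ^ h₀) ((1ℚ - b) ^ h₀))))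
          where e : ∀ b h P q → b * (κ 2 * h) ≡ 1ℚ + (κ 2 * (q - (1ℚ - h * b)) + (P - κ 2) * q + (1ℚ - P * q))
                e = solve-∀ ring
                prod : (1ℚ + b) ^ h₀ * (1ℚ - b) ^ h₀ ≤ 1ℚ
                prod = subst (_≤ 1ℚ) (*-^ (1ℚ + b) (1ℚ - b) h₀) (^≤1 h₀ (<⇒≤ ρ>0 ⊗ gap b≤1) (by (sq≥0 b) (e′ b)))
                  where e′ : ∀ b → 1ℚ ≡ (1ℚ + b) * (1ℚ - b) + b * b
                        e′ = solve-∀ ring

        -- This is θ′ - h₀ = (G - 1) h₀ - 1 without subtraction; G is written with two successors so
        -- that θ′ and s are visibly natural numbers.
        s : ℕ
        s = m ℕ.+ g ℕ.* suc m

        private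
          e-θ : ∀ m g → suc (suc (m ℕ.+ (m ℕ.+ g ℕ.* suc m))) ≡ suc (suc g) ℕ.* suc m
          e-θ = ℕ.solve-∀
          e-s : ∀ m g → suc (m ℕ.+ (m ℕ.+ g ℕ.* suc m)) ≡ m ℕ.+ g ℕ.* suc m ℕ.+ suc m
          e-s = ℕ.solve-∀

        bound : Bound k n
        bound = Estimates.Core.Analysis.pairs-upper k k-large n′ (m ℕ.+ s) (suc (suc g)) h₀ s b r U (e-θ m g) G-eq (e-s m g) n-lo n-hi H-small b>0 bU r≥0 ρr b-lo b-hi balance ν ν≥0 Nν tight U²-hi U²-lo h₀≤ h₀≥ half half⁻

      bound : Bound k n
      bound = choose found-h (split k k-large)
        where
        split : ∀ k → 4010 ℕ.≤ k → ∃ λ g → suc (suc g) ≡ k ℕ.* 1030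
        split (suc k) _ = 1028 ℕ.+ k ℕ.* 1030 , refl
        choose : (∃ λ m → m ℕ.< n × Under m × ¬ Under (suc m)) → (∃ λ g → suc (suc g) ≡ k ℕ.* 1030) → Bound k n
        choose (m , _ , um , ¬um) (g , eq) = WithScale.bound m g um ¬um eq

    bound : Bound k n
    bound = choose found
      where choose : (∃ λ m → m ℕ.< n × Fits m × ¬ Fits (suc m)) → Bound k n
            choose (β , _ , fits , ¬fits) = WithSlope.bound β fits ¬fits

-- From the bound at each scale to the integral power form of the theorem.

open import Data.Nat using (ℕ; zero; suc; _+_; _*_; _^_; _≤_; _<_; z≤n; s≤s; _≤?_)
open import Data.Nat.Properties
open import Data.Nat.Tactic.RingSolver using (solve-∀)
open import Data.List using (List; []; _∷_; length; map; cartesianProduct)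
open import Data.List.Properties using (length-++; length-map; length-filter)
open import Data.Product using (_×_; _,_; ∃; proj₁; proj₂)
open import Data.Empty using (⊥-elim)
open import Relation.Nullary using (Dec; yes; no; ¬_)
open import Relation.Nullary.Decidable using (toWitness)
open import Relation.Binary.PropositionalEquality using (_≡_; refl; sym; trans; cong; cong₂; subst; subst₂)
open import Defs using (p; dominatedPairs; partitions; _⪯?_)
import Data.Rational as ℚ
import Data.Rational.Properties as ℚ
module Q = Rationals
open Comparison using (θ)
open Magnitudes using (last-true)
open Parameters using (constant; Bound; module Choice)

dominated≤ : ∀ n → dominatedPairs n ≤ p n * p n
dominated≤ n = ≤-trans (length-filter (λ ab → proj₁ ab ⪯? proj₂ ab) (cartesianProduct (partitions n) (partitions n))) (≤-reflexive (size (partitions n) (partitions n)))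
  where
  size : ∀ (xs ys : List (List ℕ)) → length (cartesianProduct xs ys) ≡ length xs * length ys
  size []       ys = refl
  size (x ∷ xs) ys = trans (length-++ (map (x ,_) ys)) (cong₂ _+_ (length-map (x ,_) ys) (size xs ys))

natural-constant : ∀ a b c → ∃ λ C → Q.κ 2 ℚ.* (Q.κ a ℚ.* Q.κ b ℚ.* Q.κ c ℚ.* (Q.κ a ℚ.* Q.κ b ℚ.* Q.κ c)) ℚ.+ ℚ.1ℚ ≡ Q.κ C
natural-constant a b c = 2 * (a * b * c * (a * b * c)) + 1 ,
  sym (trans (Q.κ-+ (2 * (a * b * c * (a * b * c))) 1) (cong (ℚ._+ ℚ.1ℚ) (trans (Q.κ-* 2 (a * b * c * (a * b * c))) (cong (Q.κ 2 ℚ.*_) (trans (Q.κ-* (a * b * c) (a * b * c)) (cong₂ ℚ._*_ e e))))))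
  where e : Q.κ (a * b * c) ≡ Q.κ a ℚ.* Q.κ b ℚ.* Q.κ c
        e = trans (Q.κ-* (a * b) c) (cong (ℚ._* Q.κ c) (Q.κ-* a b))

opaque
  constant-natural : ∃ λ C → constant ≡ Q.κ C
  constant-natural = natural-constant 32 8 24

C₀ : ℕ
C₀ = proj₁ constant-natural

constant≡ : constant ≡ Q.κ C₀
constant≡ = proj₂ constant-natural

clear : ∀ k n → Bound k n → dominatedPairs n * 9 ^ (k * 80) ≤ C₀ * (p n * p n) * 8 ^ (k * 80)
clear k n h = Q.κ-cancel-≤ (subst₂ ℚ._≤_ (sym (trans (Q.κ-* (dominatedPairs n) (9 ^ e)) (cong (Q.κ (dominatedPairs n) ℚ.*_) (Q.κ-^ 9 e))))
    (trans (ℚ.*-assoc (constant ℚ.* (Q.κ (p n) ℚ.* Q.κ (p n))) (θ Q.^ e) (Q.κ 9 Q.^ e))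
      (trans (cong₂ (λ a b → a ℚ.* (Q.κ (p n) ℚ.* Q.κ (p n)) ℚ.* b) constant≡ (sym (Q.*-^ θ (Q.κ 9) e)))
        (sym (trans (Q.κ-* (C₀ * (p n * p n)) (8 ^ e)) (cong₂ ℚ._*_ (trans (Q.κ-* C₀ (p n * p n)) (cong (Q.κ C₀ ℚ.*_) (Q.κ-* (p n) (p n)))) (Q.κ-^ 8 e))))))
    (Q.*-monoˡ (Q.^≥0 e (Q.κ≥0 9)) h))
  where e = k * 80

-- The exponents are kept as variables, N = 5 a, so that no numeral of the size of 10 ^ 12 is ever unfolded.
module Exponents (c a E N : ℕ) (N≡ : N ≡ 5 * a) (E≤ : c * E ≤ 66 * a) where

  ^-distrib : ∀ x y n → (x * y) ^ n ≡ x ^ n * y ^ n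
  ^-distrib x y zero    = refl
  ^-distrib x y (suc n) = trans (cong (x * y *_) (^-distrib x y n)) (e x y (x ^ n) (y ^ n))
    where e : ∀ x y a b → x * y * (a * b) ≡ x * a * (y * b)
          e = solve-∀

  -- With N = 5 a the blocks contribute 80 · 5 = 400 factors for each unit of k a, and (9/8)^400 ≥
  -- 2^66. Compared with n ≈ 2^(4000 k) the exponent is 66 / (5 · 4000) = 0.0033.
  nine : ∀ k → 8 ^ (k * 80 * N) * 2 ^ (k * (66 * a)) ≤ 9 ^ (k * 80 * N)
  nine k = subst₂ _≤_ (trans (^-distrib (8 ^ 400) (2 ^ 66) (k * a)) (cong₂ _*_ (trans (^-*-assoc 8 400 (k * a)) (cong (8 ^_) e400)) (trans (^-*-assoc 2 66 (k * a)) (cong (2 ^_) (e k 66 a)))))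
      (trans (^-*-assoc 9 400 (k * a)) (cong (9 ^_) e400)) (^-monoˡ-≤ (k * a) (toWitness {a? = 8 ^ 400 * 2 ^ 66 ≤? 9 ^ 400} _))
    where
    e : ∀ k b a → b * (k * a) ≡ k * (b * a)
    e = solve-∀
    e′ : ∀ k b c a → b * c * (k * a) ≡ k * b * (c * a)
    e′ = solve-∀
    e400 : 400 * (k * a) ≡ k * 80 * N
    e400 = trans (e′ k 80 5 a) (cong (k * 80 *_) (sym N≡))

  -- The upper end of the scale of n is one step beyond what `nine` compensates; that step costs
  -- 2^(66 a), independent of n.
  final : ∀ k n D P → n ≤ 2 ^ (suc k * c) → D * 9 ^ (k * 80) ≤ C₀ * P * 8 ^ (k * 80) →
    D ^ N * n ^ E ≤ C₀ ^ N * 2 ^ (66 * a) * P ^ N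
  final k n D P hn h = *-cancelʳ-≤ (D ^ N * n ^ E) (C₀ ^ N * 2 ^ (66 * a) * P ^ N) (9 ^ (k * 80 * N)) {{m^n≢0 9 (k * 80 * N)}}
    (≤-trans (≤-reflexive (trans (swap (D ^ N) (n ^ E) (9 ^ (k * 80 * N))) (cong (_* n ^ E) (trans (cong (D ^ N *_) (sym (^-*-assoc 9 (k * 80) N))) (sym (^-distrib D (9 ^ (k * 80)) N))))))
    (≤-trans (*-mono-≤ (^-monoˡ-≤ N h) nE)
    (≤-trans (≤-reflexive (trans (cong (_* 2 ^ (suc k * (66 * a))) (trans (^-distrib (C₀ * P) (8 ^ (k * 80)) N) (cong₂ _*_ (^-distrib C₀ P N) (^-*-assoc 8 (k * 80) N))))
         (trans (cong (C₀ ^ N * P ^ N * 8 ^ (k * 80 * N) *_) (^-distribˡ-+-* 2 (66 * a) (k * (66 * a)))) (shuffle (C₀ ^ N) (P ^ N) (8 ^ (k * 80 * N)) (2 ^ (66 * a)) (2 ^ (k * (66 * a)))))))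
      (*-monoʳ-≤ (C₀ ^ N * 2 ^ (66 * a) * P ^ N) (nine k)))))
    where
    swap : ∀ x y z → x * y * z ≡ x * z * y
    swap = solve-∀
    shuffle : ∀ c p e b d → c * p * e * (b * d) ≡ c * b * p * (e * d)
    shuffle = solve-∀
    assoc : ∀ k b c → suc k * b * c ≡ suc k * (b * c)
    assoc k b c = *-assoc (suc k) b c
    nE : n ^ E ≤ 2 ^ (suc k * (66 * a))
    nE = ≤-trans (^-monoˡ-≤ E hn) (≤-trans (≤-reflexive (trans (^-*-assoc 2 (suc k * c) E) (cong (2 ^_) (assoc k c E)))) (^-monoʳ-≤ 2 (*-monoʳ-≤ (suc k) E≤)))

  small : ∀ n₀ n → n ≤ n₀ → dominatedPairs n ^ N * n ^ E ≤ n₀ ^ E * (p n * p n) ^ N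
  small n₀ n l = ≤-trans (*-mono-≤ (^-monoˡ-≤ N (dominated≤ n)) (^-monoˡ-≤ E l)) (≤-reflexive (*-comm ((p n * p n) ^ N) (n₀ ^ E)))

n<2^n : ∀ n → n < 2 ^ n
n<2^n zero    = s≤s z≤n
n<2^n (suc n) = ≤-trans (+-mono-≤ (m^n>0 2 n) (n<2^n n)) (≤-reflexive (cong (2 ^ n +_) (sym (+-identityʳ (2 ^ n)))))

-- The literal 4000 is also hidden behind a variable c, since 2 ^ (suc k * 4000) would unfold.
module Assembly (c : ℕ) (c≡ : 4000 ≡ c) (a E N : ℕ) (N≡ : N ≡ 5 * a) (E≤ : c * E ≤ 66 * a) where
  open Exponents c a E N N≡ E≤

  opaque
    n₀ : ℕ
    n₀ = 2 ^ (4010 * c)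

    n₀-spec : ∀ k n → n₀ ≤ n → n < 2 ^ (suc k * c) → 4010 ≤ k
    n₀-spec k n l h with 4010 ≤? k
    ... | yes q = q
    ... | no q  = ⊥-elim (<-irrefl refl (≤-trans h (≤-trans (^-monoʳ-≤ 2 (*-monoˡ-≤ c (≰⇒> q))) l)))

  scale : ∀ n → 1 ≤ n → ∃ λ k → 2 ^ (k * c) ≤ n × n < 2 ^ (suc k * c)
  scale n 1≤n = pick (last-true (λ k → 2 ^ (k * c) ≤ n) (λ k → 2 ^ (k * c) ≤? n) 1≤n n too-big)
    where
    too-big : ¬ 2 ^ (n * c) ≤ n
    too-big h = <-irrefl refl (<-≤-trans (n<2^n n) (≤-trans (^-monoʳ-≤ 2 (subst (λ z → n ≤ n * z) c≡ (m≤m*n n 4000))) h))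
    pick : (∃ λ k → k < n × 2 ^ (k * c) ≤ n × ¬ 2 ^ (suc k * c) ≤ n) → ∃ λ k → 2 ^ (k * c) ≤ n × n < 2 ^ (suc k * c)
    pick (k , _ , lo , hi) = k , lo , ≰⇒> hi

  Estimate : ℕ → ℕ → Set
  Estimate k n = dominatedPairs n * 9 ^ (k * 80) ≤ C₀ * (p n * p n) * 8 ^ (k * 80)

  large : ∀ n → n₀ ≤ n → 1 ≤ n → ∃ λ k → n ≤ 2 ^ (suc k * c) × Estimate k n
  large (suc n) n₀≤n 1≤n = go (scale (suc n) 1≤n)
    where
    go : (∃ λ k → 2 ^ (k * c) ≤ suc n × suc n < 2 ^ (suc k * c)) → ∃ λ k → suc n ≤ 2 ^ (suc k * c) × Estimate k (suc n)
    go (k , lo , hi) = k , <⇒≤ hi , clear k (suc n) (Choice.bound k k-large n (subst (λ z → 2 ^ (k * z) ≤ suc n) (sym c≡) lo) (≤-trans (<⇒≤ hi) (^-monoʳ-≤ 2 wider)))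
      where
      k-large = n₀-spec k (suc n) n₀≤n hi
      -- As k ≥ 4000, the scale up to 2^(4000 (k + 1)) still lies below 2^(4001 k).
      wider : suc k * c ≤ k * 4001
      wider = ≤-trans (+-monoˡ-≤ (k * c) (≤-trans (≤-trans (≤-reflexive (sym c≡)) (m≤m+n 4000 10)) k-large)) (≤-reflexive (trans (cong (λ z → k + k * z) (sym c≡)) (sym (*-suc k 4000))))

  D : ℕ
  D = C₀ ^ N * 2 ^ (66 * a) + n₀ ^ E

  estimate : ∀ n → 1 ≤ n → dominatedPairs n ^ N * n ^ E ≤ D * (p n * p n) ^ N
  estimate n 1≤n = by-size (n₀ ≤? n)
    where
    finish : (∃ λ k → n ≤ 2 ^ (suc k * c) × Estimate k n) → dominatedPairs n ^ N * n ^ E ≤ D * (p n * p n) ^ N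
    finish (k , hn , h) = ≤-trans (final k n (dominatedPairs n) (p n * p n) hn h) (*-monoˡ-≤ ((p n * p n) ^ N) (m≤m+n (C₀ ^ N * 2 ^ (66 * a)) (n₀ ^ E)))
    by-size : Dec (n₀ ≤ n) → dominatedPairs n ^ N * n ^ E ≤ D * (p n * p n) ^ N
    by-size (yes l) = finish (large n l 1≤n)
    by-size (no l)  = ≤-trans (small n₀ n (<⇒≤ (≰⇒> l))) (*-monoˡ-≤ ((p n * p n) ^ N) (m≤n+m (n₀ ^ E) (C₀ ^ N * 2 ^ (66 * a))))

estimate : ∀ c → 4000 ≡ c → ∀ a E N → N ≡ 5 * a → c * E ≤ 66 * a →
  ∃ λ (D : ℕ) → ∀ (n : ℕ) → 1 ≤ n → dominatedPairs n ^ N * n ^ E ≤ D * (p n * p n) ^ N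
estimate c c≡ a E N N≡ E≤ = Assembly.D c c≡ a E N N≡ E≤ , Assembly.estimate c c≡ a E N N≡ E≤

-- With r(n) = `dominatedPairs n` / p(n)², this is the real inequality raised to the power 10^12
-- with denominators cleared; D is C to that power.
theorem1p4 : ∃ λ (D : ℕ) → ∀ (n : ℕ) → 1 ≤ n →
    dominatedPairs n ^ (10 ^ 12) * n ^ 3297210314 ≤ D * (p n * p n) ^ (10 ^ 12)
-- a = 2 · 10^11 makes 5 a = 10^12. The last numeral is 66 a - 4000 · 3297210314, the margin of
-- 0.0033 over the required exponent after scaling.
theorem1p4 = estimate 4000 refl 200000000000 3297210314 (10 ^ 12) refl (m≤m+n (4000 * 3297210314) 11158744000)
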